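{- Let $q\ge 3$ be a prime power, let $m\ge 2$ and let $n$ be an odd positive integer. Let $\operatorname{TSRP}(m,n,q)$ be the set of primitive transformation shift register matrices of order $n$ over $\mathbb{F}_{q^m}$ (defined in the context), and let $\Psi_P(\operatorname{TSRP}(m,n,q))=\{\det(XI_{mn}-T): T\in \operatorname{TSRP}(m,n,q)\}$ be the set of their characteristic polynomials. Then $$\left|\operatorname{TSRP}(m,n,q)\right| = \left|\Psi_P\left(\operatorname{TSRP}(m,n,q)\right)\right| \prod_{i=1}^{m-1}(q^m-q^i).$$
   Context: A polynomial of degree $d$ over a finite field $\mathbb{F}_Q$ is primitive if it is monic and irreducible and one (equivalently every) root generates the cyclic group $\mathbb{F}_{Q^d}^*$. A TSR matrix of order $n$ over $\mathbb{F}_{q^m}$ is an $mn\times mn$ block matrix over $\mathbb{F}_q$ with $m\times m$ blocks of the form $$T=\begin{pmatrix} \mathbf{0} & \mathbf{0} & \cdots & \mathbf{0} & c_0A\\ I_m & \mathbf{0} & \cdots & \mathbf{0} & c_1A\\ \mathbf{0} & I_m & \cdots & \mathbf{0} & c_2A\\ \vdots & & \ddots & & \vdots\\ \mathbf{0} & \mathbf{0} & \cdots & I_m & c_{n-1}A\end{pmatrix},$$ where $c_0,\dots,c_{n-1}\in\mathbb{F}_q$, $A\in M_m(\mathbb{F}_q)$, $I_m$ is the identity and $\mathbf{0}$ the zero $m\times m$ matrix. Such a $T$ is called primitive if its characteristic polynomial $\det(XI_{mn}-T)\in\mathbb{F}_q[X]$ is a primitive polynomial (of degree $mn$) over $\mathbb{F}_q$.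 $\operatorname{TSRP}(m,n,q)$ denotes the set of all primitive TSR matrices of order $n$ over $\mathbb{F}_{q^m}$. -}

module Defs where

open import Level using (0ℓ)
open import Data.Nat as ℕ using (ℕ; zero; suc; _∸_; _^_; _≤_)
open import Data.Nat.Properties using () renaming (_≟_ to _≟ℕ_)
open import Data.Nat.ListAction using (product)
open import Data.Fin as Fin using (Fin; toℕ; punchIn; remQuot)
open import Data.List as List using (List; []; _∷_; _++_; length; upTo; drop; foldr; allFin; zipWith; tabulate)
open import Data.List.Membership.Propositional using (_∈_)
open import Data.List.Relation.Unary.Unique.Propositional using (Unique)
open import Data.Vec as Vec using (Vec; lookup)
open import Data.Product using (Σ; ∃; ∃-syntax; _×_; _,_)
open import Data.Sum using (_⊎_)
open import Data.Bool using (Bool; true; false; if_then_else_)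
open import Function.Bundles using (_⇔_)
open import Relation.Nullary using (¬_; does)
open import Relation.Binary.Definitions using (DecidableEquality)
open import Relation.Binary.PropositionalEquality using (_≡_; _≢_)
open import Algebra.Structures using (IsCommutativeRing)

record FiniteField : Set₁ where
  infixl 6 _+_
  infixl 7 _*_
  field
    Carrier : Set
    _+_ _*_ : Carrier → Carrier → Carrier
    -_      : Carrier → Carrier
    0# 1#   : Carrier
    isCommutativeRing : IsCommutativeRing _≡_ _+_ _*_ -_ 0# 1#
    0≢1     : 0# ≢ 1#
    inverse : ∀ x → x ≢ 0# → ∃[ y ] (x * y ≡ 1#)
    _≟_     : DecidableEquality Carrier
    elements : List Carrier
    complete : ∀ x → x ∈ elements
    unique   : Unique elements

card : FiniteField → ℕ
card F = length (FiniteField.elements F)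

HasSize : {A : Set} → (A → Set) → ℕ → Set
HasSize {A} P N = Σ (List A) λ xs → length xs ≡ N × Unique xs × (∀ x → (x ∈ xs) ⇔ P x)

Odd : ℕ → Set
Odd n = ∃[ k ] (n ≡ suc (2 ℕ.* k))

glFactor : ℕ → ℕ → ℕ
glFactor q m = product (List.map (λ i → q ^ m ∸ q ^ i) (drop 1 (upTo m)))

module FieldTheory (F : FiniteField) where
  open FiniteField F

  -- polynomials as coefficient lists, lowest degree first
  Poly : Set
  Poly = List Carrier

  norm : Poly → Poly
  norm [] = []
  norm (a ∷ f) with norm f
  ... | [] = if does (a ≟ 0#) then [] else a ∷ []
  ... | g ∷ gs = a ∷ g ∷ gs

  _≈ₚ_ : Poly → Poly → Set
  f ≈ₚ g = norm f ≡ norm g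

  _+ₚ_ : Poly → Poly → Poly
  [] +ₚ g = g
  (a ∷ f) +ₚ [] = a ∷ f
  (a ∷ f) +ₚ (b ∷ g) = (a + b) ∷ (f +ₚ g)

  -ₚ_ : Poly → Poly
  -ₚ f = List.map -_ f

  _-ₚ_ : Poly → Poly → Poly
  f -ₚ g = f +ₚ (-ₚ g)

  _*ₚ_ : Poly → Poly → Poly
  [] *ₚ g = []
  (a ∷ f) *ₚ g = List.map (a *_) g +ₚ (0# ∷ (f *ₚ g))

  const : Carrier → Poly
  const a = a ∷ []

  Xₚ : Poly
  Xₚ = 0# ∷ 1# ∷ []

  _^ₚ_ : Poly → ℕ → Poly
  f ^ₚ zero = const 1#
  f ^ₚ suc k = f *ₚ (f ^ₚ k)

  degree : Poly → ℕ
  degree f = length (norm f) ∸ 1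

  Monic : Poly → Set
  Monic f = ∃[ g ] (norm f ≡ g ++ (1# ∷ []))

  IsUnitₚ : Poly → Set
  IsUnitₚ g = ∃[ a ] (a ≢ 0# × g ≈ₚ const a)

  _∣ₚ_ : Poly → Poly → Set
  f ∣ₚ g = ∃[ h ] (g ≈ₚ (f *ₚ h))

  Irreducible : Poly → Set
  Irreducible f = ¬ (f ≈ₚ []) × ¬ IsUnitₚ f
                × (∀ g h → f ≈ₚ (g *ₚ h) → IsUnitₚ g ⊎ IsUnitₚ h)

  -- primitive polynomial of degree d: monic, irreducible, and the class
  -- of X (a root of f in F[X]/(f) ≅ F_{Q^d}) generates the multiplicative
  -- group of F[X]/(f), i.e. every class not divisible by f is a power of X.
  Primitive : ℕ → Poly → Set
  Primitive d f = degree f ≡ d × Monic f × Irreducible f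
                × (∀ g → ¬ (f ∣ₚ g) → ∃[ k ] (f ∣ₚ ((Xₚ ^ₚ k) -ₚ g)))

  sumₚ : List Poly → Poly
  sumₚ = foldr _+ₚ_ []

  sign : ℕ → Poly → Poly
  sign zero f = f
  sign (suc zero) f = -ₚ f
  sign (suc (suc k)) f = sign k f

  det : (k : ℕ) → (Fin k → Fin k → Poly) → Poly
  det zero M = const 1#
  det (suc k) M = sumₚ (tabulate λ j →
      sign (toℕ j) (M Fin.zero j *ₚ det k (λ r c → M (Fin.suc r) (punchIn j c))))

  Mat : ℕ → Set
  Mat k = Vec (Vec Carrier k) k

  entry : ∀ {k} → Mat k → Fin k → Fin k → Carrier
  entry T r s = lookup (lookup T r) s

  δ : ∀ {k} → Fin k → Fin k → Carrier
  δ i j = if does (i Fin.≟ j) then 1# else 0#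

  charPoly : ∀ {k} → Mat k → Poly
  charPoly {k} T = det k (λ r s → (if does (r Fin.≟ s) then Xₚ else []) -ₚ const (entry T r s))

  -- TSR matrix of order n over F_{q^m}: an (n·m)×(n·m) matrix whose
  -- row/column index r corresponds to (block b, inner index i) with
  -- r = b·m + i (Data.Fin.remQuot).  Block (B,C) is c_B·A if C is the
  -- last block column, I_m if B = C+1, and 0 otherwise.
  tsrBlockEntry : (m n : ℕ) → Vec Carrier n → Mat m →
                  Fin n × Fin m → Fin n × Fin m → Carrier
  tsrBlockEntry m n c A (B , i) (C , j) =
    if does (toℕ C ≟ℕ (n ∸ 1)) then lookup c B * entry A i j
    else (if does (toℕ B ≟ℕ suc (toℕ C)) then δ i j else 0#)

  tsrMatrix : (m n : ℕ) → Vec Carrier n → Mat m → Mat (n ℕ.* m)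
  tsrMatrix m n c A = Vec.tabulate λ r → Vec.tabulate λ s →
    tsrBlockEntry m n c A (remQuot m r) (remQuot m s)

  IsTSR : (m n : ℕ) → Mat (n ℕ.* m) → Set
  IsTSR m n T = ∃[ c ] ∃[ A ] (T ≡ tsrMatrix m n c A)

  TSRP : (m n : ℕ) → Mat (n ℕ.* m) → Set
  TSRP m n T = IsTSR m n T × Primitive (n ℕ.* m) (charPoly T)

  PsiP : (m n : ℕ) → Poly → Set
  PsiP m n f = ∃[ T ] (TSRP m n T × f ≡ norm (charPoly T))

{-# OPTIONS --safe #-}

-- A primitive characteristic polynomial of T means that the vectors T e₀, T² e₀, … exhaust the
-- nonzero vectors: χ(T) e₀ = 0 by expansion along the first row, so f ↦ f(T) e₀ identifies
-- F[X]/(χ) with the whole space.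
--
-- Normalise a TSR matrix by c₀ = 1 and write V = (F^m)^n, T^j (e₀ ⊗ u) = e_j ⊗ u for j < n and
-- T^n (e₀ ⊗ u) = Σ c_j e_j ⊗ A u. If T and T′ have the same primitive polynomial, then
-- S : f(T)ε ↦ f(T′)ε, with ε = e₀ ⊗ w, is well defined and linear. The exponents i for which T^i ε
-- lies in e₀ ⊗ F^m are the multiples of some d; these powers correspond to the nonzero elements of
-- a subfield with q^m elements, whose uniqueness in the cyclic group generated by X shows that d is
-- the same for T and T′. Hence S preserves e₀ ⊗ F^m, and applying it to T^n (e₀ ⊗ u) yields c = c′
-- and an R fixing w with A′ R = R A. Since A acts irreducibly, A′ determines R, so every fibre of
-- T ↦ χ has as many elements as there are bases of F^m starting with w: ∏ (q^m − q^i), 1 ≤ i < m.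

module Submission where

open import Level using (0ℓ)
open import Algebra.Bundles using (CommutativeRing)
import Algebra.Properties.Ring as RingProperties
open import Data.Bool using (if_then_else_)
open import Data.Empty using (⊥-elim)
open import Data.Fin as Fin using (Fin; zero; suc; toℕ; inject₁; fromℕ; punchIn; combine; remQuot; _↑ˡ_; _↑ʳ_)
import Data.Fin.Properties as Finₚ
open import Data.List as List using (List; []; _∷_; _++_; length)
import Data.List.Properties as Listₚ
open import Data.List.Membership.DecPropositional using () renaming (_∈?_ to member?)
open import Data.List.Membership.Propositional using (_∈_; _∉_; find; lose)
import Data.List.Membership.Propositional.Properties as ∈ₚ
open import Data.List.Membership.Setoid.Properties using (index-injective)
open import Data.List.Relation.Binary.Disjoint.Propositional using (Disjoint)
open import Data.List.Relation.Unary.All as All using (All; []; _∷_)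
import Data.List.Relation.Unary.All.Properties as Allₚ
open import Data.List.Relation.Unary.AllPairs as AllPairs using (AllPairs; []; _∷_)
import Data.List.Relation.Unary.AllPairs.Properties as AllPairsₚ
open import Data.List.Relation.Unary.Any as Any using (Any; here; there)
open import Data.List.Relation.Unary.Unique.Propositional using (Unique)
import Data.List.Relation.Unary.Unique.Propositional.Properties as Uniqueₚ
open import Data.Nat as ℕ using (ℕ; zero; suc; z≤n; s≤s)
import Data.Nat.DivMod as DivMod
open import Data.Nat.Divisibility using (_∣_; divides; m%n≡0⇒n∣m)
open import Data.Nat.Induction using (<-rec)
open import Data.Nat.ListAction using (product)
import Data.Nat.Properties as ℕₚ
open import Data.Product using (∃; ∃-syntax; _×_; _,_; proj₁; proj₂)
import Data.Product.Properties as Prodₚ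
open import Data.Sum using (_⊎_; inj₁; inj₂)
open import Data.Vec as Vec using (Vec; []; _∷_; lookup; tabulate; replicate; zipWith)
import Data.Vec.Properties as Vecₚ
open import Function using (_∘_; id)
open import Function.Bundles using (mk⇔)
open import Relation.Binary.Definitions using (DecidableEquality; tri<; tri≈; tri>)
open import Relation.Binary.PropositionalEquality
open import Relation.Nullary using (¬_; Dec; yes; no; does)
import Relation.Nullary.Decidable as Dec

open import Defs

-- The quotient F[X]/(χ) is never built as a field: everything is phrased through orbits and
-- annihilators of the single vector ε, and the equivalence of injectivity and surjectivity on a
-- finite set replaces dimension arguments. The converse of rigidity is also needed: if R is
-- invertible and fixes w, then 1 ⊗ R fixes ε and carries the shift with block A to the shift with
-- block R A R⁻¹, so conjugation by R stays inside the fibre. The condition R w = w is what makes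
-- the count exact. The commutant of the irreducibly acting A is the field F[A], whose q^m - 1
-- nonzero elements permute the nonzero vectors simply transitively. Hence each conjugate of A comes
-- from q^m - 1 elements of GL_m and from exactly one conjugator that fixes w. Dividing the order of
-- GL_m by q^m - 1 removes the factor with i = 0, which is why the product starts at i = 1.

-- Finite sets and the pigeonhole principle.

module FiniteSets where

  unique-lookup-injective : ∀ {A : Set} {xs : List A} → Unique xs →
    ∀ {i j} → List.lookup xs i ≡ List.lookup xs j → i ≡ j
  unique-lookup-injective (_ ∷ _) {zero} {zero} _ = refl
  unique-lookup-injective (x∉ ∷ _) {zero} {suc j} eq = ⊥-elim (All.lookup x∉ (∈ₚ.∈-lookup j) eq)
  unique-lookup-injective (x∉ ∷ _) {suc i} {zero} eq = ⊥-elim (All.lookup x∉ (∈ₚ.∈-lookup i) (sym eq))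
  unique-lookup-injective (_ ∷ u) {suc i} {suc j} eq = cong suc (unique-lookup-injective u eq)

  unique-⊆-length : ∀ {A : Set} {xs ys : List A} → Unique xs → (∀ {x} → x ∈ xs → x ∈ ys) →
    length xs ℕ.≤ length ys
  unique-⊆-length {xs = xs} {ys} u sub = Finₚ.injective⇒≤ {f = f} inj
    where
    f : Fin (length xs) → Fin (length ys)
    f i = Any.index (sub (∈ₚ.∈-lookup i))
    inj : ∀ {i j} → f i ≡ f j → i ≡ j
    inj eq = unique-lookup-injective u (index-injective (setoid _) (sub (∈ₚ.∈-lookup _)) (sub (∈ₚ.∈-lookup _)) eq)

  record Finite (A : Set) : Set where
    field
      _≟_ : DecidableEquality A
      all : List A
      all-complete : ∀ x → x ∈ all
      all-unique : Unique all

    ∣all∣ : ℕ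
    ∣all∣ = length all

    any? : {P : A → Set} → (∀ x → Dec (P x)) → Dec (∃ P)
    any? P? with Any.any? P? all
    ... | yes p = yes (Any.satisfied p)
    ... | no ¬p = no λ (x , px) → ¬p (lose (all-complete x) px)

    all? : {P : A → Set} → (∀ x → Dec (P x)) → Dec (∀ x → P x)
    all? P? with All.all? P? all
    ... | yes p = yes λ x → All.lookup p (all-complete x)
    ... | no ¬p = no λ p → ¬p (All.tabulate λ {x} _ → p x)

    -- If y had no preimage, y together with the images under `f` would form a duplicate-free list
    -- longer than `all`.
    endo-injective⇒surjective : (f : A → A) → (∀ {x y} → f x ≡ f y → x ≡ y) → ∀ y → ∃ λ x → f x ≡ y
    endo-injective⇒surjective f inj y with any? (λ x → f x ≟ y)
    ... | yes p = p
    ... | no ¬p = ⊥-elim (ℕₚ.<-irrefl (Listₚ.length-map f all)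
                    (unique-⊆-length {xs = y ∷ List.map f all} (y∉ ∷ Uniqueₚ.map⁺ inj all-unique) (λ _ → all-complete _)))
      where
      y∉ : All (y ≢_) (List.map f all)
      y∉ = Allₚ.map⁺ (All.tabulate λ {x} _ eq → ¬p (x , sym eq))

    -- A section of `f` is injective, hence onto by pigeonhole; so every element is a value of the
    -- section, and `f` separates those values.
    endo-surjective⇒injective : (f : A → A) → (∀ y → ∃ λ x → f x ≡ y) → ∀ {x y} → f x ≡ f y → x ≡ y
    endo-surjective⇒injective f sur {x} {y} eq = trans (sym (proj₂ (preimage x)))
        (trans (cong section (trans (sym (f-section⁻¹ x)) (trans eq (f-section⁻¹ y)))) (proj₂ (preimage y)))
      where
      section : A → A
      section z = proj₁ (sur z)
      section-injective : ∀ {z w} → section z ≡ section w → z ≡ w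
      section-injective {z} {w} eq = trans (sym (proj₂ (sur z))) (trans (cong f eq) (proj₂ (sur w)))
      preimage : ∀ z → ∃ λ w → section w ≡ z
      preimage = endo-injective⇒surjective section section-injective
      f-section⁻¹ : ∀ z → f z ≡ proj₁ (preimage z)
      f-section⁻¹ z = trans (cong f (sym (proj₂ (preimage z)))) (proj₂ (sur _))

    injection-from-Fin⇒≤ : ∀ {k} (f : Fin k → A) → (∀ {i j} → f i ≡ f j → i ≡ j) → k ℕ.≤ ∣all∣
    injection-from-Fin⇒≤ f inj = Finₚ.injective⇒≤ {f = λ i → Any.index (all-complete (f i))}
      (λ eq → inj (index-injective (setoid _) (all-complete _) (all-complete _) eq))

  open Finite

  vectors : ∀ {A : Set} → List A → ∀ n → List (Vec A n)
  vectors xs zero = [] ∷ []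
  vectors xs (suc n) = List.cartesianProductWith _∷_ xs (vectors xs n)

  length-vectors : ∀ {A : Set} (xs : List A) n → length (vectors xs n) ≡ length xs ℕ.^ n
  length-vectors xs zero = refl
  length-vectors xs (suc n) = trans (count xs) (cong (length xs ℕ.*_) (length-vectors xs n))
    where
    count : ∀ ys → length (List.cartesianProductWith {C = Vec _ (suc n)} _∷_ ys (vectors xs n)) ≡ length ys ℕ.* length (vectors xs n)
    count [] = refl
    count (y ∷ ys) = trans (Listₚ.length-++ (List.map (y ∷_) (vectors xs n)))
      (cong₂ ℕ._+_ (Listₚ.length-map (y ∷_) (vectors xs n)) (count ys))

  Vec-finite : ∀ {A : Set} → Finite A → ∀ n → Finite (Vec A n)
  Vec-finite fin n = record
    { _≟_ = Vecₚ.≡-dec (fin ._≟_) ; all = vectors (fin .all) n ; all-complete = complete′ ; all-unique = unique′ n }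
    where
    complete′ : ∀ {n} (x : Vec _ n) → x ∈ vectors (fin .all) n
    complete′ [] = here refl
    complete′ (x ∷ xs) = ∈ₚ.∈-cartesianProductWith⁺ _∷_ (fin .all-complete x) (complete′ xs)
    unique′ : ∀ n → Unique (vectors (fin .all) n)
    unique′ zero = [] ∷ []
    unique′ (suc n) = Uniqueₚ.cartesianProductWith⁺ _∷_ Vecₚ.∷-injective (fin .all-unique) (unique′ n)

  ×-finite : ∀ {A B : Set} → Finite A → Finite B → Finite (A × B)
  ×-finite fa fb = record
    { _≟_ = Prodₚ.≡-dec (fa ._≟_) (fb ._≟_)
    ; all = List.cartesianProduct (fa .all) (fb .all)
    ; all-complete = λ (a , b) → ∈ₚ.∈-cartesianProduct⁺ (fa .all-complete a) (fb .all-complete b)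
    ; all-unique = Uniqueₚ.cartesianProduct⁺ (fa .all-unique) (fb .all-unique) }

-- Vector spaces, linear maps and matrices over a finite field.

module LinearAlgebra (F : FiniteField) where
  open FiniteField F public
  open FieldTheory F public
  open FiniteSets public

  commutativeRing : CommutativeRing 0ℓ 0ℓ
  commutativeRing = record { isCommutativeRing = isCommutativeRing }
  open CommutativeRing commutativeRing public using
    (+-assoc; +-comm; +-identityˡ; +-identityʳ; *-assoc; *-comm; *-identityˡ; *-identityʳ;
     distribˡ; distribʳ; zeroˡ; zeroʳ; -‿inverseˡ; -‿inverseʳ)
  open RingProperties (CommutativeRing.ring commutativeRing) public using
    (-‿distribˡ-*; -‿distribʳ-*; -1*x≈-x; -0#≈0#; -‿involutive)

  field-finite : Finite Carrier
  field-finite = record { _≟_ = _≟_ ; all = elements ; all-complete = complete ; all-unique = unique }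

  -- Negation is not among the operations: the inverse of v is recovered as (-1) · v, for which
  -- distributivity and `0·v≡𝟎` suffice. The structure is abstract because the same lemmas serve
  -- scalars, vectors and vectors of blocks.
  record VectorSpace (V : Set) : Set where
    infixl 6 _⊕_
    infixr 7 _·_
    field
      _⊕_ : V → V → V
      _·_ : Carrier → V → V
      𝟎 : V
      ⊕-assoc : ∀ u v w → (u ⊕ v) ⊕ w ≡ u ⊕ (v ⊕ w)
      ⊕-comm : ∀ u v → u ⊕ v ≡ v ⊕ u
      ⊕-identityˡ : ∀ v → 𝟎 ⊕ v ≡ v
      ·-distrib-⊕ : ∀ a u v → a · (u ⊕ v) ≡ a · u ⊕ a · v
      ·-distrib-+ : ∀ a b v → (a + b) · v ≡ a · v ⊕ b · v
      ·-assoc : ∀ a b v → (a * b) · v ≡ a · (b · v)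
      1·v≡v : ∀ v → 1# · v ≡ v
      0·v≡𝟎 : ∀ v → 0# · v ≡ 𝟎

  open VectorSpace {{...}} public

  instance
    scalarSpace : VectorSpace Carrier
    scalarSpace = record
      { _⊕_ = _+_ ; _·_ = _*_ ; 𝟎 = 0# ; ⊕-assoc = +-assoc ; ⊕-comm = +-comm ; ⊕-identityˡ = +-identityˡ
      ; ·-distrib-⊕ = distribˡ ; ·-distrib-+ = λ a b v → distribʳ v a b ; ·-assoc = *-assoc
      ; 1·v≡v = *-identityˡ ; 0·v≡𝟎 = zeroˡ }

    vectorSpace : ∀ {V n} {{_ : VectorSpace V}} → VectorSpace (Vec V n)
    vectorSpace {V} {n} = record
      { _⊕_ = zipWith _⊕_ ; _·_ = λ a → Vec.map (a ·_) ; 𝟎 = replicate n 𝟎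
      ; ⊕-assoc = Vecₚ.zipWith-assoc ⊕-assoc ; ⊕-comm = Vecₚ.zipWith-comm ⊕-comm
      ; ⊕-identityˡ = Vecₚ.zipWith-identityˡ ⊕-identityˡ
      ; ·-distrib-⊕ = dist ; ·-distrib-+ = dist+ ; ·-assoc = assoc
      ; 1·v≡v = λ v → trans (Vecₚ.map-cong 1·v≡v v) (Vecₚ.map-id v)
      ; 0·v≡𝟎 = λ v → trans (Vecₚ.map-cong 0·v≡𝟎 v) (Vecₚ.map-const v 𝟎) }
      where
      dist : ∀ {n} a (u v : Vec V n) → Vec.map (a ·_) (zipWith _⊕_ u v) ≡ zipWith _⊕_ (Vec.map (a ·_) u) (Vec.map (a ·_) v)
      dist a [] [] = refl
      dist a (x ∷ u) (y ∷ v) = cong₂ _∷_ (·-distrib-⊕ a x y) (dist a u v)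
      dist+ : ∀ {n} a b (v : Vec V n) → Vec.map ((a + b) ·_) v ≡ zipWith _⊕_ (Vec.map (a ·_) v) (Vec.map (b ·_) v)
      dist+ a b [] = refl
      dist+ a b (x ∷ v) = cong₂ _∷_ (·-distrib-+ a b x) (dist+ a b v)
      assoc : ∀ {n} a b (v : Vec V n) → Vec.map ((a * b) ·_) v ≡ Vec.map (a ·_) (Vec.map (b ·_) v)
      assoc a b [] = refl
      assoc a b (x ∷ v) = cong₂ _∷_ (·-assoc a b x) (assoc a b v)

  module _ {V : Set} {{_ : VectorSpace V}} where

    ⊕-identityʳ : ∀ (v : V) → v ⊕ 𝟎 ≡ v
    ⊕-identityʳ v = trans (⊕-comm v 𝟎) (⊕-identityˡ v)

    a·𝟎≡𝟎 : ∀ a → a · 𝟎 ≡ 𝟎 {V}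
    a·𝟎≡𝟎 a = trans (cong (a ·_) (sym (0·v≡𝟎 𝟎))) (trans (sym (·-assoc a 0# 𝟎)) (trans (cong (_· 𝟎) (zeroʳ a)) (0·v≡𝟎 𝟎)))

    infix 8 ⊖_
    ⊖_ : V → V
    ⊖ v = (- 1#) · v

    ⊕-inverseʳ : ∀ v → v ⊕ ⊖ v ≡ 𝟎
    ⊕-inverseʳ v = trans (cong (_⊕ ⊖ v) (sym (1·v≡v v)))
      (trans (sym (·-distrib-+ 1# (- 1#) v)) (trans (cong (_· v) (-‿inverseʳ 1#)) (0·v≡𝟎 v)))

    ⊕-inverseˡ : ∀ v → ⊖ v ⊕ v ≡ 𝟎
    ⊕-inverseˡ v = trans (⊕-comm _ _) (⊕-inverseʳ v)

    ⊕-interchange : ∀ (a b c d : V) → (a ⊕ b) ⊕ (c ⊕ d) ≡ (a ⊕ c) ⊕ (b ⊕ d)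
    ⊕-interchange a b c d = trans (⊕-assoc a b _) (trans (cong (a ⊕_)
      (trans (sym (⊕-assoc b c d)) (trans (cong (_⊕ d) (⊕-comm b c)) (⊕-assoc c b d)))) (sym (⊕-assoc a c _)))

    ⊕-cancelʳ : ∀ (u v w : V) → u ⊕ w ≡ v ⊕ w → u ≡ v
    ⊕-cancelʳ u v w eq = trans (sym (undo u)) (trans (cong (_⊕ ⊖ w) eq) (undo v))
      where
      undo : ∀ x → (x ⊕ w) ⊕ ⊖ w ≡ x
      undo x = trans (⊕-assoc x w _) (trans (cong (x ⊕_) (⊕-inverseʳ w)) (⊕-identityʳ x))

    u⊕⊖v≡𝟎⇒u≡v : ∀ (u v : V) → u ⊕ ⊖ v ≡ 𝟎 → u ≡ v
    u⊕⊖v≡𝟎⇒u≡v u v eq = ⊕-cancelʳ u v (⊖ v) (trans eq (sym (⊕-inverseʳ v)))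

    ⊖-involutive : ∀ v → ⊖ (⊖ v) ≡ v
    ⊖-involutive v = sym (u⊕⊖v≡𝟎⇒u≡v v (⊖ ⊖ v) (trans (cong (v ⊕_) (trans (sym (·-assoc _ _ _)) (trans (cong (_· ⊖ v) (-1*-1)) (1·v≡v _)))) (⊕-inverseʳ v)))
      where
      -1*-1 : - 1# * - 1# ≡ 1#
      -1*-1 = trans (-1*x≈-x (- 1#)) (-‿involutive 1#)

    scale-cancel : ∀ {a} (v : V) → a ≢ 0# → a · v ≡ 𝟎 → v ≡ 𝟎
    scale-cancel {a} v a≢0 eq with inverse a a≢0
    ... | b , ab≡1 = trans (sym (1·v≡v v)) (trans (cong (_· v) (trans (sym ab≡1) (*-comm a b)))
                       (trans (·-assoc b a v) (trans (cong (b ·_) eq) (a·𝟎≡𝟎 b))))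

    scale-cancelʳ : ∀ {a b} (v : V) → v ≢ 𝟎 → a · v ≡ b · v → a ≡ b
    scale-cancelʳ {a} {b} v v≢𝟎 eq with (a + - b) ≟ 0#
    ... | yes p = trans (sym (+-identityʳ a)) (trans (cong (a +_) (sym (-‿inverseˡ b))) (trans (sym (+-assoc a _ b)) (trans (cong (_+ b) p) (+-identityˡ b))))
    ... | no q = ⊥-elim (v≢𝟎 (scale-cancel v q (trans (·-distrib-+ a (- b) v)
                   (trans (cong₂ _⊕_ eq (trans (cong (_· v) (sym (-1*x≈-x b))) (·-assoc _ b v))) (⊕-inverseʳ _)))))

    ∑ : ∀ {k} → (Fin k → V) → V
    ∑ {zero} f = 𝟎
    ∑ {suc k} f = f zero ⊕ ∑ (f ∘ suc)

    ∑-cong : ∀ {k} {f g : Fin k → V} → (∀ i → f i ≡ g i) → ∑ f ≡ ∑ g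
    ∑-cong {zero} eq = refl
    ∑-cong {suc k} eq = cong₂ _⊕_ (eq zero) (∑-cong (eq ∘ suc))

    ∑-𝟎 : ∀ {k} {f : Fin k → V} → (∀ i → f i ≡ 𝟎) → ∑ f ≡ 𝟎
    ∑-𝟎 {zero} eq = refl
    ∑-𝟎 {suc k} eq = trans (cong₂ _⊕_ (eq zero) (∑-𝟎 (eq ∘ suc))) (⊕-identityˡ 𝟎)

    ∑-⊕ : ∀ {k} (f g : Fin k → V) → ∑ (λ i → f i ⊕ g i) ≡ ∑ f ⊕ ∑ g
    ∑-⊕ {zero} f g = sym (⊕-identityˡ 𝟎)
    ∑-⊕ {suc k} f g = trans (cong₂ _⊕_ refl (∑-⊕ (f ∘ suc) (g ∘ suc))) (⊕-interchange _ _ _ _)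

    ∑-swap : ∀ {k l} (f : Fin k → Fin l → V) → ∑ (λ i → ∑ (f i)) ≡ ∑ (λ j → ∑ (λ i → f i j))
    ∑-swap {zero} {l} f = sym (∑-𝟎 {l} λ _ → refl)
    ∑-swap {suc k} f = trans (cong₂ _⊕_ refl (∑-swap (f ∘ suc))) (sym (∑-⊕ (f zero) _))

    ∑-single : ∀ {k} (f : Fin k → V) i → (∀ j → j ≢ i → f j ≡ 𝟎) → ∑ f ≡ f i
    ∑-single f zero eq = trans (cong (f zero ⊕_) (∑-𝟎 λ j → eq (suc j) λ ())) (⊕-identityʳ _)
    ∑-single f (suc i) eq = trans (cong₂ _⊕_ (eq zero λ ()) (∑-single (f ∘ suc) i λ j j≢i → eq (suc j) (j≢i ∘ Finₚ.suc-injective))) (⊕-identityˡ _)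

    ∑-last : ∀ {k} (f : Fin (suc k) → V) → ∑ f ≡ ∑ (f ∘ inject₁) ⊕ f (fromℕ k)
    ∑-last {zero} f = trans (⊕-identityʳ _) (sym (⊕-identityˡ _))
    ∑-last {suc k} f = trans (cong (f zero ⊕_) (∑-last (f ∘ suc))) (sym (⊕-assoc _ _ _))

    ∑-+ : ∀ a {b} (f : Fin (a ℕ.+ b) → V) → ∑ f ≡ ∑ (λ i → f (i ↑ˡ b)) ⊕ ∑ (λ i → f (a ↑ʳ i))
    ∑-+ zero f = sym (⊕-identityˡ _)
    ∑-+ (suc a) f = trans (cong (f zero ⊕_) (∑-+ a (f ∘ suc))) (sym (⊕-assoc _ _ _))

    ∑-combine : ∀ n {m} (f : Fin (n ℕ.* m) → V) → ∑ f ≡ ∑ (λ (i : Fin n) → ∑ (λ (j : Fin m) → f (combine i j)))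
    ∑-combine zero f = refl
    ∑-combine (suc n) {m} f = trans (∑-+ m f) (cong₂ _⊕_ refl (∑-combine n (f ∘ (m ↑ʳ_))))

  record Linear {V W : Set} {{_ : VectorSpace V}} {{_ : VectorSpace W}} (f : V → W) : Set where
    field
      ⊕-homo : ∀ u v → f (u ⊕ v) ≡ f u ⊕ f v
      ·-homo : ∀ a v → f (a · v) ≡ a · f v

    𝟎-homo : f 𝟎 ≡ 𝟎
    𝟎-homo = trans (cong f (sym (0·v≡𝟎 𝟎))) (trans (·-homo 0# 𝟎) (0·v≡𝟎 _))

    ∑-homo : ∀ {k} (g : Fin k → V) → f (∑ g) ≡ ∑ (f ∘ g)
    ∑-homo {zero} g = 𝟎-homo
    ∑-homo {suc k} g = trans (⊕-homo _ _) (cong₂ _⊕_ refl (∑-homo (g ∘ suc)))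

    kernel-trivial⇒injective : (∀ v → f v ≡ 𝟎 → v ≡ 𝟎) → ∀ {u v} → f u ≡ f v → u ≡ v
    kernel-trivial⇒injective ker {u} {v} eq = u⊕⊖v≡𝟎⇒u≡v u v (ker _ (trans (⊕-homo u _)
      (trans (cong₂ _⊕_ eq (·-homo _ v)) (⊕-inverseʳ (f v)))))

  open Linear public

  id-linear : ∀ {V : Set} {{_ : VectorSpace V}} → Linear {V} (λ v → v)
  id-linear = record { ⊕-homo = λ _ _ → refl ; ·-homo = λ _ _ → refl }

  ∘-linear : ∀ {U V W : Set} {{_ : VectorSpace U}} {{_ : VectorSpace V}} {{_ : VectorSpace W}}
    {g : V → W} {f : U → V} → Linear g → Linear f → Linear (g ∘ f)
  ∘-linear {g = g} lg lf = record
    { ⊕-homo = λ u v → trans (cong g (⊕-homo lf u v)) (⊕-homo lg _ _)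
    ; ·-homo = λ a v → trans (cong g (·-homo lf a v)) (·-homo lg _ _) }

  ·-linear : ∀ {V : Set} {{_ : VectorSpace V}} a → Linear {V} (a ·_)
  ·-linear a = record { ⊕-homo = ·-distrib-⊕ a
    ; ·-homo = λ b v → trans (sym (·-assoc a b v)) (trans (cong (_· v) (*-comm a b)) (·-assoc b a v)) }

  ⊕-linear : ∀ {V W : Set} {{_ : VectorSpace V}} {{_ : VectorSpace W}} {f g : V → W} →
    Linear f → Linear g → Linear (λ v → f v ⊕ g v)
  ⊕-linear lf lg = record
    { ⊕-homo = λ u v → trans (cong₂ _⊕_ (⊕-homo lf u v) (⊕-homo lg u v)) (⊕-interchange _ _ _ _)
    ; ·-homo = λ a v → trans (cong₂ _⊕_ (·-homo lf a v) (·-homo lg a v)) (sym (·-distrib-⊕ a _ _)) }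

  ∑-linear : ∀ {V W : Set} {{_ : VectorSpace V}} {{_ : VectorSpace W}} {k} {f : Fin k → V → W} →
    (∀ i → Linear (f i)) → Linear (λ v → ∑ (λ i → f i v))
  ∑-linear {k = zero} lf = record { ⊕-homo = λ _ _ → sym (⊕-identityˡ 𝟎) ; ·-homo = λ a _ → sym (a·𝟎≡𝟎 a) }
  ∑-linear {k = suc k} lf = ⊕-linear (lf zero) (∑-linear (lf ∘ suc))

  module _ {V : Set} where

    lookup-ext : ∀ {n} {x y : Vec V n} → (∀ i → lookup x i ≡ lookup y i) → x ≡ y
    lookup-ext {x = x} {y} eq = trans (sym (Vecₚ.tabulate∘lookup x)) (trans (Vecₚ.tabulate-cong eq) (Vecₚ.tabulate∘lookup y))

    module _ {{_ : VectorSpace V}} where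

      lookup-linear : ∀ {n} i → Linear {Vec V n} (λ x → lookup x i)
      lookup-linear i = record
        { ⊕-homo = Vecₚ.lookup-zipWith _⊕_ i ; ·-homo = λ a x → Vecₚ.lookup-map i (a ·_) x }

      tabulate-linear : ∀ {W : Set} {{_ : VectorSpace W}} {n} {f : Fin n → W → V} →
        (∀ i → Linear (f i)) → Linear (λ x → tabulate (λ i → f i x))
      tabulate-linear {f = f} lf = record
        { ⊕-homo = λ u v → lookup-ext λ i → trans (Vecₚ.lookup∘tabulate _ i) (trans (⊕-homo (lf i) u v)
            (sym (trans (⊕-homo (lookup-linear i) (tabulate λ j → f j u) (tabulate λ j → f j v)) (cong₂ _⊕_ (Vecₚ.lookup∘tabulate _ i) (Vecₚ.lookup∘tabulate _ i)))))
        ; ·-homo = λ a v → lookup-ext λ i → trans (Vecₚ.lookup∘tabulate _ i) (trans (·-homo (lf i) a v)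
            (sym (trans (·-homo (lookup-linear i) a (tabulate λ j → f j v)) (cong (a ·_) (Vecₚ.lookup∘tabulate _ i))))) }

  δ-diag : ∀ {k} (i : Fin k) → δ i i ≡ 1#
  δ-diag i with i Fin.≟ i
  ... | yes _ = refl
  ... | no i≢i = ⊥-elim (i≢i refl)

  δ-off : ∀ {k} {i j : Fin k} → i ≢ j → δ i j ≡ 0#
  δ-off {i = i} {j} i≢j with i Fin.≟ j
  ... | yes eq = ⊥-elim (i≢j eq)
  ... | no _ = refl

  ∑-δ : ∀ {V : Set} {{_ : VectorSpace V}} {k} (f : Fin k → V) i → ∑ (λ j → δ i j · f j) ≡ f i
  ∑-δ f i = trans (∑-single _ i λ j j≢i → trans (cong (_· f j) (δ-off (j≢i ∘ sym))) (0·v≡𝟎 _))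
              (trans (cong (_· f i) (δ-diag i)) (1·v≡v _))

  basis : ∀ {k} → Fin k → Vec Carrier k
  basis i = tabulate (δ i)

  basis-≢𝟎 : ∀ {k} (i : Fin k) → basis i ≢ 𝟎
  basis-≢𝟎 i eq = 0≢1 (sym (trans (sym (δ-diag i)) (trans (sym (Vecₚ.lookup∘tabulate (δ i) i))
    (trans (cong (λ x → lookup x i) eq) (Vecₚ.lookup-replicate i 0#)))))

  basis-expansion : ∀ {k} (x : Vec Carrier k) → x ≡ ∑ (λ i → lookup x i · basis i)
  basis-expansion x = lookup-ext λ j → sym (trans (∑-homo (lookup-linear j) (λ i → lookup x i · basis i))
    (trans (∑-single _ j λ i i≢j → trans (entry≡ i j) (trans (cong (lookup x i *_) (δ-off i≢j)) (zeroʳ _)))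
      (trans (entry≡ j j) (trans (cong (lookup x j *_) (δ-diag j)) (*-identityʳ _)))))
    where
    entry≡ : ∀ i j → lookup (lookup x i · basis i) j ≡ lookup x i * δ i j
    entry≡ i j = trans (·-homo (lookup-linear j) (lookup x i) (basis i)) (cong (lookup x i *_) (Vecₚ.lookup∘tabulate (δ i) j))

  linear-ext : ∀ {V : Set} {{_ : VectorSpace V}} {k} {f g : Vec Carrier k → V} → Linear f → Linear g →
    (∀ i → f (basis i) ≡ g (basis i)) → ∀ x → f x ≡ g x
  linear-ext {f = f} {g} lf lg eq x = trans (expand lf) (trans (∑-cong λ i → cong (lookup x i ·_) (eq i)) (sym (expand lg)))
    where
    expand : ∀ {h} → Linear h → h x ≡ ∑ (λ i → lookup x i · h (basis i))
    expand {h} lh = trans (cong h (basis-expansion x)) (trans (∑-homo lh (λ i → lookup x i · basis i)) (∑-cong λ i → ·-homo lh (lookup x i) (basis i)))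

  infixr 7 _⊛_
  _⊛_ : ∀ {k} → Mat k → Vec Carrier k → Vec Carrier k
  M ⊛ x = tabulate λ r → ∑ λ s → entry M r s * lookup x s

  lookup-⊛ : ∀ {k} (M : Mat k) x r → lookup (M ⊛ x) r ≡ ∑ λ s → entry M r s * lookup x s
  lookup-⊛ M x r = Vecₚ.lookup∘tabulate (λ r → ∑ λ s → entry M r s * lookup x s) r

  ⊛-linear : ∀ {k} (M : Mat k) → Linear (M ⊛_)
  ⊛-linear M = tabulate-linear λ r → ∑-linear λ s → ∘-linear (·-linear (entry M r s)) (lookup-linear s)

  ⊛-basis : ∀ {k} (M : Mat k) r s → lookup (M ⊛ basis s) r ≡ entry M r s
  ⊛-basis M r s = trans (Vecₚ.lookup∘tabulate _ r) (trans (∑-cong λ t →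
      trans (*-comm _ _) (cong (_* entry M r t) (Vecₚ.lookup∘tabulate (δ s) t))) (∑-δ (entry M r) s))

  matrix-ext : ∀ {k} (M N : Mat k) → (∀ x → M ⊛ x ≡ N ⊛ x) → M ≡ N
  matrix-ext M N eq = lookup-ext λ r → lookup-ext λ s →
    trans (sym (⊛-basis M r s)) (trans (cong (λ x → lookup x r) (eq (basis s))) (⊛-basis N r s))

  matrixOf : ∀ {k} → (Vec Carrier k → Vec Carrier k) → Mat k
  matrixOf f = tabulate λ r → tabulate λ s → lookup (f (basis s)) r

  matrixOf-⊛ : ∀ {k} {f : Vec Carrier k → Vec Carrier k} → Linear f → ∀ x → matrixOf f ⊛ x ≡ f x
  matrixOf-⊛ {f = f} lf = linear-ext (⊛-linear (matrixOf f)) lf λ s → lookup-ext λ r →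
    trans (⊛-basis (matrixOf f) r s) (trans (cong (λ row → lookup row s) (Vecₚ.lookup∘tabulate _ r)) (Vecₚ.lookup∘tabulate _ s))

  iter : ∀ {V : Set} → (V → V) → ℕ → V → V
  iter T zero v = v
  iter T (suc k) v = T (iter T k v)

  iter-+ : ∀ {V : Set} (T : V → V) i j v → iter T (i ℕ.+ j) v ≡ iter T i (iter T j v)
  iter-+ T zero j v = refl
  iter-+ T (suc i) j v = cong T (iter-+ T i j v)

  iter-linear : ∀ {V : Set} {{_ : VectorSpace V}} {T : V → V} → Linear T → ∀ k → Linear (iter T k)
  iter-linear lT zero = id-linear
  iter-linear lT (suc k) = ∘-linear lT (iter-linear lT k)

  iter-commute : ∀ {V W : Set} {T : V → V} {T′ : W → W} {g : V → W} → (∀ v → g (T v) ≡ T′ (g v)) →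
    ∀ k v → g (iter T k v) ≡ iter T′ k (g v)
  iter-commute comm zero v = refl
  iter-commute {T = T} {T′} comm (suc k) v = trans (comm _) (cong T′ (iter-commute comm k v))

-- Polynomials by coefficients, division with remainder, and polynomials in an operator.

module Polynomials (F : FiniteField) where
  open LinearAlgebra F

  coeff : Poly → ℕ → Carrier
  coeff [] i = 0#
  coeff (a ∷ f) zero = a
  coeff (a ∷ f) (suc i) = coeff f i

  infix 4 _~_
  -- Coefficients can be compared by recursion along the lists, which trailing zeros obstruct for
  -- `norm`. Computations use this relation and return to `_≈ₚ_` where divisibility and primitivity
  -- are concerned.
  _~_ : Poly → Poly → Set
  f ~ g = ∀ i → coeff f i ≡ coeff g i

  coeff-norm : ∀ f → norm f ~ f
  coeff-norm [] i = refl
  coeff-norm (a ∷ f) i with norm f | coeff-norm f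
  ... | g ∷ gs | ih = step i
    where
    step : ∀ i → coeff (a ∷ g ∷ gs) i ≡ coeff (a ∷ f) i
    step zero = refl
    step (suc i) = ih i
  ... | [] | ih with a ≟ 0#
  ...   | yes a≡0 = step i
    where
    step : ∀ i → 0# ≡ coeff (a ∷ f) i
    step zero = sym a≡0
    step (suc i) = ih i
  ...   | no _ = step i
    where
    step : ∀ i → coeff (a ∷ []) i ≡ coeff (a ∷ f) i
    step zero = refl
    step (suc i) = ih i

  norm-zero : ∀ f → f ~ [] → norm f ≡ []
  norm-zero [] eq = refl
  norm-zero (a ∷ f) eq rewrite norm-zero f (eq ∘ suc) with a ≟ 0#
  ... | yes _ = refl
  ... | no a≢0 = ⊥-elim (a≢0 (eq 0))

  norm-∷-cong : ∀ a {f g} → norm f ≡ norm g → norm (a ∷ f) ≡ norm (a ∷ g)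
  norm-∷-cong a {f} {g} eq with norm f | norm g | eq
  ... | _ | _ | refl = refl

  ~⇒≈ₚ : ∀ f g → f ~ g → f ≈ₚ g
  ~⇒≈ₚ [] g eq = sym (norm-zero g (sym ∘ eq))
  ~⇒≈ₚ (a ∷ f) [] eq = norm-zero (a ∷ f) eq
  ~⇒≈ₚ (a ∷ f) (b ∷ g) eq = trans (norm-∷-cong a {f} {g} (~⇒≈ₚ f g (eq ∘ suc))) (cong (λ c → norm (c ∷ g)) (eq 0))

  ≈ₚ⇒~ : ∀ f g → f ≈ₚ g → f ~ g
  ≈ₚ⇒~ f g eq i = trans (sym (coeff-norm f i)) (trans (cong (λ h → coeff h i) eq) (coeff-norm g i))

  coeff-+ : ∀ f g i → coeff (f +ₚ g) i ≡ coeff f i + coeff g i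
  coeff-+ [] g i = sym (+-identityˡ _)
  coeff-+ (a ∷ f) [] i = sym (+-identityʳ _)
  coeff-+ (a ∷ f) (b ∷ g) zero = refl
  coeff-+ (a ∷ f) (b ∷ g) (suc i) = coeff-+ f g i

  coeff-scale : ∀ a f i → coeff (List.map (a *_) f) i ≡ a * coeff f i
  coeff-scale a [] i = sym (zeroʳ a)
  coeff-scale a (b ∷ f) zero = refl
  coeff-scale a (b ∷ f) (suc i) = coeff-scale a f i

  coeff-neg : ∀ f i → coeff (-ₚ f) i ≡ - coeff f i
  coeff-neg [] i = sym -0#≈0#
  coeff-neg (b ∷ f) zero = refl
  coeff-neg (b ∷ f) (suc i) = coeff-neg f i

  coeff-*-zero : ∀ a f g → coeff ((a ∷ f) *ₚ g) 0 ≡ a * coeff g 0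
  coeff-*-zero a f g = trans (coeff-+ (List.map (a *_) g) _ 0) (trans (+-identityʳ _) (coeff-scale a g 0))

  coeff-*-suc : ∀ a f g i → coeff ((a ∷ f) *ₚ g) (suc i) ≡ a * coeff g (suc i) + coeff (f *ₚ g) i
  coeff-*-suc a f g i = trans (coeff-+ (List.map (a *_) g) _ (suc i)) (cong (_+ _) (coeff-scale a g (suc i)))

  zero-*ₚ : ∀ f g → f ~ [] → f *ₚ g ~ []
  zero-*ₚ [] g eq i = refl
  zero-*ₚ (a ∷ f) g eq zero = trans (coeff-*-zero a f g) (trans (cong (_* _) (eq 0)) (zeroˡ _))
  zero-*ₚ (a ∷ f) g eq (suc i) = trans (coeff-*-suc a f g i)
    (trans (cong₂ _+_ (trans (cong (_* _) (eq 0)) (zeroˡ _)) (zero-*ₚ f g (eq ∘ suc) i)) (+-identityˡ _))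

  *ₚ-zero : ∀ f g → g ~ [] → f *ₚ g ~ []
  *ₚ-zero [] g eq i = refl
  *ₚ-zero (a ∷ f) g eq zero = trans (coeff-*-zero a f g) (trans (cong (a *_) (eq 0)) (zeroʳ _))
  *ₚ-zero (a ∷ f) g eq (suc i) = trans (coeff-*-suc a f g i)
    (trans (cong₂ _+_ (trans (cong (a *_) (eq (suc i))) (zeroʳ _)) (*ₚ-zero f g eq i)) (+-identityˡ _))

  -- Upper bounds rather than exact degrees: they also cover the zero polynomial and pass through
  -- products without normalisation.
  DegreeLT DegreeLE : Poly → ℕ → Set
  DegreeLT f k = ∀ i → k ℕ.≤ i → coeff f i ≡ 0#
  DegreeLE f k = DegreeLT f (suc k)

  *ₚ-degree : ∀ f g a b → DegreeLE f a → DegreeLE g b → DegreeLE (f *ₚ g) (a ℕ.+ b)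
  *ₚ-degree [] g a b df dg i lt = refl
  *ₚ-degree (x ∷ f) g zero b df dg (suc i) (s≤s lt) = trans (coeff-*-suc x f g i)
    (trans (cong₂ _+_ (trans (cong (x *_) (dg (suc i) (s≤s lt))) (zeroʳ x)) (zero-*ₚ f g (λ j → df (suc j) (s≤s z≤n)) i)) (+-identityˡ _))
  *ₚ-degree (x ∷ f) g (suc a) b df dg (suc i) (s≤s lt) = trans (coeff-*-suc x f g i)
    (trans (cong₂ _+_ (trans (cong (x *_) (dg (suc i) (s≤s (ℕₚ.≤-trans (ℕₚ.m≤n+m b (suc a)) lt)))) (zeroʳ x))
      (*ₚ-degree f g a b (λ j p → df (suc j) (s≤s p)) dg i lt)) (+-identityˡ _))

  *ₚ-lead : ∀ f g a b → DegreeLE f a → DegreeLE g b → coeff (f *ₚ g) (a ℕ.+ b) ≡ coeff f a * coeff g b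
  *ₚ-lead [] g a b df dg = sym (zeroˡ _)
  *ₚ-lead (x ∷ f) g zero zero df dg = coeff-*-zero x f g
  *ₚ-lead (x ∷ f) g zero (suc b) df dg = trans (coeff-*-suc x f g b)
    (trans (cong (_ +_) (zero-*ₚ f g (λ j → df (suc j) (s≤s z≤n)) b)) (+-identityʳ _))
  *ₚ-lead (x ∷ f) g (suc a) b df dg = trans (coeff-*-suc x f g (a ℕ.+ b))
    (trans (cong₂ _+_ (trans (cong (x *_) (dg (suc (a ℕ.+ b)) (s≤s (ℕₚ.m≤n+m b a)))) (zeroʳ x))
      (*ₚ-lead f g a b (λ j p → df (suc j) (s≤s p)) dg)) (+-identityˡ _))

  HasDegree : Poly → ℕ → Set
  HasDegree f k = DegreeLE f k × coeff f k ≢ 0#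

  zero-or-degree : ∀ f → f ~ [] ⊎ ∃ (HasDegree f)
  zero-or-degree [] = inj₁ λ _ → refl
  zero-or-degree (a ∷ f) with zero-or-degree f
  ... | inj₂ (k , df , nz) = inj₂ (suc k , (λ { (suc i) (s≤s p) → df i p }) , nz)
  ... | inj₁ eq with a ≟ 0#
  ...   | yes a≡0 = inj₁ λ { zero → a≡0 ; (suc i) → eq i }
  ...   | no a≢0 = inj₂ (0 , (λ { (suc i) _ → eq i }) , a≢0)

  degree-unique : ∀ {f k l} → HasDegree f k → HasDegree f l → k ≡ l
  degree-unique {k = k} {l} (df , nz) (df′ , nz′) with ℕₚ.<-cmp k l
  ... | tri< k<l _ _ = ⊥-elim (nz′ (df l k<l))
  ... | tri≈ _ eq _ = eq
  ... | tri> _ _ l<k = ⊥-elim (nz (df′ k l<k))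

  *-≢0 : ∀ {a b} → a ≢ 0# → b ≢ 0# → a * b ≢ 0#
  *-≢0 a≢0 b≢0 eq = b≢0 (scale-cancel _ a≢0 eq)

  *ₚ-hasDegree : ∀ {f g a b} → HasDegree f a → HasDegree g b → HasDegree (f *ₚ g) (a ℕ.+ b)
  *ₚ-hasDegree {f} {g} {a} {b} (df , nf) (dg , ng) =
    *ₚ-degree f g a b df dg , λ eq → *-≢0 nf ng (trans (sym (*ₚ-lead f g a b df dg)) eq)

  norm-snoc : ∀ f k → HasDegree f k → ∃ λ g → norm f ≡ g ++ (coeff f k ∷ []) × length g ≡ k
  norm-snoc [] k (_ , nz) = ⊥-elim (nz refl)
  norm-snoc (x ∷ f) zero (df , nz) rewrite norm-zero f (λ j → df (suc j) (s≤s z≤n)) with x ≟ 0#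
  ... | yes x≡0 = ⊥-elim (nz x≡0)
  ... | no _ = [] , refl , refl
  norm-snoc (x ∷ f) (suc k) (df , nz) with norm-snoc f k ((λ j p → df (suc j) (s≤s p)) , nz)
  ... | [] , eq , len rewrite eq = x ∷ [] , refl , cong suc len
  ... | y ∷ g , eq , len rewrite eq = x ∷ y ∷ g , refl , cong suc len

  degree≡ : ∀ f k → HasDegree f k → degree f ≡ k
  degree≡ f k d with norm-snoc f k d
  ... | g , eq , len rewrite eq = trans (cong (ℕ._∸ 1) (Listₚ.length-++ g)) (trans (ℕₚ.m+n∸n≡m (length g) 1) len)

  -- `_*ₚ_` recurses on its left factor. This is the recursion in the right factor, needed because
  -- `division` builds the quotient there one coefficient at a time.
  *ₚ-∷ʳ : ∀ f b g i → coeff (f *ₚ (b ∷ g)) i ≡ b * coeff f i + coeff (0# ∷ (f *ₚ g)) i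
  *ₚ-∷ʳ [] b g zero = sym (trans (+-identityʳ _) (zeroʳ b))
  *ₚ-∷ʳ [] b g (suc i) = sym (trans (+-identityʳ _) (zeroʳ b))
  *ₚ-∷ʳ (a ∷ f) b g zero = trans (coeff-*-zero a f (b ∷ g)) (trans (*-comm a b) (sym (+-identityʳ _)))
  *ₚ-∷ʳ (a ∷ f) b g (suc i) = trans (coeff-*-suc a f (b ∷ g) i)
    (trans (cong (a * coeff g i +_) (*ₚ-∷ʳ f b g i)) (trans (sym (+-assoc _ _ _))
      (trans (cong₂ _+_ (+-comm (a * coeff g i) (b * coeff f i)) refl) (trans (+-assoc _ _ _) (cong (b * coeff f i +_) (tail i))))))
    where
    tail : ∀ i → a * coeff g i + coeff (0# ∷ (f *ₚ g)) i ≡ coeff ((a ∷ f) *ₚ g) i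
    tail zero = trans (+-identityʳ _) (sym (coeff-*-zero a f g))
    tail (suc i) = sym (coeff-*-suc a f g i)

  MonicOfDegree : Poly → ℕ → Set
  MonicOfDegree χ k = DegreeLE χ k × coeff χ k ≡ 1#

  monic-hasDegree : ∀ {χ k} → MonicOfDegree χ k → HasDegree χ k
  monic-hasDegree (dχ , lead) = dχ , λ eq → 0≢1 (trans (sym eq) lead)

  module _ {χ : Poly} {k : ℕ} (χ-monic : MonicOfDegree χ k) where

    -- Horner recursion: if f = χ h + r, then a + X f = χ (X h) + (a + X r), and the only
    -- coefficient that can break the degree bound, the one at X^k, is removed by subtracting that
    -- multiple of the monic χ.
    division : ∀ f → ∃ λ h → ∃ λ r → DegreeLT r k × f ~ ((χ *ₚ h) +ₚ r)
    division [] = [] , [] , (λ _ _ → refl) , λ i → sym (trans (coeff-+ (χ *ₚ []) [] i) (trans (+-identityʳ _) (*ₚ-zero χ [] (λ _ → refl) i)))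
    division (a ∷ f) with division f
    ... | h , r , dr , eq = b ∷ h , r′ , dr′ , λ i → sym (trans (coeff-+ (χ *ₚ (b ∷ h)) r′ i)
            (trans (cong₂ _+_ (*ₚ-∷ʳ χ b h i) (coeff-r′ i)) (trans (cancel (b * coeff χ i) _ _) (quotient i))))
      where
      b : Carrier
      b = coeff (a ∷ r) k
      r′ : Poly
      r′ = (a ∷ r) +ₚ (-ₚ List.map (b *_) χ)
      coeff-r′ : ∀ i → coeff r′ i ≡ coeff (a ∷ r) i + - (b * coeff χ i)
      coeff-r′ i = trans (coeff-+ (a ∷ r) (-ₚ List.map (b *_) χ) i) (cong (coeff (a ∷ r) i +_) (trans (coeff-neg (List.map (b *_) χ) i) (cong -_ (coeff-scale b χ i))))
      dr′ : DegreeLT r′ k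
      dr′ i k≤i with ℕₚ.m≤n⇒m<n∨m≡n k≤i
      ... | inj₂ refl = trans (coeff-r′ k) (trans (cong (b +_) (cong -_ (trans (cong (b *_) (proj₂ χ-monic)) (*-identityʳ b)))) (-‿inverseʳ b))
      dr′ (suc i) k≤i | inj₁ (s≤s k≤i′) = trans (coeff-r′ (suc i))
        (trans (cong₂ _+_ (dr i k≤i′) (trans (cong -_ (trans (cong (b *_) (proj₁ χ-monic (suc i) (s≤s k≤i′))) (zeroʳ b))) -0#≈0#)) (+-identityˡ _))
      cancel : ∀ x y z → (x + y) + (z + - x) ≡ y + z
      cancel x y z = trans (⊕-interchange x y z (- x)) (trans (cong₂ _+_ (+-comm x z) refl)
        (trans (⊕-interchange z x y (- x)) (trans (cong₂ _+_ (+-comm z y) (-‿inverseʳ x)) (+-identityʳ _))))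
      quotient : ∀ i → coeff (0# ∷ (χ *ₚ h)) i + coeff (a ∷ r) i ≡ coeff (a ∷ f) i
      quotient zero = +-identityˡ a
      quotient (suc i) = sym (trans (eq i) (coeff-+ (χ *ₚ h) r i))

    -- A nonzero cofactor of degree l would give the product a nonzero coefficient at k + l, beyond
    -- the bound on `f`.
    multiple-degree : ∀ f h → DegreeLT f k → f ≈ₚ (χ *ₚ h) → f ~ []
    multiple-degree f h df eq with zero-or-degree h
    ... | inj₁ h~0 = λ i → trans (≈ₚ⇒~ f (χ *ₚ h) eq i) (*ₚ-zero χ h h~0 i)
    ... | inj₂ (l , dh) = ⊥-elim (proj₂ (*ₚ-hasDegree {χ} {h} (monic-hasDegree {χ} χ-monic) dh)
            (trans (sym (≈ₚ⇒~ f (χ *ₚ h) eq (k ℕ.+ l))) (df (k ℕ.+ l) (ℕₚ.m≤m+n k l))))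

  truncate : ∀ k → Poly → Vec Carrier k
  truncate k f = tabulate (λ i → coeff f (toℕ i))

  -- Stated for an arbitrary sequence `c`, so that the induction can shift it.
  coeff-toList-tabulate : ∀ {k} (c : ℕ → Carrier) → (∀ i → k ℕ.≤ i → c i ≡ 0#) →
    ∀ i → coeff (Vec.toList (tabulate {n = k} (c ∘ toℕ))) i ≡ c i
  coeff-toList-tabulate {zero} c c0 i = sym (c0 i z≤n)
  coeff-toList-tabulate {suc k} c c0 zero = refl
  coeff-toList-tabulate {suc k} c c0 (suc i) = coeff-toList-tabulate (c ∘ suc) (λ j p → c0 (suc j) (s≤s p)) i

  toList-truncate : ∀ k f → DegreeLT f k → Vec.toList (truncate k f) ~ f
  toList-truncate k f = coeff-toList-tabulate (coeff f)

  toList-degree : ∀ {k} (x : Vec Carrier k) → DegreeLT (Vec.toList x) k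
  toList-degree [] i p = refl
  toList-degree (a ∷ x) (suc i) (s≤s p) = toList-degree x i p

  module _ {V : Set} {{_ : VectorSpace V}} where

    -- The vector f(T) v by Horner's rule; for linear T this makes V an F[X]-module.
    act : (V → V) → Poly → V → V
    act T [] v = 𝟎
    act T (a ∷ f) v = a · v ⊕ T (act T f v)

    module _ {T : V → V} (lT : Linear T) where

      act-linear : ∀ f → Linear (act T f)
      act-linear [] = record { ⊕-homo = λ _ _ → sym (⊕-identityˡ 𝟎) ; ·-homo = λ a _ → sym (a·𝟎≡𝟎 a) }
      act-linear (a ∷ f) = ⊕-linear (·-linear a) (∘-linear lT (act-linear f))

      act-zero : ∀ f v → f ~ [] → act T f v ≡ 𝟎
      act-zero [] v eq = refl
      act-zero (a ∷ f) v eq = trans (cong₂ _⊕_ (trans (cong (_· v) (eq 0)) (0·v≡𝟎 v))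
        (trans (cong T (act-zero f v (eq ∘ suc))) (𝟎-homo lT))) (⊕-identityˡ 𝟎)

      act-~ : ∀ f g v → f ~ g → act T f v ≡ act T g v
      act-~ [] g v eq = sym (act-zero g v (sym ∘ eq))
      act-~ (a ∷ f) [] v eq = act-zero (a ∷ f) v eq
      act-~ (a ∷ f) (b ∷ g) v eq = cong₂ _⊕_ (cong (_· v) (eq 0)) (cong T (act-~ f g v (eq ∘ suc)))

      act-≈ₚ : ∀ {f g} v → f ≈ₚ g → act T f v ≡ act T g v
      act-≈ₚ {f} {g} v eq = act-~ f g v (≈ₚ⇒~ f g eq)

      act-+ : ∀ f g v → act T (f +ₚ g) v ≡ act T f v ⊕ act T g v
      act-+ [] g v = sym (⊕-identityˡ _)
      act-+ (a ∷ f) [] v = sym (⊕-identityʳ _)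
      act-+ (a ∷ f) (b ∷ g) v = trans (cong₂ _⊕_ (·-distrib-+ a b v) (trans (cong T (act-+ f g v)) (⊕-homo lT _ _))) (⊕-interchange _ _ _ _)

      act-scale : ∀ a f v → act T (List.map (a *_) f) v ≡ a · act T f v
      act-scale a [] v = sym (a·𝟎≡𝟎 a)
      act-scale a (b ∷ f) v = trans (cong₂ _⊕_ (·-assoc a b v) (trans (cong T (act-scale a f v)) (·-homo lT a _))) (sym (·-distrib-⊕ a _ _))

      act-neg : ∀ f v → act T (-ₚ f) v ≡ ⊖ act T f v
      act-neg f v = trans (cong (λ g → act T g v) (Listₚ.map-cong (λ a → sym (-1*x≈-x a)) f)) (act-scale (- 1#) f v)

      act-- : ∀ f g v → act T (f -ₚ g) v ≡ act T f v ⊕ ⊖ act T g v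
      act-- f g v = trans (act-+ f (-ₚ g) v) (cong₂ _⊕_ refl (act-neg g v))

      act-* : ∀ f g v → act T (f *ₚ g) v ≡ act T f (act T g v)
      act-* [] g v = refl
      act-* (a ∷ f) g v = trans (act-+ (List.map (a *_) g) _ v)
        (cong₂ _⊕_ (act-scale a g v) (trans (cong₂ _⊕_ (0·v≡𝟎 v) (cong T (act-* f g v))) (⊕-identityˡ _)))

      act-const : ∀ a v → act T (const a) v ≡ a · v
      act-const a v = trans (cong₂ _⊕_ refl (𝟎-homo lT)) (⊕-identityʳ _)

      act-X : ∀ v → act T Xₚ v ≡ T v
      act-X v = trans (cong₂ _⊕_ (0·v≡𝟎 v) (cong T (trans (act-const 1# v) (1·v≡v v)))) (⊕-identityˡ _)

      act-X^ : ∀ k v → act T (Xₚ ^ₚ k) v ≡ iter T k v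
      act-X^ zero v = trans (act-const 1# v) (1·v≡v v)
      act-X^ (suc k) v = trans (act-* Xₚ (Xₚ ^ₚ k) v) (trans (act-X _) (cong T (act-X^ k v)))

  act-commute : ∀ {V W : Set} {{_ : VectorSpace V}} {{_ : VectorSpace W}} {T : V → V} {T′ : W → W} {g : V → W} →
    Linear g → (∀ v → g (T v) ≡ T′ (g v)) → ∀ f v → g (act T f v) ≡ act T′ f (g v)
  act-commute lg comm [] v = 𝟎-homo lg
  act-commute {T′ = T′} lg comm (a ∷ f) v = trans (⊕-homo lg _ _)
    (cong₂ _⊕_ (·-homo lg a v) (trans (comm _) (cong T′ (act-commute lg comm f v))))

  module _ {V : Set} {{_ : VectorSpace V}} {T : V → V} (lT : Linear T) where

    -- f(T) commutes with T, so it is an endomorphism of the F[X]-module and commutes with g(T);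
    -- both steps are instances of `act-commute`.
    act-comm : ∀ f g v → act T f (act T g v) ≡ act T g (act T f v)
    act-comm f g v = act-commute (act-linear lT f) (λ w → sym (act-commute lT (λ _ → refl) f w)) g v

    -- Polynomials in T commute, so the divisor may be applied to `v` first. `χ` and `χ′` may be
    -- different lists with one normal form, as for the characteristic polynomials of two matrices.
    act-multiple : ∀ χ χ′ f v → χ ≈ₚ χ′ → act T χ v ≡ 𝟎 → χ′ ∣ₚ f → act T f v ≡ 𝟎
    act-multiple χ χ′ f v eq χv≡𝟎 (h , fh) = trans (act-≈ₚ lT {f} {χ′ *ₚ h} v fh) (trans (act-* lT χ′ h v)
      (trans (act-comm χ′ h v) (trans (cong (act T h) (trans (sym (act-≈ₚ lT {χ} {χ′} v eq)) χv≡𝟎)) (𝟎-homo (act-linear lT h)))))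

-- Cofactor expansion, and the degree and annihilation property of characteristic polynomials.

module Determinants (F : FiniteField) where
  open LinearAlgebra F
  open Polynomials F

  -- The embedding of the columns other than i and j, written symmetrically in them, which iterated
  -- `punchIn` is not. The value for i = j is arbitrary: the expansions only use it at j and
  -- `punchIn j l`.
  removeTwo : ∀ {k} → Fin (suc (suc k)) → Fin (suc (suc k)) → Fin k → Fin (suc (suc k))
  removeTwo zero zero c = suc (suc c)
  removeTwo zero (suc l) c = suc (punchIn l c)
  removeTwo (suc j) zero c = suc (punchIn j c)
  removeTwo (suc j) (suc l) zero = zero
  removeTwo (suc j) (suc l) (suc c) = suc (removeTwo j l c)

  removeTwo-comm : ∀ {k} (i j : Fin (suc (suc k))) c → removeTwo i j c ≡ removeTwo j i c
  removeTwo-comm zero zero c = refl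
  removeTwo-comm zero (suc j) c = refl
  removeTwo-comm (suc i) zero c = refl
  removeTwo-comm (suc i) (suc j) zero = refl
  removeTwo-comm (suc i) (suc j) (suc c) = cong suc (removeTwo-comm i j c)

  removeTwo-punchIn : ∀ {k} (j : Fin (suc (suc k))) l c → removeTwo j (punchIn j l) c ≡ punchIn j (punchIn l c)
  removeTwo-punchIn zero l c = refl
  removeTwo-punchIn (suc j) zero c = refl
  removeTwo-punchIn (suc j) (suc l) zero = refl
  removeTwo-punchIn (suc j) (suc l) (suc c) = cong suc (removeTwo-punchIn j l c)

  minor : ∀ {k} {A : Set} → (Fin (suc k) → Fin (suc k) → A) → Fin (suc k) → Fin k → Fin k → A
  minor M j r c = M (suc r) (punchIn j c)

  det-cong : ∀ k {M N : Fin k → Fin k → Poly} → (∀ r c → M r c ≡ N r c) → det k M ≡ det k N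
  det-cong zero eq = refl
  det-cong (suc k) eq = cong sumₚ (Listₚ.tabulate-cong λ j →
    cong (sign (toℕ j)) (cong₂ _*ₚ_ (eq zero j) (det-cong k λ r c → eq (suc r) (punchIn j c))))

  module _ {V : Set} {{_ : VectorSpace V}} where

    signed : ℕ → V → V
    signed zero v = v
    signed (suc zero) v = ⊖ v
    signed (suc (suc k)) v = signed k v

    signed-suc : ∀ k v → signed (suc k) v ≡ ⊖ signed k v
    signed-suc zero v = refl
    signed-suc (suc zero) v = sym (⊖-involutive v)
    signed-suc (suc (suc k)) v = signed-suc k v

    signed-linear : ∀ k → Linear (signed k)
    signed-linear zero = id-linear
    signed-linear (suc zero) = ·-linear (- 1#)
    signed-linear (suc (suc k)) = signed-linear k

    signed-commute : ∀ {f} → Linear f → ∀ k v → f (signed k v) ≡ signed k (f v)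
    signed-commute lf zero v = refl
    signed-commute lf (suc zero) v = ·-homo lf (- 1#) v
    signed-commute lf (suc (suc k)) v = signed-commute lf k v

    signed-suc-suc : ∀ j l v → signed (suc j) (signed (suc l) v) ≡ signed j (signed l v)
    signed-suc-suc j l v = trans (signed-suc j _) (trans (cong ⊖_ (trans (cong (signed j) (signed-suc l v)) (·-homo (signed-linear j) _ _))) (⊖-involutive _))

    -- The shape of a Laplace expansion along two rows: column j for the first, then the l-th
    -- remaining column for the second, with the signs of the two successive expansions.
    doubleSum : ∀ {n} → (Fin (suc n) → Fin (suc n) → V) → V
    doubleSum G = ∑ λ j → signed (toℕ j) (∑ λ l → signed (toℕ l) (G j (punchIn j l)))

    -- The pairs (i, j) and (j, i) carry opposite signs, because deleting the smaller column moves
    -- the larger one by one place. Pairs involving column zero cancel directly, the others by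
    -- induction. Cancelling pairs, rather than deriving S = -S, also covers characteristic two.
    doubleSum-symmetric : ∀ n (G : Fin (suc n) → Fin (suc n) → V) → (∀ i j → G i j ≡ G j i) → doubleSum G ≡ 𝟎
    doubleSum-symmetric zero G sy = ⊕-identityˡ 𝟎
    doubleSum-symmetric (suc n) G sy = trans (cong₂ _⊕_ refl rest) (⊕-inverseʳ A)
      where
      A : V
      A = ∑ λ l → signed (toℕ l) (G zero (suc l))
      B : Fin (suc n) → V
      B j = ∑ λ l → signed (toℕ l) (G (suc j) (suc (punchIn j l)))
      split : ∀ j → signed (suc (toℕ j)) (G (suc j) zero ⊕ ∑ (λ l → signed (suc (toℕ l)) (G (suc j) (suc (punchIn j l)))))
                ≡ ⊖ signed (toℕ j) (G zero (suc j)) ⊕ signed (toℕ j) (B j)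
      split j = trans (⊕-homo (signed-linear (suc (toℕ j))) _ _) (cong₂ _⊕_
        (trans (signed-suc (toℕ j) _) (cong (λ x → ⊖ signed (toℕ j) x) (sy (suc j) zero)))
        (trans (∑-homo (signed-linear (suc (toℕ j))) (λ l → signed (suc (toℕ l)) (G (suc j) (suc (punchIn j l)))))
          (trans (∑-cong {f = λ l → signed (suc (toℕ j)) (signed (suc (toℕ l)) (G (suc j) (suc (punchIn j l))))} λ l → signed-suc-suc (toℕ j) (toℕ l) (G (suc j) (suc (punchIn j l)))) (sym (∑-homo (signed-linear (toℕ j)) (λ l → signed (toℕ l) (G (suc j) (suc (punchIn j l)))))))))
      rest : ∑ (λ j → signed (suc (toℕ j)) (G (suc j) zero ⊕ ∑ (λ l → signed (suc (toℕ l)) (G (suc j) (suc (punchIn j l)))))) ≡ ⊖ A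
      rest = trans (∑-cong split) (trans (∑-⊕ (λ j → ⊖ signed (toℕ j) (G zero (suc j))) (λ j → signed (toℕ j) (B j)))
        (trans (cong₂ _⊕_ (sym (∑-homo (·-linear (- 1#)) (λ j → signed (toℕ j) (G zero (suc j)))))
          (doubleSum-symmetric n (λ i j → G (suc i) (suc j)) (λ i j → sy (suc i) (suc j)))) (⊕-identityʳ _)))

    -- G plus its transpose is symmetric, so the double sums of the two add up to zero.
    doubleSum-transpose : ∀ {n} (G : Fin (suc n) → Fin (suc n) → V) → doubleSum (λ i j → G j i) ≡ 𝟎 → doubleSum G ≡ 𝟎
    doubleSum-transpose {n} G Gᵗ≡𝟎 = trans (sym (⊕-identityʳ _)) (trans (cong₂ _⊕_ refl (sym Gᵗ≡𝟎))
      (trans (sym additive) (doubleSum-symmetric n (λ i j → G i j ⊕ G j i) λ i j → ⊕-comm (G i j) (G j i))))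
      where
      additive : doubleSum (λ i j → G i j ⊕ G j i) ≡ doubleSum G ⊕ doubleSum (λ i j → G j i)
      additive = trans (∑-cong λ j → trans (cong (signed (toℕ j)) (trans (∑-cong λ l → ⊕-homo (signed-linear (toℕ l)) (G j (punchIn j l)) (G (punchIn j l) j))
          (∑-⊕ (λ l → signed (toℕ l) (G j (punchIn j l))) (λ l → signed (toℕ l) (G (punchIn j l) j))))) (⊕-homo (signed-linear (toℕ j)) _ _))
        (∑-⊕ (λ j → signed (toℕ j) (∑ λ l → signed (toℕ l) (G j (punchIn j l)))) (λ j → signed (toℕ j) (∑ λ l → signed (toℕ l) (G (punchIn j l) j))))

    module _ {T : V → V} (lT : Linear T) where

      act-sign : ∀ k f v → act T (sign k f) v ≡ signed k (act T f v)
      act-sign zero f v = refl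
      act-sign (suc zero) f v = act-neg lT f v
      act-sign (suc (suc k)) f v = act-sign k f v

      act-sum : ∀ {k} (h : Fin k → Poly) v → act T (sumₚ (List.tabulate h)) v ≡ ∑ (λ j → act T (h j) v)
      act-sum {zero} h v = refl
      act-sum {suc k} h v = trans (act-+ lT (h zero) _ v) (cong₂ _⊕_ refl (act-sum (h ∘ suc) v))

      act-det : ∀ k (M : Fin (suc k) → Fin (suc k) → Poly) v →
        act T (det (suc k) M) v ≡ ∑ λ j → signed (toℕ j) (act T (M zero j) (act T (det k (minor M j)) v))
      act-det k M v = trans (act-sum (λ j → sign (toℕ j) (M zero j *ₚ det k (minor M j))) v)
        (∑-cong λ j → trans (act-sign (toℕ j) (M zero j *ₚ det k (minor M j)) v) (cong (signed (toℕ j)) (act-* lT (M zero j) (det k (minor M j)) v)))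

      -- The vanishing of a determinant with a repeated row, evaluated at a vector. Expanding each
      -- minor along its first row, which is row one of `M`, gives a double sum whose factor `D`
      -- depends only on the unordered pair of deleted columns.
      alien-cofactors : ∀ k (M : Fin (suc k) → Fin (suc k) → Poly) r v →
        ∑ (λ j → signed (toℕ j) (act T (M (suc r) j) (act T (det k (minor M j)) v))) ≡ 𝟎
      alien-cofactors (suc k) M r v = trans (∑-cong expand) (vanish r)
        where
        D : Fin (suc (suc k)) → Fin (suc (suc k)) → V
        D j j′ = act T (det k (λ s c → M (suc (suc s)) (removeTwo j j′ c))) v
        D-punchIn : ∀ j l → act T (det k (minor (minor M j) l)) v ≡ D j (punchIn j l)
        D-punchIn j l = cong (λ f → act T f v) (det-cong k λ s c → cong (M (suc (suc s))) (sym (removeTwo-punchIn j l c)))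
        D-comm : ∀ i j → D i j ≡ D j i
        D-comm i j = cong (λ f → act T f v) (det-cong k λ s c → cong (M (suc (suc s))) (removeTwo-comm i j c))
        G : Fin (suc k) → Fin (suc (suc k)) → Fin (suc (suc k)) → V
        G r j j′ = act T (M (suc r) j) (act T (M (suc zero) j′) (D j j′))
        expand : ∀ j → signed (toℕ j) (act T (M (suc r) j) (act T (det (suc k) (minor M j)) v)) ≡
                       signed (toℕ j) (∑ λ l → signed (toℕ l) (G r j (punchIn j l)))
        expand j = cong (signed (toℕ j)) (trans (cong (act T (M (suc r) j)) (act-det k (minor M j) v))
          (trans (∑-homo (act-linear lT (M (suc r) j)) (λ l → signed (toℕ l) (act T (minor M j zero l) (act T (det k (minor (minor M j) l)) v))))
            (∑-cong λ l → trans (signed-commute (act-linear lT (M (suc r) j)) (toℕ l) _)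
              (cong (λ x → signed (toℕ l) (act T (M (suc r) j) (act T (M (suc zero) (punchIn j l)) x))) (D-punchIn j l)))))
        vanish : ∀ r → doubleSum (G r) ≡ 𝟎
        -- Row one occurs twice here, so exchanging the two columns does not change the summand.
        vanish zero = doubleSum-symmetric (suc k) (G zero) λ i j →
          trans (act-comm lT (M (suc zero) i) (M (suc zero) j) _) (cong (λ x → act T (M (suc zero) j) (act T (M (suc zero) i) x)) (D-comm i j))
        -- After transposition the column j taken from row one is fixed outside, and the inner sum
        -- is an alien cofactor sum of the smaller matrix `minor M j`.
        vanish (suc r) = doubleSum-transpose (G (suc r)) (∑-𝟎 λ j → trans (cong (signed (toℕ j)) (inner j)) (𝟎-homo (signed-linear (toℕ j))))
          where
          inner : ∀ j → ∑ (λ l → signed (toℕ l) (G (suc r) (punchIn j l) j)) ≡ 𝟎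
          inner j = trans (∑-cong λ l → trans (cong (signed (toℕ l)) (trans (act-comm lT (M (suc (suc r)) (punchIn j l)) (M (suc zero) j) _)
                (cong (λ x → act T (M (suc zero) j) (act T (M (suc (suc r)) (punchIn j l)) x)) (trans (D-comm (punchIn j l) j) (sym (D-punchIn j l))))))
                (sym (signed-commute (act-linear lT (M (suc zero) j)) (toℕ l) _)))
            (trans (sym (∑-homo (act-linear lT (M (suc zero) j)) (λ l → signed (toℕ l) (act T (minor M j (suc r) l) (act T (det k (minor (minor M j) l)) v)))))
              (trans (cong (act T (M (suc zero) j)) (alien-cofactors k (minor M j) r v)) (𝟎-homo (act-linear lT (M (suc zero) j)))))

      -- Multiply the relations by the cofactors of row zero: the coefficient of
      -- e zero becomes the determinant and the other coefficients are alien cofactor sums.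
      det-annihilates : ∀ k (M : Fin (suc k) → Fin (suc k) → Poly) (e : Fin (suc k) → V) →
        (∀ j → ∑ (λ i → act T (M i j) (e i)) ≡ 𝟎) → act T (det (suc k) M) (e zero) ≡ 𝟎
      det-annihilates k M e rel = trans (act-det k M (e zero)) (trans (sym (⊕-identityʳ _))
        (trans (cong₂ _⊕_ refl (sym (∑-𝟎 {f = λ i → ∑ λ j → term (suc i) j} λ i → alien-cofactors k M i (e (suc i)))))
          (trans (∑-swap term) (∑-𝟎 column))))
        where
        term : Fin (suc k) → Fin (suc k) → V
        term i j = signed (toℕ j) (act T (M i j) (act T (det k (minor M j)) (e i)))
        column : ∀ j → ∑ (λ i → term i j) ≡ 𝟎
        column j = trans (∑-cong λ i → cong (signed (toℕ j)) (act-comm lT (M i j) (det k (minor M j)) (e i)))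
          (trans (sym (∑-homo (signed-linear (toℕ j)) (λ i → act T (det k (minor M j)) (act T (M i j) (e i)))))
            (trans (cong (signed (toℕ j)) (trans (sym (∑-homo (act-linear lT (det k (minor M j))) (λ i → act T (M i j) (e i))))
              (trans (cong (act T (det k (minor M j))) (rel j)) (𝟎-homo (act-linear lT (det k (minor M j)))))))
              (𝟎-homo (signed-linear (toℕ j)))))

  charMatrix : ∀ {k} → Mat k → Fin k → Fin k → Poly
  charMatrix T r s = (if does (r Fin.≟ s) then Xₚ else []) -ₚ const (entry T r s)

  -- The relations T e_j = ∑ T_ij e_i say that every column of X - T annihilates the tuple of basis
  -- vectors.
  charPoly-annihilates : ∀ {k} (T : Mat (suc k)) → act (T ⊛_) (charPoly T) (basis zero) ≡ 𝟎
  charPoly-annihilates {k} T = det-annihilates lT k (charMatrix T) basis λ j →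
      trans (∑-cong λ i → trans (act-- lT (if does (i Fin.≟ j) then Xₚ else []) (const (entry T i j)) (basis i)) (cong₂ _⊕_ (diag i j) (cong ⊖_ (act-const lT (entry T i j) (basis i)))))
        (trans (∑-⊕ (λ i → δ j i · T ⊛ basis i) (λ i → ⊖ (entry T i j · basis i)))
          (trans (cong₂ _⊕_ (∑-δ (λ i → T ⊛ basis i) j) (trans (sym (∑-homo (·-linear (- 1#)) (λ i → entry T i j · basis i))) (cong ⊖_ (column j))))
            (⊕-inverseʳ (T ⊛ basis j))))
    where
    lT : Linear (T ⊛_)
    lT = ⊛-linear T
    diag : ∀ i j → act (T ⊛_) (if does (i Fin.≟ j) then Xₚ else []) (basis i) ≡ δ j i · T ⊛ basis i
    diag i j with i Fin.≟ j
    ... | yes refl = trans (act-X lT (basis i)) (sym (trans (cong (_· T ⊛ basis i) (δ-diag i)) (1·v≡v _)))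
    ... | no i≢j = sym (trans (cong (_· T ⊛ basis i) (δ-off (i≢j ∘ sym))) (0·v≡𝟎 _))
    column : ∀ j → ∑ (λ i → entry T i j · basis i) ≡ T ⊛ basis j
    column j = sym (trans (basis-expansion (T ⊛ basis j)) (∑-cong λ i → cong (_· basis i) (⊛-basis T i j)))

  coeff-sign : ∀ k f i → coeff (sign k f) i ≡ signed k (coeff f i)
  coeff-sign zero f i = refl
  coeff-sign (suc zero) f i = trans (coeff-neg f i) (sym (-1*x≈-x _))
  coeff-sign (suc (suc k)) f i = coeff-sign k f i

  coeff-sum : ∀ {k} (h : Fin k → Poly) i → coeff (sumₚ (List.tabulate h)) i ≡ ∑ (λ j → coeff (h j) i)
  coeff-sum {zero} h i = refl
  coeff-sum {suc k} h i = trans (coeff-+ (h zero) _ i) (cong (coeff (h zero) i +_) (coeff-sum (h ∘ suc) i))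

  coeff-det : ∀ k (M : Fin (suc k) → Fin (suc k) → Poly) i →
    coeff (det (suc k) M) i ≡ ∑ (λ j → signed (toℕ j) (coeff (M zero j *ₚ det k (minor M j)) i))
  coeff-det k M i = trans (coeff-sum (λ j → sign (toℕ j) (M zero j *ₚ det k (minor M j))) i)
    (∑-cong λ j → coeff-sign (toℕ j) (M zero j *ₚ det k (minor M j)) i)

  coeff-det-zero : ∀ k (M : Fin (suc k) → Fin (suc k) → Poly) i →
    (∀ j → coeff (M zero j *ₚ det k (minor M j)) i ≡ 0#) → coeff (det (suc k) M) i ≡ 0#
  coeff-det-zero k M i eq = trans (coeff-det k M i) (∑-𝟎 λ j → trans (cong (signed (toℕ j)) (eq j)) (𝟎-homo (signed-linear (toℕ j))))

  det-degree : ∀ k (M : Fin k → Fin k → Poly) → (∀ r c → DegreeLE (M r c) 1) → DegreeLE (det k M) k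
  det-degree zero M d (suc i) p = refl
  det-degree (suc k) M d i p = coeff-det-zero k M i λ j →
    *ₚ-degree (M zero j) (det k (minor M j)) 1 k (d zero j) (det-degree k (minor M j) (λ r c → d (suc r) (punchIn j c))) i p

  -- Every product in the expansion takes one factor from the row without X, so the bound drops by
  -- one.
  det-degree-constantRow : ∀ k (M : Fin (suc k) → Fin (suc k) → Poly) → (∀ r c → DegreeLE (M r c) 1) →
    ∀ r → (∀ c → DegreeLE (M r c) 0) → DegreeLE (det (suc k) M) k
  det-degree-constantRow k M d zero d0 i p = coeff-det-zero k M i λ j →
    *ₚ-degree (M zero j) (det k (minor M j)) 0 k (d0 j) (det-degree k (minor M j) (λ r c → d (suc r) (punchIn j c))) i p
  det-degree-constantRow (suc k) M d (suc r) d0 i p = coeff-det-zero (suc k) M i λ j →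
    *ₚ-degree (M zero j) (det (suc k) (minor M j)) 1 k (d zero j)
      (det-degree-constantRow k (minor M j) (λ s c → d (suc s) (punchIn j c)) r (λ c → d0 (punchIn j c))) i p

  det-lead : ∀ k (M : Fin k → Fin k → Poly) → (∀ r c → DegreeLE (M r c) 1) → (∀ r c → r ≢ c → DegreeLE (M r c) 0) →
    (∀ r → coeff (M r r) 1 ≡ 1#) → coeff (det k M) k ≡ 1#
  det-lead zero M d d0 lead = refl
  det-lead (suc k) M d d0 lead = trans (coeff-det k M (suc k)) (trans (∑-single _ zero off)
      (trans (*ₚ-lead (M zero zero) (det k (minor M zero)) 1 k (d zero zero) (det-degree k (minor M zero) (λ r c → d (suc r) (suc c))))
        (trans (cong₂ _*_ (lead zero) (det-lead k (minor M zero) (λ r c → d (suc r) (suc c)) (λ r c r≢c → d0 (suc r) (suc c) (r≢c ∘ Finₚ.suc-injective)) (lead ∘ suc)))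
          (*-identityˡ 1#))))
    where
    offTerm : ∀ {k} (M : Fin (suc k) → Fin (suc k) → Poly) → (∀ r c → DegreeLE (M r c) 1) → (∀ r c → r ≢ c → DegreeLE (M r c) 0) →
      ∀ j → j ≢ zero → coeff (M zero j *ₚ det k (minor M j)) (suc k) ≡ 0#
    offTerm M d d0 zero j≢0 = ⊥-elim (j≢0 refl)
    -- Row `j` of this minor is row `suc j` of `M` without its diagonal entry, hence constant. With
    -- the constant first factor the degree is at most k, two below the coefficient in question.
    offTerm {suc k} M d d0 (suc j) j≢0 = *ₚ-degree (M zero (suc j)) (det (suc k) (minor M (suc j))) 0 k (d0 zero (suc j) λ ())
      (det-degree-constantRow k (minor M (suc j)) (λ r c → d (suc r) (punchIn (suc j) c)) j
        (λ c → d0 (suc j) (punchIn (suc j) c) (Finₚ.punchInᵢ≢i (suc j) c ∘ sym))) (suc (suc k)) (s≤s (ℕₚ.n≤1+n k))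
    off : ∀ j → j ≢ zero → signed (toℕ j) (coeff (M zero j *ₚ det k (minor M j)) (suc k)) ≡ 0#
    off j j≢0 = trans (cong (signed (toℕ j)) (offTerm M d d0 j j≢0)) (𝟎-homo (signed-linear (toℕ j)))

  charPoly-monic : ∀ {k} (T : Mat k) → MonicOfDegree (charPoly T) k
  charPoly-monic {k} T = det-degree k (charMatrix T) deg1 , det-lead k (charMatrix T) deg1 deg0 lead
    where
    deg1 : ∀ r c → DegreeLE (charMatrix T r c) 1
    deg1 r c (suc zero) (s≤s ())
    deg1 r c (suc (suc i)) p with r Fin.≟ c
    ... | yes _ = refl
    ... | no _ = refl
    deg0 : ∀ r c → r ≢ c → DegreeLE (charMatrix T r c) 0
    deg0 r c r≢c (suc i) p with r Fin.≟ c
    ... | yes r≡c = ⊥-elim (r≢c r≡c)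
    ... | no _ = refl
    lead : ∀ r → coeff (charMatrix T r r) 1 ≡ 1#
    lead r with r Fin.≟ r
    ... | yes _ = refl
    ... | no r≢r = ⊥-elim (r≢r refl)

-- Full orbits of an operator and their equivalence with primitivity.

abstract
  least : {P : ℕ → Set} → (∀ n → Dec (P n)) → ∀ n → P n → ∃ λ m → P m × (∀ {l} → l ℕ.< m → ¬ P l)
  least {P} P? = <-rec _ step
    where
    step : ∀ n → (∀ {l} → l ℕ.< n → P l → ∃ λ m → P m × (∀ {l} → l ℕ.< m → ¬ P l)) → P n →
      ∃ λ m → P m × (∀ {l} → l ℕ.< m → ¬ P l)
    step n rec pn with ℕₚ.anyUpTo? P? n
    ... | yes (l , l<n , pl) = rec l<n pl
    ... | no none = n , pn , λ l<n pl → none (_ , l<n , pl)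

module Orbits (F : FiniteField) where
  open LinearAlgebra F
  open Polynomials F

  -- Exponents start at one, so that a nonzero ε is itself reached again: the sequence is then
  -- periodic and T invertible. With exponent zero allowed, T might never return to ε.
  Orb : {V : Set} {{_ : VectorSpace V}} → (V → V) → V → Set
  Orb T ε = ∀ v → v ≢ 𝟎 → ∃ λ j → iter T (suc j) ε ≡ v

  module OrbitProperties {V : Set} {{_ : VectorSpace V}} (_≟V_ : DecidableEquality V)
      {T : V → V} (lT : Linear T) {ε : V} (ε≢𝟎 : ε ≢ 𝟎) (orb : Orb T ε) where

    abstract
      leastPeriod : ∃ λ p → iter T (suc p) ε ≡ ε × (∀ {l} → l ℕ.< p → iter T (suc l) ε ≢ ε)
      leastPeriod = least (λ n → iter T (suc n) ε ≟V ε) (proj₁ (orb ε ε≢𝟎)) (proj₂ (orb ε ε≢𝟎))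

      

    order : ℕ
    order = suc (proj₁ leastPeriod)

    iter-order : iter T order ε ≡ ε
    iter-order = proj₁ (proj₂ leastPeriod)

    order-minimal : ∀ {l} → 0 ℕ.< l → l ℕ.< order → iter T l ε ≢ ε
    order-minimal {suc l} _ (s≤s l<p) = proj₂ (proj₂ leastPeriod) l<p

    iter-multiple : ∀ n i → iter T (i ℕ.+ n ℕ.* order) ε ≡ iter T i ε
    iter-multiple n i = trans (iter-+ T i (n ℕ.* order) ε) (cong (iter T i) (periodic n))
      where
      periodic : ∀ n → iter T (n ℕ.* order) ε ≡ ε
      periodic zero = refl
      periodic (suc n) = trans (iter-+ T order (n ℕ.* order) ε) (trans (cong (iter T order) (periodic n)) iter-order)

    iter-mod : ∀ i → iter T i ε ≡ iter T (i DivMod.% order) ε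
    iter-mod i = trans (cong (λ j → iter T j ε) (DivMod.m≡m%n+[m/n]*n i order)) (iter-multiple (i DivMod./ order) (i DivMod.% order))

    orbit-distinct : ∀ {i j} → i ℕ.< j → j ℕ.< order → iter T i ε ≢ iter T j ε
    orbit-distinct {i} {j} i<j j<o eq = order-minimal (ℕₚ.m<n⇒0<n∸m i<j) (ℕₚ.≤-<-trans (ℕₚ.m∸n≤m j i) j<o)
        (trans (sym (iter-multiple 1 (j ℕ.∸ i))) (trans (cong (λ k → iter T k ε) exponent) (trans (iter-+ T (order ℕ.∸ i) j ε)
          (trans (cong (iter T (order ℕ.∸ i)) (sym eq)) (trans (sym (iter-+ T (order ℕ.∸ i) i ε))
            (trans (cong (λ k → iter T k ε) (ℕₚ.m∸n+n≡m i≤o)) iter-order))))))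
      where
      i≤o : i ℕ.≤ order
      i≤o = ℕₚ.<⇒≤ (ℕₚ.<-trans i<j j<o)
      exponent : (j ℕ.∸ i) ℕ.+ 1 ℕ.* order ≡ (order ℕ.∸ i) ℕ.+ j
      exponent = trans (cong ((j ℕ.∸ i) ℕ.+_) (ℕₚ.*-identityˡ order)) (trans (sym (ℕₚ.+-∸-comm order (ℕₚ.<⇒≤ i<j)))
        (trans (cong (ℕ._∸ i) (ℕₚ.+-comm j order)) (ℕₚ.+-∸-comm j i≤o)))

    orbit-injective : ∀ {i j} → i ℕ.< order → j ℕ.< order → iter T i ε ≡ iter T j ε → i ≡ j
    orbit-injective {i} {j} i<o j<o eq with ℕₚ.<-cmp i j
    ... | tri< i<j _ _ = ⊥-elim (orbit-distinct i<j j<o eq)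
    ... | tri≈ _ i≡j _ = i≡j
    ... | tri> _ _ j<i = ⊥-elim (orbit-distinct j<i i<o (sym eq))

    -- Every nonzero vector is a power of T applied to ε, and T^order commutes with that power.
    iter-order-id : ∀ v → iter T order v ≡ v
    iter-order-id v with v ≟V 𝟎
    ... | yes refl = 𝟎-homo (iter-linear lT order)
    ... | no v≢𝟎 with orb v v≢𝟎
    ...   | j , refl = trans (sym (iter-+ T order (suc j) ε)) (trans (cong (λ k → iter T k ε) (ℕₚ.+-comm order (suc j)))
              (trans (iter-+ T (suc j) order ε) (cong (iter T (suc j)) iter-order)))

    iter-injective : ∀ i {u v} → iter T i u ≡ iter T i v → u ≡ v
    iter-injective zero eq = eq
    iter-injective (suc i) {u} {v} eq = iter-injective i (trans (sym (undo (iter T i u))) (trans (cong (iter T p) eq) (undo (iter T i v))))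
      where
      -- One less than the order, so T^p is the inverse of T.
      p : ℕ
      p = proj₁ leastPeriod
      undo : ∀ w → iter T p (T w) ≡ w
      undo w = trans (sym (iter-commute {T = T} {T′ = T} {g = T} (λ _ → refl) p w)) (iter-order-id w)

    orbit-≢𝟎 : ∀ i → iter T i ε ≢ 𝟎
    orbit-≢𝟎 i eq = ε≢𝟎 (iter-injective i (trans eq (sym (𝟎-homo (iter-linear lT i)))))

    -- The vectors T^i ε with i below the order are distinct, so the order is at most the number of
    -- vectors. This bound on the search is what makes `Orb` decidable.
    bounded-orbit : (fin : Finite V) → ∀ v → v ≢ 𝟎 → ∃ λ j → j ℕ.< Finite.∣all∣ fin × iter T (suc j) ε ≡ v
    bounded-orbit fin v v≢𝟎 with orb v v≢𝟎
    ... | j , refl = j DivMod.% order , ℕₚ.<-≤-trans (DivMod.m%n<n j order) order≤ , cong T (sym (iter-mod j))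
      where
      order≤ : order ℕ.≤ Finite.∣all∣ fin
      order≤ = Finite.injection-from-Fin⇒≤ fin {order} (λ i → iter T (toℕ i) ε)
        (λ {i} {j} eq → Finₚ.toℕ-injective (orbit-injective (Finₚ.toℕ<n i) (Finₚ.toℕ<n j) eq))

  orb? : ∀ {V : Set} {{_ : VectorSpace V}} → Finite V → {T : V → V} → Linear T → {ε : V} → ε ≢ 𝟎 → Dec (Orb T ε)
  orb? fin {T} lT {ε} ε≢𝟎 with Finite.all? fin {λ v → v ≢ 𝟎 → ∃ λ j → j ℕ.< Finite.∣all∣ fin × iter T (suc j) ε ≡ v} reached?
    where
    reached? : ∀ v → Dec (v ≢ 𝟎 → ∃ λ j → j ℕ.< Finite.∣all∣ fin × iter T (suc j) ε ≡ v)
    reached? v with Finite._≟_ fin v 𝟎 | ℕₚ.anyUpTo? (λ j → Finite._≟_ fin (iter T (suc j) ε) v) (Finite.∣all∣ fin)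
    ... | yes v≡𝟎 | _ = yes λ v≢𝟎 → ⊥-elim (v≢𝟎 v≡𝟎)
    ... | no _ | yes found = yes λ _ → found
    ... | no v≢𝟎 | no none = no λ f → none (f v≢𝟎)
  ... | yes p = yes λ v v≢𝟎 → let (j , _ , eq) = p v v≢𝟎 in j , eq
  ... | no ¬p = no λ orb → ¬p (OrbitProperties.bounded-orbit (Finite._≟_ fin) lT ε≢𝟎 orb fin)

  vector-finite : ∀ k → Finite (Vec Carrier k)
  vector-finite = Vec-finite field-finite

  module PrimitiveOrbit {k : ℕ} {T : Vec Carrier k → Vec Carrier k} (lT : Linear T) {ε : Vec Carrier k} (ε≢𝟎 : ε ≢ 𝟎)
      {χ : Poly} (χ-monic : MonicOfDegree χ k) (χ-annihilates : act T χ ε ≡ 𝟎) where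

    -- The map f ↦ f(T) ε on polynomials of degree below k, in coordinates. As an endomap of the
    -- finite set F^k it is injective exactly when it is surjective.
    evaluate : Vec Carrier k → Vec Carrier k
    evaluate x = act T (Vec.toList x) ε

    -- Says that χ is the minimal polynomial of ε under T.
    Faithful : Set
    Faithful = ∀ f → DegreeLT f k → act T f ε ≡ 𝟎 → f ~ []

    annihilates-orbit : ∀ f → act T χ (act T f ε) ≡ 𝟎
    annihilates-orbit f = trans (act-comm lT χ f ε) (trans (cong (act T f) χ-annihilates) (𝟎-homo (act-linear lT f)))

    multiple-annihilates : ∀ f → χ ∣ₚ f → act T f ε ≡ 𝟎
    multiple-annihilates f = act-multiple lT χ χ f ε refl χ-annihilates

    difference : ∀ f g → act T f ε ≡ act T g ε → act T (f -ₚ g) ε ≡ 𝟎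
    difference f g eq = trans (act-- lT f g ε) (trans (cong₂ _⊕_ eq refl) (⊕-inverseʳ _))

    difference⁻¹ : ∀ f g → act T (f -ₚ g) ε ≡ 𝟎 → act T f ε ≡ act T g ε
    difference⁻¹ f g eq = u⊕⊖v≡𝟎⇒u≡v _ _ (trans (sym (act-- lT f g ε)) eq)

    remainder : ∀ f → ∃ λ r → DegreeLT r k × act T f ε ≡ act T r ε × (r ~ [] → χ ∣ₚ f)
    remainder f with division {χ} χ-monic f
    ... | h , r , dr , eq = r , dr
        , trans (act-~ lT f ((χ *ₚ h) +ₚ r) ε eq) (trans (act-+ lT (χ *ₚ h) r ε)
            (trans (cong₂ _⊕_ (trans (act-* lT χ h ε) (annihilates-orbit h)) refl) (⊕-identityˡ _)))
        , λ r~0 → h , ~⇒≈ₚ f (χ *ₚ h) λ i → trans (eq i) (trans (coeff-+ (χ *ₚ h) r i) (trans (cong (_ +_) (r~0 i)) (+-identityʳ _)))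

    faithful⇒kernel : Faithful → ∀ f → act T f ε ≡ 𝟎 → χ ∣ₚ f
    faithful⇒kernel faithful f eq with remainder f
    ... | r , dr , same , multiple = multiple (faithful r dr (trans (sym same) eq))

    evaluate-truncate : ∀ f → DegreeLT f k → evaluate (truncate k f) ≡ act T f ε
    evaluate-truncate f df = act-~ lT (Vec.toList (truncate k f)) f ε (toList-truncate k f df)

    faithful⇒surjective : Faithful → ∀ v → ∃ λ x → evaluate x ≡ v
    faithful⇒surjective faithful = Finite.endo-injective⇒surjective (vector-finite k) evaluate injective
      where
      injective : ∀ {x y} → evaluate x ≡ evaluate y → x ≡ y
      injective {x} {y} eq = lookup-ext λ i → trans (sym (lookup≡coeff x i)) (trans (same (toℕ i)) (lookup≡coeff y i))
        where
        lookup≡coeff : ∀ {n} (z : Vec Carrier n) i → coeff (Vec.toList z) (toℕ i) ≡ lookup z i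
        lookup≡coeff (a ∷ z) zero = refl
        lookup≡coeff (a ∷ z) (suc i) = lookup≡coeff z i
        f g : Poly
        f = Vec.toList x
        g = Vec.toList y
        coeff-- : ∀ i → coeff (f -ₚ g) i ≡ coeff f i + - coeff g i
        coeff-- i = trans (coeff-+ f (-ₚ g) i) (cong (coeff f i +_) (coeff-neg g i))
        same : f ~ g
        same i = u⊕⊖v≡𝟎⇒u≡v (coeff f i) (coeff g i) (trans (cong (coeff f i +_) (-1*x≈-x (coeff g i)))
          (trans (sym (coeff-- i)) (faithful (f -ₚ g)
            (λ j p → trans (coeff-- j) (trans (cong₂ _+_ (toList-degree x j p) (trans (cong -_ (toList-degree y j p)) -0#≈0#)) (+-identityˡ _)))
            (difference f g eq) i)))

    χ-hasDegree : HasDegree χ k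
    χ-hasDegree = monic-hasDegree {χ} χ-monic

    module FromOrb (orb : Orb T ε) where
      open OrbitProperties (Finite._≟_ (vector-finite k)) lT ε≢𝟎 orb public

      -- A nonzero vector is a power of X acting on ε, and the remainder of that power modulo χ has
      -- degree below k and the same value.
      evaluate-surjective : ∀ v → ∃ λ x → evaluate x ≡ v
      evaluate-surjective v with Finite._≟_ (vector-finite k) v 𝟎
      ... | yes refl = truncate k [] , evaluate-truncate [] (λ _ _ → refl)
      ... | no v≢𝟎 with orb v v≢𝟎
      ...   | j , refl with remainder (Xₚ ^ₚ suc j)
      ...     | r , dr , same , _ = truncate k r , trans (evaluate-truncate r dr) (trans (sym same) (act-X^ lT (suc j) ε))

      faithful : Faithful
      faithful f df eq i = trans (sym (toList-truncate k f df i))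
        (trans (cong (λ x → coeff (Vec.toList x) i) truncations) (toList-truncate k [] (λ _ _ → refl) i))
        where
        truncations : truncate k f ≡ truncate k []
        truncations = Finite.endo-surjective⇒injective (vector-finite k) evaluate evaluate-surjective
          (trans (evaluate-truncate f df) (trans eq (sym (evaluate-truncate [] (λ _ _ → refl)))))

      kernel : ∀ f → act T f ε ≡ 𝟎 → χ ∣ₚ f
      kernel = faithful⇒kernel faithful

      -- The difference of two monic polynomials of degree k has degree below k, so if it
      -- annihilates ε it is zero.
      annihilator-unique : ∀ χ′ → MonicOfDegree χ′ k → act T χ′ ε ≡ 𝟎 → χ′ ~ χ
      annihilator-unique χ′ χ′-monic χ′-annihilates i = u⊕⊖v≡𝟎⇒u≡v (coeff χ′ i) (coeff χ i)
          (trans (cong (coeff χ′ i +_) (-1*x≈-x _)) (trans (sym (coeff-- i)) (faithful (χ′ -ₚ χ) degree<k (difference χ′ χ (trans χ′-annihilates (sym χ-annihilates))) i)))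
        where
        coeff-- : ∀ i → coeff (χ′ -ₚ χ) i ≡ coeff χ′ i + - coeff χ i
        coeff-- i = trans (coeff-+ χ′ (-ₚ χ) i) (cong (coeff χ′ i +_) (coeff-neg χ i))
        degree<k : DegreeLT (χ′ -ₚ χ) k
        degree<k i k≤i with ℕₚ.m≤n⇒m<n∨m≡n k≤i
        ... | inj₁ k<i = trans (coeff-- i) (trans (cong₂ (λ a b → a + - b) (proj₁ χ′-monic i k<i) (proj₁ χ-monic i k<i)) (-‿inverseʳ 0#))
        ... | inj₂ refl = trans (coeff-- k) (trans (cong₂ (λ a b → a + - b) (proj₂ χ′-monic) (proj₂ χ-monic)) (-‿inverseʳ 1#))

      -- If χ = g h with both degrees positive, then g(T) ε and h(T) ε are nonzero, hence of the
      -- form T^(i+1) ε and T^(j+1) ε, and χ(T) ε = T^(i+j+2) ε would be nonzero. Generation by X is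
      -- the orbit property read modulo the kernel.
      orb⇒primitive : 1 ℕ.≤ k → Primitive k χ
      orb⇒primitive 1≤k = degree≡ χ k χ-hasDegree , monic , (nonzero , nonunit , splits) , generates
        where
        monic : Monic χ
        monic with norm-snoc χ k χ-hasDegree
        ... | g , eq , _ = g , trans eq (cong (λ a → g ++ (a ∷ [])) (proj₂ χ-monic))
        nonzero : ¬ (χ ≈ₚ [])
        nonzero eq = proj₂ χ-hasDegree (≈ₚ⇒~ χ [] eq k)
        coeff-const : ∀ a i → 1 ℕ.≤ i → coeff (const a) i ≡ 0#
        coeff-const a (suc i) _ = refl
        nonunit : ¬ IsUnitₚ χ
        nonunit (a , _ , eq) = proj₂ χ-hasDegree (trans (≈ₚ⇒~ χ (const a) eq k) (coeff-const a k 1≤k))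
        unit : ∀ g → HasDegree g 0 → IsUnitₚ g
        unit g (dg , nz) = coeff g 0 , nz , ~⇒≈ₚ g (const (coeff g 0)) λ { zero → refl ; (suc i) → dg (suc i) (s≤s z≤n) }
        low-degree-≢𝟎 : ∀ {f a} → HasDegree f a → a ℕ.< k → act T f ε ≢ 𝟎
        low-degree-≢𝟎 {f} {a} (df , nz) a<k eq = nz (faithful f (λ i p → df i (ℕₚ.<-≤-trans a<k p)) eq a)
        splits : ∀ g h → χ ≈ₚ (g *ₚ h) → IsUnitₚ g ⊎ IsUnitₚ h
        splits g h eq with zero-or-degree g | zero-or-degree h
        ... | inj₁ g~0 | _ = ⊥-elim (proj₂ χ-hasDegree (trans (≈ₚ⇒~ χ (g *ₚ h) eq k) (zero-*ₚ g h g~0 k)))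
        ... | inj₂ _ | inj₁ h~0 = ⊥-elim (proj₂ χ-hasDegree (trans (≈ₚ⇒~ χ (g *ₚ h) eq k) (*ₚ-zero g h h~0 k)))
        ... | inj₂ (zero , dg) | inj₂ _ = inj₁ (unit g dg)
        ... | inj₂ (suc a , dg) | inj₂ (zero , dh) = inj₂ (unit h dh)
        ... | inj₂ (suc a , dg) | inj₂ (suc b , dh) = ⊥-elim (contra (orb (act T g ε) (low-degree-≢𝟎 {g} dg a<k)) (orb (act T h ε) (low-degree-≢𝟎 {h} dh b<k)))
          where
          χ~gh : χ ~ g *ₚ h
          χ~gh = ≈ₚ⇒~ χ (g *ₚ h) eq
          sum≡k : suc a ℕ.+ suc b ≡ k
          sum≡k = degree-unique {χ} ((λ i p → trans (χ~gh i) (proj₁ gh i p)) , λ z → proj₂ gh (trans (sym (χ~gh _)) z)) χ-hasDegree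
            where
            gh : HasDegree (g *ₚ h) (suc a ℕ.+ suc b)
            gh = *ₚ-hasDegree {g} {h} dg dh
          a<k : suc a ℕ.< k
          a<k = subst (suc a ℕ.<_) sum≡k (ℕₚ.m<m+n (suc a) (s≤s z≤n))
          b<k : suc b ℕ.< k
          b<k = subst (suc b ℕ.<_) sum≡k (ℕₚ.m<n+m (suc b) (s≤s z≤n))
          contra : (∃ λ i → iter T (suc i) ε ≡ act T g ε) → (∃ λ j → iter T (suc j) ε ≡ act T h ε) → _
          contra (i , gi) (j , hj) = orbit-≢𝟎 (suc j ℕ.+ suc i) (trans (iter-+ T (suc j) (suc i) ε) (trans (cong (iter T (suc j)) gi)
            (trans (sym (iter-commute {T = T} {T′ = T} {g = act T g} (λ w → sym (act-commute lT (λ _ → refl) g w)) (suc j) ε))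
              (trans (cong (act T g) hj) (trans (sym (act-* lT g h ε)) (trans (sym (act-≈ₚ lT {χ} {g *ₚ h} ε eq)) χ-annihilates))))))
        generates : ∀ g → ¬ (χ ∣ₚ g) → ∃ λ j → χ ∣ₚ ((Xₚ ^ₚ j) -ₚ g)
        generates g ¬div with orb (act T g ε) (¬div ∘ kernel g)
        ... | j , eq = suc j , kernel ((Xₚ ^ₚ suc j) -ₚ g) (difference (Xₚ ^ₚ suc j) g (trans (act-X^ lT (suc j) ε) eq))

    -- Primitivity yields exponents from zero on, while `Orb` asks for positive ones. The gap is
    -- closed by inverting T: if χ = a + X χ′ with a ≠ 0, then -a⁻¹ χ′(T) is inverse to T on vectors
    -- killed by χ(T).
    primitive⇒orb : 2 ℕ.≤ k → Primitive k χ → Orb T ε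
    primitive⇒orb 2≤k (_ , _ , (_ , _ , splits) , generates) = invert χ refl
      where
      invert : ∀ χ₀ → χ ≡ χ₀ → Orb T ε
      invert [] refl = ⊥-elim (proj₂ χ-hasDegree refl)
      invert (a ∷ χ′) refl with a ≟ 0#
      -- Here X divides χ, so X or χ′ would be a unit; but X has degree one, and χ′ has degree k -
      -- 1, positive by `2≤k`.
      ... | yes refl = ⊥-elim (notUnit (splits Xₚ χ′ (~⇒≈ₚ χ (Xₚ *ₚ χ′) factor)))
        where
        factor : χ ~ Xₚ *ₚ χ′
        factor zero = sym (trans (coeff-*-zero 0# (1# ∷ []) χ′) (zeroˡ _))
        factor (suc i) = sym (trans (coeff-*-suc 0# (1# ∷ []) χ′ i) (trans (cong₂ _+_ (zeroˡ _) refl) (trans (+-identityˡ _) (one i))))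
          where
          one : ∀ i → coeff (const 1# *ₚ χ′) i ≡ coeff χ′ i
          one zero = trans (coeff-*-zero 1# [] χ′) (*-identityˡ _)
          one (suc i) = trans (coeff-*-suc 1# [] χ′ i) (trans (+-identityʳ _) (*-identityˡ _))
        notUnit : ¬ (IsUnitₚ Xₚ ⊎ IsUnitₚ χ′)
        notUnit (inj₁ (b , _ , eq)) = 0≢1 (sym (≈ₚ⇒~ Xₚ (const b) eq 1))
        notUnit (inj₂ (b , _ , eq)) = high k 2≤k refl
          where
          high : ∀ k′ → 2 ℕ.≤ k′ → k′ ≡ k → _
          high (suc zero) (s≤s ()) _
          high (suc (suc l)) _ refl = proj₂ χ-hasDegree (≈ₚ⇒~ χ′ (const b) eq (suc l))
      ... | no a≢0 with inverse a a≢0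
      ...   | b , ab≡1 = orb
        where
        root : Vec Carrier k → Vec Carrier k
        root v = (- b) · act T χ′ v
        T-root : ∀ v → act T χ v ≡ 𝟎 → T (root v) ≡ v
        T-root v eq = trans (·-homo lT (- b) _) (trans (cong ((- b) ·_) T-act)
          (trans (sym (·-assoc (- b) (- a) v)) (trans (cong (_· v) -b*-a) (1·v≡v v))))
          where
          T-act : T (act T χ′ v) ≡ (- a) · v
          T-act = ⊕-cancelʳ _ _ (a · v) (trans (⊕-comm _ _) (trans eq (sym (trans (sym (·-distrib-+ (- a) a v)) (trans (cong (_· v) (-‿inverseˡ a)) (0·v≡𝟎 v))))))
          -b*-a : - b * - a ≡ 1#
          -b*-a = trans (sym (-‿distribˡ-* b (- a))) (trans (cong -_ (sym (-‿distribʳ-* b a))) (trans (-‿involutive _) (trans (*-comm b a) ab≡1)))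
        root-T : ∀ v → root (T v) ≡ T (root v)
        root-T v = trans (cong ((- b) ·_) (sym (act-commute lT (λ _ → refl) χ′ v))) (sym (·-homo lT (- b) _))
        root-𝟎 : root 𝟎 ≡ 𝟎
        root-𝟎 = trans (cong ((- b) ·_) (𝟎-homo (act-linear lT χ′))) (a·𝟎≡𝟎 (- b))
        orbit-≢𝟎 : ∀ j → iter T j ε ≢ 𝟎
        orbit-≢𝟎 zero eq = ε≢𝟎 eq
        orbit-≢𝟎 (suc j) eq = orbit-≢𝟎 j (trans (sym (T-root _ (trans (cong (act T χ) (sym (act-X^ lT j ε))) (annihilates-orbit (Xₚ ^ₚ j)))))
          (trans (sym (root-T _)) (trans (cong root eq) root-𝟎)))
        power : ∀ f → ¬ (χ ∣ₚ f) → ∃ λ j → iter T j ε ≡ act T f ε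
        power f ¬div with generates f ¬div
        ... | j , div = j , trans (sym (act-X^ lT j ε)) (difference⁻¹ (Xₚ ^ₚ j) f (multiple-annihilates ((Xₚ ^ₚ j) -ₚ f) div))
        faithful : Faithful
        faithful f df eq with zero-or-degree f
        ... | inj₁ f~0 = f~0
        -- A nonzero polynomial of degree below k is not divisible by χ, so its value at ε is some
        -- T^j ε, which is not zero.
        ... | inj₂ (l , _ , nz) with power f (λ (h , fh) → nz (multiple-degree {χ} χ-monic f h df fh l))
        ...   | j , jf = ⊥-elim (orbit-≢𝟎 j (trans jf eq))
        orb : Orb T ε
        orb v v≢𝟎 with faithful⇒surjective faithful v
        -- A power is found for T⁻¹ v; one further application of T makes the exponent positive.
        ... | x , refl with faithful⇒surjective faithful (root (evaluate x))
        ...   | y , ey with power (Vec.toList y) (λ div → v≢𝟎 (trans (sym (T-root (evaluate x) (annihilates-orbit (Vec.toList x)))) (trans (cong T (trans (sym ey) (multiple-annihilates (Vec.toList y) div))) (𝟎-homo lT))))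
        ...     | j , eq = j , trans (cong T (trans eq ey)) (T-root (evaluate x) (annihilates-orbit (Vec.toList x)))

-- TSR matrices as shift operators on vectors of blocks.

module ShiftOperators (F : FiniteField) where
  open LinearAlgebra F
  open Polynomials F
  open Orbits F

  module _ {n m : ℕ} where

    Blocks : Set
    Blocks = Vec (Vec Carrier m) (suc n)

    -- The tensor e_B ⊗ u.
    at : Fin (suc n) → Vec Carrier m → Blocks
    at B u = tabulate λ C → δ C B · u

    previous : Blocks → Fin (suc n) → Vec Carrier m
    previous v zero = 𝟎
    previous v (suc B) = lookup v (inject₁ B)

    -- the action of the block matrix with coefficients c and blocks A, where f is the action of A
    shift : Vec Carrier (suc n) → (Vec Carrier m → Vec Carrier m) → Blocks → Blocks
    shift c f v = tabulate λ B → previous v B ⊕ lookup c B · f (lookup v (fromℕ n))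

    -- The tensor c ⊗ u: a block u leaving the last position comes back as c ⊗ f u.
    spread : Vec Carrier (suc n) → Vec Carrier m → Blocks
    spread c u = tabulate λ B → lookup c B · u

    at-linear : ∀ B → Linear (at B)
    at-linear B = tabulate-linear λ C → ·-linear (δ C B)

    lookup-at-δ : ∀ B C u → lookup (at B u) C ≡ δ C B · u
    lookup-at-δ B C u = Vecₚ.lookup∘tabulate (λ C → δ C B · u) C

    lookup-shift : ∀ c f v B → lookup (shift c f v) B ≡ previous v B ⊕ lookup c B · f (lookup v (fromℕ n))
    lookup-shift c f v B = Vecₚ.lookup∘tabulate (λ B → previous v B ⊕ lookup c B · f (lookup v (fromℕ n))) B

    lookup-at : ∀ B u → lookup (at B u) B ≡ u
    lookup-at B u = trans (lookup-at-δ B B u) (trans (cong (_· u) (δ-diag B)) (1·v≡v u))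

    lookup-at-off : ∀ {B C} u → C ≢ B → lookup (at B u) C ≡ 𝟎
    lookup-at-off {B} {C} u C≢B = trans (lookup-at-δ B C u) (trans (cong (_· u) (δ-off C≢B)) (0·v≡𝟎 u))

    at-injective : ∀ B {u v} → at B u ≡ at B v → u ≡ v
    at-injective B eq = trans (sym (lookup-at B _)) (trans (cong (λ x → lookup x B) eq) (lookup-at B _))

    at-≢𝟎 : ∀ B {u} → u ≢ 𝟎 → at B u ≢ 𝟎
    at-≢𝟎 B u≢𝟎 eq = u≢𝟎 (at-injective B (trans eq (sym (𝟎-homo (at-linear B)))))

    tabulate≡∑at : ∀ (g : Fin (suc n) → Vec Carrier m) → tabulate g ≡ ∑ (λ B → at B (g B))
    tabulate≡∑at g = lookup-ext λ C → trans (Vecₚ.lookup∘tabulate g C) (sym (trans (∑-homo (lookup-linear C) (λ B → at B (g B)))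
      (trans (∑-cong λ B → Vecₚ.lookup∘tabulate (λ C → δ C B · g B) C) (∑-δ g C))))

    module _ (c : Vec Carrier (suc n)) {f : Vec Carrier m → Vec Carrier m} (lf : Linear f) where

      previous-linear : ∀ B → Linear (λ v → previous v B)
      previous-linear zero = record { ⊕-homo = λ _ _ → sym (⊕-identityˡ 𝟎) ; ·-homo = λ a _ → sym (a·𝟎≡𝟎 a) }
      previous-linear (suc B) = lookup-linear (inject₁ B)

      shift-linear : Linear (shift c f)
      shift-linear = tabulate-linear λ B → ⊕-linear (previous-linear B) (∘-linear (·-linear (lookup c B)) (∘-linear lf (lookup-linear (fromℕ n))))

      shift-at : ∀ B u → shift c f (at (inject₁ B) u) ≡ at (suc B) u
      shift-at B u = Vecₚ.tabulate-cong λ C → trans (cong₂ _⊕_ refl (trans (cong (λ x → lookup c C · f x) (lookup-at-off u (Finₚ.fromℕ≢inject₁ {i = B})))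
          (trans (cong (lookup c C ·_) (𝟎-homo lf)) (a·𝟎≡𝟎 _)))) (trans (⊕-identityʳ _) (previous-at C))
        where
        previous-at : ∀ C → previous (at (inject₁ B) u) C ≡ δ C (suc B) · u
        previous-at zero = sym (0·v≡𝟎 u)
        previous-at (suc C) with C Fin.≟ B
        ... | yes refl = trans (lookup-at (inject₁ B) u) (sym (1·v≡v u))
        ... | no C≢B = trans (lookup-at-off u (C≢B ∘ Finₚ.inject₁-injective)) (sym (0·v≡𝟎 u))

      shift-at-last : ∀ u → shift c f (at (fromℕ n) u) ≡ spread c (f u)
      shift-at-last u = Vecₚ.tabulate-cong λ C → trans (cong₂ _⊕_ (previous-at C) (cong (λ x → lookup c C · f x) (lookup-at (fromℕ n) u))) (⊕-identityˡ _)
        where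
        previous-at : ∀ C → previous (at (fromℕ n) u) C ≡ 𝟎
        previous-at zero = refl
        previous-at (suc C) = lookup-at-off u (Finₚ.fromℕ≢inject₁ {i = C} ∘ sym)

      iter-shift : ∀ B u → iter (shift c f) (toℕ B) (at zero u) ≡ at B u
      iter-shift B u = go (toℕ B) B refl
        where
        -- Recursion on the number, because `inject₁ B` is not a subterm of `suc B`.
        go : ∀ j B → toℕ B ≡ j → iter (shift c f) j (at zero u) ≡ at B u
        go zero zero eq = refl
        go (suc j) (suc B) eq = trans (cong (shift c f) (go j (inject₁ B) (trans (Finₚ.toℕ-inject₁ B) (ℕₚ.suc-injective eq)))) (shift-at B u)

      iter-shift-full : ∀ u → iter (shift c f) (suc n) (at zero u) ≡ spread c (f u)
      iter-shift-full u = trans (cong (λ j → shift c f (iter (shift c f) j (at zero u))) (sym (Finₚ.toℕ-fromℕ n)))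
        (trans (cong (shift c f) (iter-shift (fromℕ n) u)) (shift-at-last u))

    module _ {g : Vec Carrier m → Vec Carrier m} (lg : Linear g) where

      map-at : ∀ B u → Vec.map g (at B u) ≡ at B (g u)
      map-at B u = lookup-ext λ C → trans (Vecₚ.lookup-map C g (at B u)) (trans (cong g (lookup-at-δ B C u))
        (trans (·-homo lg (δ C B) u) (sym (lookup-at-δ B C (g u)))))

      map-linear : Linear {Blocks} (Vec.map g)
      map-linear = record
        { ⊕-homo = λ u v → lookup-ext λ i → trans (Vecₚ.lookup-map i g (u ⊕ v)) (trans (cong g (Vecₚ.lookup-zipWith _⊕_ i u v))
            (trans (⊕-homo lg _ _) (sym (trans (Vecₚ.lookup-zipWith _⊕_ i (Vec.map g u) (Vec.map g v)) (cong₂ _⊕_ (Vecₚ.lookup-map i g u) (Vecₚ.lookup-map i g v))))))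
        ; ·-homo = λ a v → lookup-ext λ i → trans (Vecₚ.lookup-map i g (a · v)) (trans (cong g (Vecₚ.lookup-map i (a ·_) v))
            (trans (·-homo lg a _) (sym (trans (Vecₚ.lookup-map i (a ·_) (Vec.map g v)) (cong (a ·_) (Vecₚ.lookup-map i g v)))))) }

      -- The shift combines blocks with scalar coefficients and applies `f` inside one block, so 1 ⊗
      -- g intertwines two shifts as soon as g intertwines f and f′.
      shift-map : ∀ c {f f′} → (∀ u → g (f u) ≡ f′ (g u)) → ∀ v → Vec.map g (shift c f v) ≡ shift c f′ (Vec.map g v)
      shift-map c {f} {f′} comm v = lookup-ext λ B → trans (Vecₚ.lookup-map B g (shift c f v)) (trans (cong g (lookup-shift c f v B))
          (trans (⊕-homo lg _ _) (trans (cong₂ _⊕_ (previous-map B) (trans (·-homo lg (lookup c B) (f (lookup v (fromℕ n))))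
              (cong (lookup c B ·_) (trans (comm _) (cong f′ (sym (Vecₚ.lookup-map (fromℕ n) g v)))))))
            (sym (lookup-shift c f′ (Vec.map g v) B)))))
        where
        previous-map : ∀ B → g (previous v B) ≡ previous (Vec.map g v) B
        previous-map zero = 𝟎-homo lg
        previous-map (suc B) = sym (Vecₚ.lookup-map (inject₁ B) g v)

    toBlocks : Vec Carrier (suc n ℕ.* m) → Blocks
    toBlocks x = tabulate λ B → tabulate λ i → lookup x (combine B i)

    fromBlocks : Blocks → Vec Carrier (suc n ℕ.* m)
    fromBlocks v = tabulate λ r → lookup (lookup v (proj₁ (remQuot {suc n} m r))) (proj₂ (remQuot {suc n} m r))

    toBlocks-linear : Linear toBlocks
    toBlocks-linear = tabulate-linear λ B → tabulate-linear λ i → lookup-linear (combine B i)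

    lookup-toBlocks : ∀ x B i → lookup (lookup (toBlocks x) B) i ≡ lookup x (combine B i)
    lookup-toBlocks x B i = trans (cong (λ y → lookup y i) (Vecₚ.lookup∘tabulate (λ B → tabulate λ i → lookup x (combine B i)) B)) (Vecₚ.lookup∘tabulate (λ i → lookup x (combine B i)) i)

    toBlocks-injective : ∀ {x y} → toBlocks x ≡ toBlocks y → x ≡ y
    toBlocks-injective {x} {y} eq = lookup-ext λ r → subst (λ r → lookup x r ≡ lookup y r) (Finₚ.combine-remQuot {suc n} m r)
      (block (remQuot {suc n} m r))
      where
      block : ∀ ((B , i) : Fin (suc n) × Fin m) → lookup x (combine B i) ≡ lookup y (combine B i)
      block (B , i) = trans (sym (lookup-toBlocks x B i)) (trans (cong (λ v → lookup (lookup v B) i) eq) (lookup-toBlocks y B i))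

    toBlocks-fromBlocks : ∀ v → toBlocks (fromBlocks v) ≡ v
    toBlocks-fromBlocks v = lookup-ext λ B → lookup-ext λ i → trans (lookup-toBlocks (fromBlocks v) B i)
      (trans (Vecₚ.lookup∘tabulate _ (combine B i)) (cong (λ (C , j) → lookup (lookup v C) j) (Finₚ.remQuot-combine B i)))

    -- The sum over columns is split at the last block column, which contributes c_B A; among the
    -- other columns C only B = C + 1 survives, which moves the blocks down by one.
    toBlocks-tsr : ∀ c (A : Mat m) x → toBlocks (tsrMatrix m (suc n) c A ⊛ x) ≡ shift c (A ⊛_) (toBlocks x)
    toBlocks-tsr c A x = lookup-ext λ B → lookup-ext λ i → trans (lookup-toBlocks (T ⊛ x) B i)
        (trans (Vecₚ.lookup∘tabulate _ (combine B i)) (trans (∑-cong λ s → cong (_* lookup x s) (T-entry (combine B i) s))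
        (trans (∑-combine (suc n) {m} _) (trans (∑-cong λ C → ∑-cong λ j → cong₂ (λ p q → tsrBlockEntry m (suc n) c A p q * lookup x (combine C j))
            (Finₚ.remQuot-combine B i) (Finₚ.remQuot-combine C j))
        (trans (∑-last (λ C → ∑ λ j → tsrBlockEntry m (suc n) c A (B , i) (C , j) * lookup x (combine C j)))
          (trans (cong₂ _+_ (inner B i) (last B i)) (sym (trans (cong (λ y → lookup y i) (lookup-shift c (A ⊛_) (toBlocks x) B))
            (trans (⊕-homo (lookup-linear i) (previous (toBlocks x) B) (lookup c B · A ⊛ lookup (toBlocks x) (fromℕ n)))
              (cong₂ _+_ refl (·-homo (lookup-linear i) (lookup c B) (A ⊛ lookup (toBlocks x) (fromℕ n)))))))))))))
      where
      T : Mat (suc n ℕ.* m)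
      T = tsrMatrix m (suc n) c A
      T-entry : ∀ r s → entry T r s ≡ tsrBlockEntry m (suc n) c A (remQuot m r) (remQuot m s)
      T-entry r s = trans (cong (λ row → lookup row s) (Vecₚ.lookup∘tabulate _ r)) (Vecₚ.lookup∘tabulate _ s)
      last : ∀ B i → ∑ (λ j → tsrBlockEntry m (suc n) c A (B , i) (fromℕ n , j) * lookup x (combine (fromℕ n) j))
        ≡ lookup c B * lookup (A ⊛ lookup (toBlocks x) (fromℕ n)) i
      last B i rewrite Finₚ.toℕ-fromℕ n | Dec.dec-true (n ℕₚ.≟ n) refl =
            trans (∑-cong λ j → trans (*-assoc _ _ _) (cong (λ z → lookup c B * (entry A i j * z)) (sym (lookup-toBlocks x (fromℕ n) j))))
            (trans (sym (∑-homo (·-linear (lookup c B)) (λ j → entry A i j * lookup (lookup (toBlocks x) (fromℕ n)) j)))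
              (cong (lookup c B *_) (sym (Vecₚ.lookup∘tabulate _ i))))
      middle : ∀ B i (C : Fin n) j → tsrBlockEntry m (suc n) c A (B , i) (inject₁ C , j) ≡ (if does (toℕ B ℕₚ.≟ suc (toℕ C)) then δ i j else 0#)
      middle B i C j rewrite Finₚ.toℕ-inject₁ C | Dec.dec-false (toℕ C ℕₚ.≟ n) (λ eq → ℕₚ.<-irrefl eq (Finₚ.toℕ<n C)) = refl
      inner : ∀ B i → ∑ (λ C → ∑ λ j → tsrBlockEntry m (suc n) c A (B , i) (inject₁ C , j) * lookup x (combine (inject₁ C) j))
        ≡ lookup (previous (toBlocks x) B) i
      inner B i = trans (∑-cong λ C → ∑-cong λ j → cong (_* lookup x (combine (inject₁ C) j)) (middle B i C j)) (select B)
        where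
        g : Fin (suc n) → Fin n → Carrier
        g B C = ∑ λ j → (if does (toℕ B ℕₚ.≟ suc (toℕ C)) then δ i j else 0#) * lookup x (combine (inject₁ C) j)
        g-off : ∀ B C → toℕ B ≢ suc (toℕ C) → g B C ≡ 0#
        g-off B C ne rewrite Dec.dec-false (toℕ B ℕₚ.≟ suc (toℕ C)) ne = ∑-𝟎 {f = λ j → 0# * lookup x (combine (inject₁ C) j)} λ j → zeroˡ _
        select : ∀ B → ∑ (g B) ≡ lookup (previous (toBlocks x) B) i
        select zero = trans (∑-𝟎 λ C → g-off zero C λ ()) (sym (Vecₚ.lookup-replicate i 0#))
        select (suc B) = trans (∑-single (g (suc B)) B λ C C≢B → g-off (suc B) C λ eq → C≢B (Finₚ.toℕ-injective (sym (ℕₚ.suc-injective eq)))) diag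
          where
          diag : g (suc B) B ≡ lookup (lookup (toBlocks x) (inject₁ B)) i
          diag rewrite Dec.dec-true (toℕ B ℕₚ.≟ toℕ B) refl = trans (∑-δ (λ j → lookup x (combine (inject₁ B) j)) i) (sym (lookup-toBlocks x (inject₁ B) i))

  toBlocks-basis : ∀ {n m} → toBlocks {n} {suc m} (basis zero) ≡ at zero (basis zero)
  toBlocks-basis {n} {m} = lookup-ext λ B → lookup-ext λ i → trans (lookup-toBlocks {n} {suc m} (basis zero) B i)
      (trans (Vecₚ.lookup∘tabulate (δ zero) (combine B i)) (sym (trans (cong (λ y → lookup y i) (Vecₚ.lookup∘tabulate (λ C → δ C zero · basis zero) B))
        (trans (·-homo (lookup-linear i) (δ B zero) (basis zero)) (trans (cong (δ B zero *_) (Vecₚ.lookup∘tabulate (δ zero) i)) (δ-product B i))))))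
    where
    δ-product : ∀ (B : Fin (suc n)) (i : Fin (suc m)) → δ B zero * δ zero i ≡ δ zero (combine B i)
    δ-product zero zero = *-identityˡ _
    δ-product zero (suc i) = *-identityˡ _
    δ-product (suc B) i = zeroˡ _

  module _ {V W : Set} {{_ : VectorSpace V}} {{_ : VectorSpace W}} {T : V → V} {T′ : W → W} {ε : V}
      {φ : V → W} (lφ : Linear φ) (comm : ∀ v → φ (T v) ≡ T′ (φ v)) where

    orb-transport : (∀ w → ∃ λ v → φ v ≡ w) → Orb T ε → Orb T′ (φ ε)
    orb-transport sur orb w w≢𝟎 with sur w
    ... | v , refl with orb v (λ v≡𝟎 → w≢𝟎 (trans (cong φ v≡𝟎) (𝟎-homo lφ)))
    ...   | j , refl = j , sym (iter-commute {T = T} {T′ = T′} {g = φ} comm (suc j) ε)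

    orb-transport⁻¹ : (∀ {u v} → φ u ≡ φ v → u ≡ v) → Orb T′ (φ ε) → Orb T ε
    orb-transport⁻¹ inj orb v v≢𝟎 with orb (φ v) (λ eq → v≢𝟎 (inj (trans eq (sym (𝟎-homo lφ)))))
    ... | j , eq = j , inj (trans (iter-commute {T = T} {T′ = T′} {g = φ} comm (suc j) ε) eq)

-- Powers of a shift that preserve the first block, and rigidity.

module Rigidity (F : FiniteField) where
  open LinearAlgebra F
  open Polynomials F
  open Determinants F using (act-sum)
  open Orbits F
  open ShiftOperators F

  module ShiftOrbit {n m : ℕ} (c : Vec Carrier (suc n)) {f : Vec Carrier m → Vec Carrier m} (lf : Linear f)
      {w : Vec Carrier m} (w≢𝟎 : w ≢ 𝟎) (orb : Orb (shift c f) (at zero w)) where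

    T : Blocks {n} {m} → Blocks
    T = shift c f

    lT : Linear T
    lT = shift-linear c lf

    ε : Blocks {n} {m}
    ε = at zero w

    _≟B_ : DecidableEquality (Blocks {n} {m})
    _≟B_ = Finite._≟_ (Vec-finite (vector-finite m) (suc n))

    open OrbitProperties _≟B_ lT (at-≢𝟎 {n} zero w≢𝟎) orb public

    -- The vectors all of whose blocks lie in F[A]w form a T-invariant subspace containing ε.
    abstract
      irreducible : ∀ u → ∃ λ p → u ≡ act f p w
      irreducible u with Finite._≟_ (vector-finite m) u 𝟎
      ... | yes u≡𝟎 = [] , u≡𝟎
      ... | no u≢𝟎 with orb (at zero u) (at-≢𝟎 zero u≢𝟎)
      ...   | j , eq with invariant (suc j) zero
        where
        invariant : ∀ j B → ∃ λ p → lookup (iter T j ε) B ≡ act f p w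
        invariant zero zero = const 1# , trans (lookup-at {n} zero w) (sym (trans (act-const lf 1# w) (1·v≡v w)))
        invariant zero (suc B) = [] , lookup-at-off {n} {m} {zero} {suc B} w λ ()
        invariant (suc j) B with previous-invariant B | invariant j (fromℕ n)
          where
          previous-invariant : ∀ B → ∃ λ p → previous (iter T j ε) B ≡ act f p w
          previous-invariant zero = [] , refl
          previous-invariant (suc B) = invariant j (inject₁ B)
        ... | p , ep | q , eq = p +ₚ List.map (lookup c B *_) (0# ∷ q) , trans (lookup-shift c f (iter T j ε) B)
              (sym (trans (act-+ lf p (List.map (lookup c B *_) (0# ∷ q)) w) (cong₂ _⊕_ (sym ep) (trans (act-scale lf (lookup c B) (0# ∷ q) w)
                (cong (lookup c B ·_) (trans (cong₂ _⊕_ (0·v≡𝟎 w) (cong f (sym eq))) (⊕-identityˡ _)))))))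
      ...     | p , ep = p , trans (sym (lookup-at {n} zero u)) (trans (cong (λ v → lookup v zero) (sym eq)) ep)

      

    InFirst : Blocks {n} {m} → Set
    InFirst v = ∃ λ u → v ≡ at zero u

    inFirst? : ∀ v → Dec (InFirst v)
    inFirst? v with v ≟B at zero (lookup v zero)
    ... | yes eq = yes (lookup v zero , eq)
    ... | no ne = no λ (u , eq) → ne (trans eq (cong (at zero) (sym (trans (cong (λ x → lookup x zero) eq) (lookup-at {n} zero u)))))

    -- A condition on ε alone; by irreducibility it forces T^i to map the whole first block into
    -- itself.
    Stabilises : ℕ → Set
    Stabilises i = InFirst (iter T i ε)

    abstract
      -- Write u = p(f) w. The map 1 ⊗ p(f) commutes with T^i and preserves the first block, and it
      -- sends T^i ε to T^i (e₀ ⊗ u).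
      stabilises-first : ∀ i → Stabilises i → ∀ u → InFirst (iter T i (at zero u))
      stabilises-first i (x , eq) u with irreducible u
      ... | p , refl = act f p x , trans (cong (iter T i) (act-at p w)) (trans (act-commute (iter-linear lT i) map-iter p ε)
              (trans (cong (act (Vec.map f) p) eq) (sym (act-at p x))))
        where
        act-at : ∀ p u → at zero (act f p u) ≡ act (Vec.map f) p (at {n} zero u)
        act-at = act-commute (at-linear zero) (λ v → sym (map-at lf zero v))
        map-iter : ∀ v → iter T i (Vec.map f v) ≡ Vec.map f (iter T i v)
        map-iter v = sym (iter-commute {T = T} {T′ = T} {g = Vec.map f} (shift-map lf c {f} {f} λ _ → refl) i v)

      

    stabilises-+ : ∀ i j → Stabilises i → Stabilises j → Stabilises (i ℕ.+ j)
    stabilises-+ i j si (u , eq) with stabilises-first i si u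
    ... | x , ex = x , trans (iter-+ T i j ε) (trans (cong (iter T i) eq) ex)

    -- T^i is injective on the finite first block and therefore onto it, so T^(i+j) ε is T^i of a
    -- vector of the first block, and T^i can be cancelled.
    stabilises-∸ : ∀ i j → Stabilises i → Stabilises (i ℕ.+ j) → Stabilises j
    stabilises-∸ i j si (u , eq) with Finite.endo-injective⇒surjective (vector-finite m) M M-injective u
      where
      M : Vec Carrier m → Vec Carrier m
      M u = proj₁ (stabilises-first i si u)
      M-injective : ∀ {x y} → M x ≡ M y → x ≡ y
      M-injective {x} {y} eq = at-injective zero (iter-injective i (trans (proj₂ (stabilises-first i si x))
        (trans (cong (at zero) eq) (sym (proj₂ (stabilises-first i si y))))))
    ... | x , Mx = x , iter-injective i (trans (sym (iter-+ T i j ε)) (trans eq (trans (cong (at zero) (sym Mx)) (sym (proj₂ (stabilises-first i si x))))))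

    abstract
      leastStabiliser : ∃ λ d → Stabilises (suc d) × (∀ {l} → l ℕ.< d → ¬ Stabilises (suc l))
      leastStabiliser = least (λ l → inFirst? (iter T (suc l) ε)) (proj₁ leastPeriod) (w , iter-order)

      

    d : ℕ
    d = suc (proj₁ leastStabiliser)

    abstract
      multiple-stabilises : ∀ t → Stabilises (t ℕ.* d)
      multiple-stabilises zero = w , refl
      multiple-stabilises (suc t) = stabilises-+ d (t ℕ.* d) (proj₁ (proj₂ leastStabiliser)) (multiple-stabilises t)

      -- Stabilising exponents are closed under sums and differences, so the remainder modulo the
      -- least positive one stabilises as well and must be zero.
      stabilises⇒d∣ : ∀ e → Stabilises e → d ∣ e
      stabilises⇒d∣ e se = m%n≡0⇒n∣m e d (zero! (e DivMod.% d) (DivMod.m%n<n e d) remainder)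
        where
        remainder : Stabilises (e DivMod.% d)
        remainder = stabilises-∸ (e DivMod./ d ℕ.* d) (e DivMod.% d) (multiple-stabilises (e DivMod./ d))
          (subst Stabilises (trans (DivMod.m≡m%n+[m/n]*n e d) (ℕₚ.+-comm (e DivMod.% d) _)) se)
        zero! : ∀ r → r ℕ.< d → Stabilises r → r ≡ 0
        zero! zero _ _ = refl
        zero! (suc r) (s≤s lt) sr = ⊥-elim (proj₂ (proj₂ leastStabiliser) lt sr)

      d∣order : d ∣ order
      d∣order = stabilises⇒d∣ order (w , iter-order)

      

    -- The number of distinct vectors T^(t d) ε, that is, of nonzero vectors in the first block.
    index : ℕ
    index = _∣_.quotient d∣order

    order≡index*d : order ≡ index ℕ.* d
    order≡index*d = _∣_.equality d∣order

  module _ {n m : ℕ} {c c′ : Vec Carrier (suc n)} {f f′ : Vec Carrier m → Vec Carrier m} (lf : Linear f) (lf′ : Linear f′)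
      {w : Vec Carrier m} (w≢𝟎 : w ≢ 𝟎) (orb : Orb (shift c f) (at zero w)) (orb′ : Orb (shift c′ f′) (at zero w)) where
    private
      module S = ShiftOrbit c lf w≢𝟎 orb
      module S′ = ShiftOrbit c′ lf′ w≢𝟎 orb′

    -- Both cyclic subgroups biject with the nonzero vectors of the first block, hence have the same size.
    index-≤ : S.index ℕ.≤ S′.index
    index-≤ = Finₚ.injective⇒≤ {f = g} g-injective
      where
      exponent : Fin S.index → ℕ
      exponent i = toℕ i ℕ.* S.d
      exponent< : ∀ i → exponent i ℕ.< S.order
      exponent< i = subst (exponent i ℕ.<_) (sym S.order≡index*d) (ℕₚ.*-monoˡ-< S.d (Finₚ.toℕ<n i))
      u : Fin S.index → Vec Carrier m
      u i = proj₁ (S.multiple-stabilises (toℕ i))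
      iter-u : ∀ i → iter S.T (exponent i) S.ε ≡ at zero (u i)
      iter-u i = proj₂ (S.multiple-stabilises (toℕ i))
      reach : ∀ i → ∃ λ q → q ℕ.< S′.index × iter S′.T (q ℕ.* S′.d) S′.ε ≡ at zero (u i)
      reach i with orb′ (at zero (u i)) (λ eq → S.orbit-≢𝟎 (exponent i) (trans (iter-u i) eq))
      ... | j , eq with S′.stabilises⇒d∣ (suc j DivMod.% S′.order) (u i , trans (sym (S′.iter-mod (suc j))) eq)
      ...   | divides q e≡ = q , ℕₚ.*-cancelʳ-< S′.d q S′.index
                (ℕₚ.≤-<-trans (ℕₚ.≤-reflexive (sym e≡)) (subst (suc j DivMod.% S′.order ℕ.<_) S′.order≡index*d (DivMod.m%n<n (suc j) S′.order)))
              , trans (cong (λ k → iter S′.T k S′.ε) (sym e≡)) (trans (sym (S′.iter-mod (suc j))) eq)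
      g : Fin S.index → Fin S′.index
      g i = Fin.fromℕ< (proj₁ (proj₂ (reach i)))
      g-injective : ∀ {i j} → g i ≡ g j → i ≡ j
      g-injective {i} {j} eq = Finₚ.toℕ-injective (ℕₚ.*-cancelʳ-≡ _ _ S.d (S.orbit-injective (exponent< i) (exponent< j)
          (trans (iter-u i) (trans (trans (sym (proj₂ (proj₂ (reach i)))) (trans (cong (λ q → iter S′.T (q ℕ.* S′.d) S′.ε) q≡) (proj₂ (proj₂ (reach j))))) (sym (iter-u j))))))
        where
        q≡ : proj₁ (reach i) ≡ proj₁ (reach j)
        q≡ = trans (sym (Finₚ.toℕ-fromℕ< _)) (trans (cong toℕ eq) (Finₚ.toℕ-fromℕ< _))

  -- Comparison of two shifts under which ε has the same annihilator.

  module _ {n m : ℕ} {c c′ : Vec Carrier (suc n)} {f f′ : Vec Carrier m → Vec Carrier m} (lf : Linear f) (lf′ : Linear f′)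
      {w : Vec Carrier m} (w≢𝟎 : w ≢ 𝟎) (orb : Orb (shift c f) (at zero w)) (orb′ : Orb (shift c′ f′) (at zero w))
      (kernel⇒ : ∀ p → act (shift c f) p (at zero w) ≡ 𝟎 → act (shift c′ f′) p (at zero w) ≡ 𝟎)
      (kernel⇐ : ∀ p → act (shift c′ f′) p (at zero w) ≡ 𝟎 → act (shift c f) p (at zero w) ≡ 𝟎) where
    private
      module S = ShiftOrbit c lf w≢𝟎 orb
      module S′ = ShiftOrbit c′ lf′ w≢𝟎 orb′
      open S using (T; lT; ε)
      open S′ using () renaming (T to T′; lT to lT′)

      act-transport : ∀ {T T′ : Blocks {n} {m} → Blocks} (lT : Linear T) (lT′ : Linear T′) →
        (∀ p → act T p ε ≡ 𝟎 → act T′ p ε ≡ 𝟎) → ∀ p q → act T p ε ≡ act T q ε → act T′ p ε ≡ act T′ q ε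
      act-transport lT lT′ ker p q eq = u⊕⊖v≡𝟎⇒u≡v _ _ (trans (sym (act-- lT′ p q ε)) (ker (p -ₚ q)
        (trans (act-- lT p q ε) (trans (cong₂ _⊕_ eq refl) (⊕-inverseʳ _)))))

      transport : ∀ p q → act T p ε ≡ act T q ε → act T′ p ε ≡ act T′ q ε
      transport = act-transport lT lT′ kernel⇒

      iter-transport : ∀ {T T′ : Blocks {n} {m} → Blocks} (lT : Linear T) (lT′ : Linear T′) →
        (∀ p → act T p ε ≡ 𝟎 → act T′ p ε ≡ 𝟎) → ∀ i → iter T i ε ≡ ε → iter T′ i ε ≡ ε
      iter-transport lT lT′ ker i eq = trans (sym (act-X^ lT′ i ε)) (trans (act-transport lT lT′ ker (Xₚ ^ₚ i) (Xₚ ^ₚ 0)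
        (trans (act-X^ lT i ε) (trans eq (sym (act-X^ lT 0 ε))))) (act-X^ lT′ 0 ε))

      -- The period is determined by which of the polynomials X^i - 1 annihilate ε.
      order≡ : S.order ≡ S′.order
      order≡ with ℕₚ.<-cmp S.order S′.order
      ... | tri< lt _ _ = ⊥-elim (S′.order-minimal (s≤s z≤n) lt (iter-transport lT lT′ kernel⇒ S.order S.iter-order))
      ... | tri≈ _ eq _ = eq
      ... | tri> _ _ gt = ⊥-elim (S.order-minimal (s≤s z≤n) gt (iter-transport lT′ lT kernel⇐ S′.order S′.iter-order))

      index≡ : S.index ≡ S′.index
      index≡ = ℕₚ.≤-antisym (index-≤ lf lf′ w≢𝟎 orb orb′) (index-≤ lf′ lf w≢𝟎 orb′ orb)

      d≡ : S.d ≡ S′.d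
      d≡ = cancel S.index S.order≡index*d (trans order≡ (trans S′.order≡index*d (cong (ℕ._* S′.d) (sym index≡))))
        where
        -- The index is generalised to `s`: the case zero contradicts the positive order, and
        -- otherwise `s` can be cancelled.
        cancel : ∀ s → S.order ≡ s ℕ.* S.d → S.order ≡ s ℕ.* S′.d → S.d ≡ S′.d
        cancel (suc s) e e′ = ℕₚ.*-cancelˡ-≡ S.d S′.d (suc s) (trans (sym e) e′)

      stabilises-transport : ∀ i → S.Stabilises i → S′.Stabilises i
      stabilises-transport i si with S.stabilises⇒d∣ i si
      ... | divides t refl = subst (λ e → S′.Stabilises (t ℕ.* e)) (sym d≡) (S′.multiple-stabilises t)

      -- A nonzero e₀ ⊗ u is T^i ε with i stabilising for T, hence for T′, so p = X^i serves; for u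
      -- = 0 it is p = 0.
      reaching : ∀ u → ∃ λ p → act T p ε ≡ at zero u × S′.InFirst (act T′ p ε)
      reaching u with Finite._≟_ (vector-finite m) u 𝟎
      ... | yes refl = [] , sym (𝟎-homo (at-linear zero)) , 𝟎 , sym (𝟎-homo (at-linear zero))
      ... | no u≢𝟎 with orb (at zero u) (at-≢𝟎 zero u≢𝟎)
      ...   | j , eq with stabilises-transport (suc j) (u , eq)
      ...     | x , ex = Xₚ ^ₚ suc j , trans (act-X^ lT (suc j) ε) eq , x , trans (act-X^ lT′ (suc j) ε) ex

      q : Vec Carrier m → Poly
      q u = proj₁ (reaching u)

      act-q : ∀ u → act T (q u) ε ≡ at zero u
      act-q u = proj₁ (proj₂ (reaching u))

    -- The map p(T) ε ↦ p(T′) ε restricted to the first block, computed with one chosen p for each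
    -- u.
    intertwiner : Vec Carrier m → Vec Carrier m
    intertwiner u = proj₁ (proj₂ (proj₂ (reaching u)))

    private
      R : Vec Carrier m → Vec Carrier m
      R = intertwiner

      act-q′ : ∀ u → act T′ (q u) ε ≡ at zero (R u)
      act-q′ u = proj₂ (proj₂ (proj₂ (reaching u)))

      -- Nested annihilators make the value independent of the chosen polynomial, so each property
      -- of R is proved by exhibiting one convenient p.
      R-unique : ∀ p u x → act T p ε ≡ at zero u → act T′ p ε ≡ at zero x → R u ≡ x
      R-unique p u x eq eq′ = at-injective zero (trans (sym (act-q′ u)) (trans (transport (q u) p (trans (act-q u) (sym eq))) eq′))

    intertwiner-linear : Linear intertwiner
    intertwiner-linear = record
      { ⊕-homo = λ u v → R-unique (q u +ₚ q v) (u ⊕ v) (R u ⊕ R v)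
          (trans (act-+ lT (q u) (q v) ε) (trans (cong₂ _⊕_ (act-q u) (act-q v)) (sym (⊕-homo (at-linear zero) u v))))
          (trans (act-+ lT′ (q u) (q v) ε) (trans (cong₂ _⊕_ (act-q′ u) (act-q′ v)) (sym (⊕-homo (at-linear zero) (R u) (R v)))))
      ; ·-homo = λ a u → R-unique (List.map (a *_) (q u)) (a · u) (a · R u)
          (trans (act-scale lT a (q u) ε) (trans (cong (a ·_) (act-q u)) (sym (·-homo (at-linear zero) a u))))
          (trans (act-scale lT′ a (q u) ε) (trans (cong (a ·_) (act-q′ u)) (sym (·-homo (at-linear zero) a (R u))))) }

    intertwiner-fixes : intertwiner w ≡ w
    intertwiner-fixes = R-unique (Xₚ ^ₚ 0) w w (act-X^ lT 0 ε) (act-X^ lT′ 0 ε)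

    intertwiner-kernel : ∀ u → intertwiner u ≡ 𝟎 → u ≡ 𝟎
    intertwiner-kernel u eq = at-injective zero (trans (sym (act-q u)) (trans
      (kernel⇐ (q u) (trans (act-q′ u) (trans (cong (at zero) eq) (𝟎-homo (at-linear zero))))) (sym (𝟎-homo (at-linear zero)))))

    private
      -- T^n applied to the first block, computed on both sides of the intertwiner.
      spread-≡ : ∀ u → spread c′ (f′ (R u)) ≡ spread c (R (f u))
      spread-≡ u = trans (sym (iter-shift-full c′ lf′ (R u))) (trans (cong (iter T′ (suc n)) (sym (act-q′ u)))
          (trans (sym (trans (act-* lT′ (Xₚ ^ₚ suc n) (q u) ε) (act-X^ lT′ (suc n) _)))
            (trans (transport ((Xₚ ^ₚ suc n) *ₚ q u) (sumₚ (List.tabulate pieces)) same) image)))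
        where
        pieces : Fin (suc n) → Poly
        pieces B = (Xₚ ^ₚ toℕ B) *ₚ q (lookup c B · f u)
        same : act T ((Xₚ ^ₚ suc n) *ₚ q u) ε ≡ act T (sumₚ (List.tabulate pieces)) ε
        same = trans (act-* lT (Xₚ ^ₚ suc n) (q u) ε) (trans (act-X^ lT (suc n) _) (trans (cong (iter T (suc n)) (act-q u))
          (trans (iter-shift-full c lf u) (trans (tabulate≡∑at (λ B → lookup c B · f u)) (sym (trans (act-sum lT pieces ε)
            (∑-cong λ B → trans (act-* lT (Xₚ ^ₚ toℕ B) (q (lookup c B · f u)) ε) (trans (act-X^ lT (toℕ B) _)
              (trans (cong (iter T (toℕ B)) (act-q (lookup c B · f u))) (iter-shift c lf B _))))))))))
        image : act T′ (sumₚ (List.tabulate pieces)) ε ≡ spread c (R (f u))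
        image = trans (act-sum lT′ pieces ε) (trans
          (∑-cong λ B → trans (act-* lT′ (Xₚ ^ₚ toℕ B) (q (lookup c B · f u)) ε) (trans (act-X^ lT′ (toℕ B) _)
            (trans (cong (iter T′ (toℕ B)) (act-q′ (lookup c B · f u))) (trans (iter-shift c′ lf′ B _)
              (cong (at B) (·-homo intertwiner-linear (lookup c B) (f u)))))))
          (sym (tabulate≡∑at (λ B → lookup c B · R (f u)))))

      component : ∀ B u → lookup c′ B · f′ (R u) ≡ lookup c B · R (f u)
      component B u = trans (sym (Vecₚ.lookup∘tabulate (λ B → lookup c′ B · f′ (R u)) B))
        (trans (cong (λ v → lookup v B) (spread-≡ u)) (Vecₚ.lookup∘tabulate (λ B → lookup c B · R (f u)) B))

    module _ (c₀≡1 : lookup c zero ≡ 1#) (c′₀≡1 : lookup c′ zero ≡ 1#) where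

      -- Block zero of the comparison, where both coefficients are one.
      intertwines : ∀ u → f′ (intertwiner u) ≡ intertwiner (f u)
      intertwines u = trans (sym (1·v≡v _)) (trans (cong (_· f′ (R u)) (sym c′₀≡1)) (trans (component zero u)
        (trans (cong (_· R (f u)) c₀≡1) (1·v≡v _))))

      -- Given the intertwining relation, block B compares the multiples by c_B and c′_B of one
      -- vector R (f w), which is nonzero.
      coefficients≡ : c ≡ c′
      coefficients≡ = lookup-ext λ B → sym (scale-cancelʳ (R (f w)) Rfw≢𝟎
          (trans (cong (lookup c′ B ·_) (sym (intertwines w))) (component B w)))
        where
        Rfw≢𝟎 : R (f w) ≢ 𝟎
        -- Otherwise f w = 0, and T^(n+1) ε = c ⊗ f w would vanish.
        Rfw≢𝟎 eq = S.orbit-≢𝟎 (suc n) (trans (iter-shift-full c lf w) (lookup-ext λ B →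
          trans (Vecₚ.lookup∘tabulate (λ B → lookup c B · f w) B) (trans (cong (lookup c B ·_) (intertwiner-kernel (f w) eq))
            (trans (a·𝟎≡𝟎 _) (sym (Vecₚ.lookup-replicate B 𝟎))))))

      abstract
        rigidity : c ≡ c′ × ∃ λ (R : Vec Carrier m → Vec Carrier m) →
          Linear R × R w ≡ w × (∀ u → R u ≡ 𝟎 → u ≡ 𝟎) × (∀ u → f′ (R u) ≡ R (f u))
        rigidity = coefficients≡ , intertwiner , intertwiner-linear , intertwiner-fixes , intertwiner-kernel , intertwines

-- Counting with duplicate-free lists: unions, fibres and complements.

module ListCounting where

  concatMap-unique : ∀ {A B : Set} (g : A → List B) {xs} → (∀ {x} → x ∈ xs → Unique (g x)) →
    AllPairs (λ x y → Disjoint (g x) (g y)) xs → Unique (List.concatMap g xs)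
  concatMap-unique g {xs} unique disjoint =
    Uniqueₚ.concat⁺ (Allₚ.map⁺ (All.tabulate unique)) (AllPairsₚ.map⁺ disjoint)

  allPairs-with : ∀ {A : Set} {P : A → Set} {Q : A → A → Set} {xs} → All P xs → AllPairs Q xs →
    AllPairs (λ x y → P x × P y × Q x y) xs
  allPairs-with [] [] = []
  allPairs-with (px ∷ pxs) (qx ∷ qxs) = All.zipWith (λ (py , q) → px , py , q) (pxs , qx) ∷ allPairs-with pxs qxs

  concatMap-length : ∀ {A B : Set} (g : A → List B) N xs → (∀ {x} → x ∈ xs → length (g x) ≡ N) →
    length (List.concatMap g xs) ≡ length xs ℕ.* N
  concatMap-length g N [] eq = refl
  concatMap-length g N (x ∷ xs) eq = trans (Listₚ.length-++ (g x)) (cong₂ ℕ._+_ (eq (here refl)) (concatMap-length g N xs (eq ∘ there)))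

  ∈-concatMap⁺ : ∀ {A B : Set} (g : A → List B) {x xs y} → x ∈ xs → y ∈ g x → y ∈ List.concatMap g xs
  ∈-concatMap⁺ g x∈ y∈ = ∈ₚ.∈-concatMap⁺ g (lose x∈ y∈)

  ∈-concatMap⁻ : ∀ {A B : Set} (g : A → List B) {xs y} → y ∈ List.concatMap g xs → ∃ λ x → x ∈ xs × y ∈ g x
  ∈-concatMap⁻ g {xs} y∈ = find (∈ₚ.∈-concatMap⁻ g {xs = xs} y∈)

  module _ {A B : Set} (_≟_ : DecidableEquality B) (f : A → B) where

    representatives : List A → List A
    representatives [] = []
    representatives (x ∷ xs) with Any.any? (λ y → f x ≟ f y) (representatives xs)
    ... | yes _ = representatives xs
    ... | no _ = x ∷ representatives xs

    representatives-⊆ : ∀ xs {x} → x ∈ representatives xs → x ∈ xs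
    representatives-⊆ (x ∷ xs) x∈ with Any.any? (λ y → f x ≟ f y) (representatives xs)
    representatives-⊆ (x ∷ xs) x∈ | yes _ = there (representatives-⊆ xs x∈)
    representatives-⊆ (x ∷ xs) (here eq) | no _ = here eq
    representatives-⊆ (x ∷ xs) (there x∈) | no _ = there (representatives-⊆ xs x∈)

    representatives-distinct : ∀ xs → AllPairs (λ x y → f x ≢ f y) (representatives xs)
    representatives-distinct [] = []
    representatives-distinct (x ∷ xs) with Any.any? (λ y → f x ≟ f y) (representatives xs)
    ... | yes _ = representatives-distinct xs
    ... | no none = Allₚ.¬Any⇒All¬ _ none ∷ representatives-distinct xs

    representatives-cover : ∀ xs {x} → x ∈ xs → ∃ λ r → r ∈ representatives xs × f x ≡ f r
    representatives-cover (y ∷ xs) x∈ with Any.any? (λ z → f y ≟ f z) (representatives xs)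
    representatives-cover (y ∷ xs) (here refl) | yes p = find p
    representatives-cover (y ∷ xs) (there x∈) | yes p = representatives-cover xs x∈
    representatives-cover (y ∷ xs) (here refl) | no _ = y , here refl , refl
    representatives-cover (y ∷ xs) (there x∈) | no _ = let (r , r∈ , eq) = representatives-cover xs x∈ in r , there r∈ , eq

  open FiniteSets

  -- The elements outside followed by `S` enumerate the whole set without repetition.
  complement-length : ∀ {A : Set} (fin : Finite A) (S : List A) → Unique S →
    length (List.filter (λ x → Dec.¬? (member? (Finite._≟_ fin) x S)) (Finite.all fin)) ≡ Finite.∣all∣ fin ℕ.∸ length S
  complement-length fin S S! = trans (sym (ℕₚ.m+n∸n≡m _ (length S))) (cong (ℕ._∸ length S)
      (trans (sym (Listₚ.length-++ outside)) (ℕₚ.≤-antisym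
        (unique-⊆-length (Uniqueₚ.++⁺ (Uniqueₚ.filter⁺ _ (Finite.all-unique fin)) S! λ (p , q) → proj₂ (∈ₚ.∈-filter⁻ outside? {xs = Finite.all fin} p) q) λ _ → Finite.all-complete fin _)
        (unique-⊆-length (Finite.all-unique fin) λ {x} _ → cover x))))
    where
    outside? = λ x → Dec.¬? (member? (Finite._≟_ fin) x S)
    outside = List.filter outside? (Finite.all fin)
    cover : ∀ x → x ∈ outside ++ S
    cover x with member? (Finite._≟_ fin) x S
    ... | yes p = ∈ₚ.∈-++⁺ʳ outside p
    ... | no p = ∈ₚ.∈-++⁺ˡ (∈ₚ.∈-filter⁺ outside? (Finite.all-complete fin x) p)

-- Counting completions to a basis, and conjugation by an invertible map.

module Frames (F : FiniteField) where
  open LinearAlgebra F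
  open Polynomials F
  open Orbits F using (vector-finite)
  open ListCounting

  q : ℕ
  q = card F

  combination : ∀ {V : Set} {{_ : VectorSpace V}} {j} → Vec V j → Vec Carrier j → V
  combination bs x = ∑ λ i → lookup x i · lookup bs i

  combination-linear : ∀ {V : Set} {{_ : VectorSpace V}} {j} (bs : Vec V j) → Linear (combination bs)
  combination-linear bs = ∑-linear λ i → record
    { ⊕-homo = λ x y → trans (cong (_· lookup bs i) (⊕-homo (lookup-linear i) x y)) (·-distrib-+ _ _ _)
    ; ·-homo = λ a x → trans (cong (_· lookup bs i) (·-homo (lookup-linear i) a x)) (·-assoc _ _ _) }

  combination-basis : ∀ {V : Set} {{_ : VectorSpace V}} {j} (bs : Vec V j) i → combination bs (basis i) ≡ lookup bs i
  combination-basis bs i = trans (∑-cong λ j → cong (_· lookup bs j) (Vecₚ.lookup∘tabulate (δ i) j)) (∑-δ (lookup bs) i)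

  module _ {m : ℕ} where
    private
      V : Set
      V = Vec Carrier m
      fin : Finite V
      fin = vector-finite m
      _∈?_ : ∀ (v : V) S → Dec (v ∈ S)
      _∈?_ = member? (Finite._≟_ fin)

    -- A subspace is a duplicate-free list, so that its length is its cardinality and the vectors
    -- outside can be counted.
    record Subspace (S : List V) : Set where
      field
        𝟎∈ : 𝟎 ∈ S
        ⊕∈ : ∀ {u v} → u ∈ S → v ∈ S → u ⊕ v ∈ S
        ·∈ : ∀ a {v} → v ∈ S → a · v ∈ S
        distinct : Unique S

      scaled∈ : ∀ {a v} → a ≢ 0# → a · v ∈ S → v ∈ S
      scaled∈ {a} {v} a≢0 av∈ with inverse a a≢0
      ... | b , ab≡1 = subst (_∈ S) (trans (sym (·-assoc b a v)) (trans (cong (_· v) (trans (*-comm b a) ab≡1)) (1·v≡v v))) (·∈ b av∈)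

    open Subspace

    translates : V → List V → Carrier → List V
    translates b S a = List.map (a · b ⊕_) S

    adjoin : V → List V → List V
    adjoin b S = List.concatMap (translates b S) elements

    module _ {b : V} {S : List V} (sub : Subspace S) where

      ∈-adjoin⁺ : ∀ a {s} → s ∈ S → a · b ⊕ s ∈ adjoin b S
      ∈-adjoin⁺ a s∈ = ∈-concatMap⁺ (translates b S) (complete a) (∈ₚ.∈-map⁺ _ s∈)

      ∈-adjoin⁻ : ∀ {v} → v ∈ adjoin b S → ∃ λ a → ∃ λ s → s ∈ S × v ≡ a · b ⊕ s
      ∈-adjoin⁻ v∈ with ∈-concatMap⁻ (translates b S) {xs = elements} v∈
      ... | a , _ , v∈a with ∈ₚ.∈-map⁻ (a · b ⊕_) v∈a
      ...   | s , s∈ , eq = a , s , s∈ , eq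

      adjoin-subspace : b ∉ S → Subspace (adjoin b S)
      adjoin-subspace b∉ = record
        { 𝟎∈ = subst (_∈ adjoin b S) (trans (⊕-identityʳ _) (0·v≡𝟎 b)) (∈-adjoin⁺ 0# (𝟎∈ sub))
        ; ⊕∈ = λ u∈ v∈ → let (a , s , s∈ , eu) = ∈-adjoin⁻ u∈ ; (a′ , s′ , s′∈ , ev) = ∈-adjoin⁻ v∈ in
            subst (_∈ adjoin b S) (trans (cong (_⊕ (s ⊕ s′)) (·-distrib-+ a a′ b)) (trans (⊕-interchange (a · b) (a′ · b) s s′) (sym (cong₂ _⊕_ eu ev))))
              (∈-adjoin⁺ (a + a′) (⊕∈ sub s∈ s′∈))
        ; ·∈ = λ x v∈ → let (a , s , s∈ , ev) = ∈-adjoin⁻ v∈ in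
            subst (_∈ adjoin b S) (trans (cong (_⊕ x · s) (·-assoc x a b)) (trans (sym (·-distrib-⊕ x (a · b) s)) (cong (x ·_) (sym ev))))
              (∈-adjoin⁺ (x * a) (·∈ sub x s∈))
        ; distinct = concatMap-unique (translates b S) (λ {a} _ → Uniqueₚ.map⁺ (λ {u} {v} eq → ⊕-cancelʳ u v (a · b) (trans (⊕-comm u _) (trans eq (⊕-comm _ v)))) (distinct sub))
            (AllPairs.map (λ {a} {a′} → disjoint a a′) unique) }
        where
        disjoint : ∀ a a′ → a ≢ a′ → Disjoint (translates b S a) (translates b S a′)
        disjoint a a′ a≢a′ (v∈ , v∈′) with ∈ₚ.∈-map⁻ (a · b ⊕_) v∈ | ∈ₚ.∈-map⁻ (a′ · b ⊕_) v∈′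
        -- A common element of two translates puts (a - a′) b into S, and dividing by a - a′ would
        -- put b there.
        ... | s , s∈ , refl | s′ , s′∈ , eq = b∉ (scaled∈ sub (λ z → a≢a′ (u⊕⊖v≡𝟎⇒u≡v a a′ z))
              (subst (_∈ S) difference (⊕∈ sub s′∈ (·∈ sub (- 1#) s∈))))
          where
          difference : s′ ⊕ ⊖ s ≡ (a + ⊖ a′) · b
          difference = ⊕-cancelʳ _ _ (a′ · b ⊕ s) (trans (⊕-interchange s′ (⊖ s) (a′ · b) s) (trans (cong₂ _⊕_ (trans (⊕-comm s′ _) (sym eq)) (⊕-inverseˡ s))
            (trans (⊕-identityʳ _) (trans (cong (λ x → x · b ⊕ s) (sym a-a′+a′)) (trans (cong (_⊕ s) (·-distrib-+ (a + ⊖ a′) a′ b)) (⊕-assoc _ _ s))))))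
            where
            a-a′+a′ : (a + ⊖ a′) + a′ ≡ a
            a-a′+a′ = trans (+-assoc a _ a′) (trans (cong (a +_) (⊕-inverseˡ a′)) (+-identityʳ a))

    adjoin-length : ∀ b S → length (adjoin b S) ≡ q ℕ.* length S
    adjoin-length b S = concatMap-length (translates b S) (length S) elements (λ _ → Listₚ.length-map _ S)

    -- Linear independence of the images in the quotient V/S.
    IndependentOver : ∀ {j} → List V → Vec V j → Set
    IndependentOver S bs = ∀ x → combination bs x ∈ S → x ≡ 𝟎

    outside : List V → List V
    outside S = List.filter (λ v → Dec.¬? (v ∈? S)) (Finite.all fin)

    ∈-outside⁻ : ∀ {S b} → b ∈ outside S → b ∉ S
    ∈-outside⁻ {S} b∈ = proj₂ (∈ₚ.∈-filter⁻ (λ v → Dec.¬? (v ∈? S)) {xs = Finite.all fin} b∈)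

    -- Each vector is chosen outside the span of S and its predecessors. In this form the number of
    -- choices at every stage depends only on the size of the span.
    extensions : List V → ∀ j → List (Vec V j)
    prepend : List V → ∀ j → V → List (Vec V (suc j))
    extensions S zero = [] ∷ []
    extensions S (suc j) = List.concatMap (prepend S j) (outside S)
    prepend S j b = List.map (b ∷_) (extensions (adjoin b S) j)

    -- If x b plus a combination of `bs` lies in S, that combination lies in the span of b and S, so
    -- its coefficients vanish; then x b is in S, which forces x = 0.
    independent-∷⁺ : ∀ {S j b} (bs : Vec V j) → Subspace S → b ∉ S → IndependentOver (adjoin b S) bs → IndependentOver S (b ∷ bs)
    independent-∷⁺ {S} {b = b} bs sub b∉ ind (x ∷ xs) s∈ with ind xs (subst (_∈ adjoin b S) rearrange (∈-adjoin⁺ sub (- 1# * x) s∈))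
      where
      rearrange : (- 1# * x) · b ⊕ (x · b ⊕ combination bs xs) ≡ combination bs xs
      rearrange = trans (sym (⊕-assoc _ _ _)) (trans (cong (_⊕ combination bs xs) (trans (cong (_⊕ x · b) (·-assoc (- 1#) x b)) (⊕-inverseˡ (x · b)))) (⊕-identityˡ _))
    ... | refl = cong (_∷ 𝟎) x≡0
      where
      x≡0 : x ≡ 0#
      x≡0 with x ≟ 0#
      ... | yes eq = eq
      ... | no ne = ⊥-elim (b∉ (scaled∈ sub ne (subst (_∈ S) (trans (cong₂ _⊕_ refl (𝟎-homo (combination-linear bs))) (⊕-identityʳ _)) s∈)))

    independent-head : ∀ {S j b} (bs : Vec V j) → IndependentOver S (b ∷ bs) → b ∉ S
    independent-head {S} {b = b} bs ind b∈ = 0≢1 (sym (cong (λ x → lookup x zero) (ind (basis zero) (subst (_∈ S) (sym (combination-basis (b ∷ bs) zero)) b∈))))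

    independent-tail : ∀ {S j b} (bs : Vec V j) → Subspace S → IndependentOver S (b ∷ bs) → IndependentOver (adjoin b S) bs
    independent-tail {S} {b = b} bs sub ind xs v∈ with ∈-adjoin⁻ sub v∈
    ... | a , s , s∈ , eq = Vecₚ.∷-injectiveʳ (ind ((- 1# * a) ∷ xs) (subst (_∈ S) (sym (trans (cong₂ _⊕_ refl eq) rearrange)) s∈))
      where
      rearrange : (- 1# * a) · b ⊕ (a · b ⊕ s) ≡ s
      rearrange = trans (sym (⊕-assoc _ _ _)) (trans (cong (_⊕ s) (trans (cong (_⊕ a · b) (·-assoc (- 1#) a b)) (⊕-inverseˡ (a · b)))) (⊕-identityˡ _))

    extensions-sound : ∀ {S} j → Subspace S → ∀ {bs} → bs ∈ extensions S j → IndependentOver S bs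
    extensions-sound zero sub (here refl) [] _ = refl
    extensions-sound {S} (suc j) sub bs∈ with ∈-concatMap⁻ (prepend S j) {xs = outside S} bs∈
    ... | b , b∈ , bs∈b with ∈ₚ.∈-map⁻ (b ∷_) bs∈b
    ...   | cs , cs∈ , refl = independent-∷⁺ cs sub b∉ (extensions-sound j (adjoin-subspace sub b∉) cs∈)
      where
      b∉ : b ∉ S
      b∉ = ∈-outside⁻ {S} b∈

    extensions-complete : ∀ {S} j → Subspace S → ∀ bs → IndependentOver S bs → bs ∈ extensions S j
    extensions-complete zero sub [] ind = here refl
    extensions-complete {S} (suc j) sub (b ∷ bs) ind = ∈-concatMap⁺ (prepend S j)
        (∈ₚ.∈-filter⁺ (λ v → Dec.¬? (v ∈? S)) (Finite.all-complete fin b) b∉)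
        (∈ₚ.∈-map⁺ (b ∷_) (extensions-complete j (adjoin-subspace sub b∉) bs (independent-tail bs sub ind)))
      where
      b∉ : b ∉ S
      b∉ = independent-head bs ind

    extensions-unique : ∀ S j → Unique (extensions S j)
    extensions-unique S zero = [] ∷ []
    extensions-unique S (suc j) = concatMap-unique (prepend S j)
        (λ {b} _ → Uniqueₚ.map⁺ Vecₚ.∷-injectiveʳ (extensions-unique (adjoin b S) j))
        (AllPairs.map heads (Uniqueₚ.filter⁺ (λ v → Dec.¬? (v ∈? S)) (Finite.all-unique fin)))
      where
      heads : ∀ {b c} → b ≢ c → Disjoint (prepend S j b) (prepend S j c)
      heads {b} {c} b≢c (p , r) with ∈ₚ.∈-map⁻ (b ∷_) p | ∈ₚ.∈-map⁻ (c ∷_) r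
      ... | _ , _ , refl | _ , _ , eq = b≢c (Vecₚ.∷-injectiveˡ eq)

    -- The product of q^m - q^t over i ≤ t < i + j.
    fallingProduct : ℕ → ℕ → ℕ
    fallingProduct i zero = 1
    fallingProduct i (suc j) = (q ℕ.^ m ℕ.∸ q ℕ.^ i) ℕ.* fallingProduct (suc i) j

    -- There are q^m - q^i vectors outside S, and adjoining any of them gives a subspace with
    -- q^(i+1) elements.
    extensions-length : ∀ {S} i j → Subspace S → length S ≡ q ℕ.^ i → length (extensions S j) ≡ fallingProduct i j
    extensions-length i zero sub len = refl
    extensions-length {S} i (suc j) sub len = trans (concatMap-length (prepend S j) (fallingProduct (suc i) j) (outside S)
          (λ {b} b∈ → trans (Listₚ.length-map (b ∷_) (extensions (adjoin b S) j)) (extensions-length (suc i) j (adjoin-subspace sub (∈-outside⁻ {S} b∈))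
            (trans (adjoin-length b S) (cong (q ℕ.*_) len)))))
        (cong (ℕ._* fallingProduct (suc i) j) (trans (complement-length fin S (distinct sub)) (cong₂ ℕ._∸_ (length-vectors elements m) len)))

    -- Generalised over `g`, because unfolding `applyUpTo` composes it with `suc`.
    fallingProduct-applyUpTo : ∀ i j (g : ℕ → ℕ) → (∀ t → g t ≡ i ℕ.+ t) →
      product (List.map (λ t → q ℕ.^ m ℕ.∸ q ℕ.^ t) (List.applyUpTo g j)) ≡ fallingProduct i j
    fallingProduct-applyUpTo i zero g eq = refl
    fallingProduct-applyUpTo i (suc j) g eq = cong₂ (λ a p → (q ℕ.^ m ℕ.∸ q ℕ.^ a) ℕ.* p) (trans (eq 0) (ℕₚ.+-identityʳ i))
      (fallingProduct-applyUpTo (suc i) j (g ∘ suc) λ t → trans (eq (suc t)) (ℕₚ.+-suc i t))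

    line : V → List V
    line w = List.map (_· w) elements

    line-subspace : ∀ {w} → w ≢ 𝟎 → Subspace (line w)
    line-subspace {w} w≢𝟎 = record
      { 𝟎∈ = subst (_∈ line w) (0·v≡𝟎 w) (∈-line 0#)
      ; ⊕∈ = λ u∈ v∈ → let (a , _ , eu) = ∈ₚ.∈-map⁻ (_· w) u∈ ; (b , _ , ev) = ∈ₚ.∈-map⁻ (_· w) v∈ in
          subst (_∈ line w) (trans (·-distrib-+ a b w) (sym (cong₂ _⊕_ eu ev))) (∈-line (a + b))
      ; ·∈ = λ x v∈ → let (a , _ , ev) = ∈ₚ.∈-map⁻ (_· w) v∈ in
          subst (_∈ line w) (trans (·-assoc x a w) (cong (x ·_) (sym ev))) (∈-line (x * a))
      ; distinct = Uniqueₚ.map⁺ (scale-cancelʳ w w≢𝟎) unique }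
      where
      ∈-line : ∀ a → a · w ∈ line w
      ∈-line a = ∈ₚ.∈-map⁺ (_· w) (complete a)

    -- Together with the converse below: counting independent tuples modulo the line of w counts the
    -- maps of trivial kernel whose first column is w.
    independent-over-line⁻ : ∀ {w j} (bs : Vec V j) → w ≢ 𝟎 → IndependentOver (line w) bs → ∀ x → combination (w ∷ bs) x ≡ 𝟎 → x ≡ 𝟎
    independent-over-line⁻ {w} bs w≢𝟎 ind (x ∷ xs) eq with ind xs (subst (_∈ line w) (sym xs≡) (∈ₚ.∈-map⁺ (_· w) (complete (- 1# * x))))
      where
      xs≡ : combination bs xs ≡ (- 1# * x) · w
      xs≡ = ⊕-cancelʳ _ _ (x · w) (trans (⊕-comm _ (x · w)) (trans eq (sym (trans (cong (_⊕ x · w) (·-assoc (- 1#) x w)) (⊕-inverseˡ (x · w))))))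
    ... | refl = cong (_∷ 𝟎) (scale-cancelʳ w w≢𝟎 (trans (trans (sym (trans (cong₂ _⊕_ refl (𝟎-homo (combination-linear bs))) (⊕-identityʳ _))) eq) (sym (0·v≡𝟎 w))))

    independent-over-line⁺ : ∀ {w j} (bs : Vec V j) → (∀ x → combination (w ∷ bs) x ≡ 𝟎 → x ≡ 𝟎) → IndependentOver (line w) bs
    independent-over-line⁺ {w} bs ker xs xs∈ with ∈ₚ.∈-map⁻ (_· w) xs∈
    ... | a , _ , eq = Vecₚ.∷-injectiveʳ (ker ((- 1# * a) ∷ xs) (trans (cong₂ _⊕_ (·-assoc (- 1#) a w) eq) (⊕-inverseˡ (a · w))))

    abstract
      -- Arbitrary outside the image of R.
      preimage : (V → V) → V → V
      preimage R y with Finite.any? fin (λ x → Finite._≟_ fin (R x) y)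
      ... | yes (x , _) = x
      ... | no _ = 𝟎

      R-preimage : ∀ (R : V → V) → (∀ y → ∃ λ x → R x ≡ y) → ∀ y → R (preimage R y) ≡ y
      R-preimage R sur y with Finite.any? fin (λ x → Finite._≟_ fin (R x) y)
      ... | yes (_ , eq) = eq
      ... | no none = ⊥-elim (none (sur y))

    abstract
      -- The matrix of R A R⁻¹. It is defined for every R, so that tuples can be mapped over before
      -- their independence is invoked; it has its meaning only for bijective linear R.
      conjugate : (V → V) → Mat m → Mat m
      conjugate R A = matrixOf (λ v → R (A ⊛ preimage R v))

    module _ {R : V → V} (lR : Linear R) (ker : ∀ x → R x ≡ 𝟎 → x ≡ 𝟎) where

      R-injective : ∀ {x y} → R x ≡ R y → x ≡ y
      R-injective = kernel-trivial⇒injective lR ker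

      R-surjective : ∀ y → ∃ λ x → R x ≡ y
      R-surjective = Finite.endo-injective⇒surjective fin R R-injective

      preimage-linear : Linear (preimage R)
      preimage-linear = record
        { ⊕-homo = λ u v → R-injective (trans (R-preimage R R-surjective _) (sym (trans (⊕-homo lR _ _) (cong₂ _⊕_ (R-preimage R R-surjective u) (R-preimage R R-surjective v)))))
        ; ·-homo = λ a v → R-injective (trans (R-preimage R R-surjective _) (sym (trans (·-homo lR a _) (cong (a ·_) (R-preimage R R-surjective v))))) }

      abstract
        conjugate-⊛ : ∀ A x → conjugate R A ⊛ R x ≡ R (A ⊛ x)
        conjugate-⊛ A x = trans (matrixOf-⊛ (∘-linear lR (∘-linear (⊛-linear A) preimage-linear)) (R x))
          (cong (λ y → R (A ⊛ y)) (R-injective (R-preimage R R-surjective (R x))))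

      conjugate-unique : ∀ A B → (∀ x → B ⊛ R x ≡ R (A ⊛ x)) → B ≡ conjugate R A
      conjugate-unique A B eq = matrix-ext B (conjugate R A) λ y → let (x , Rx) = R-surjective y in
        subst (λ y → B ⊛ y ≡ conjugate R A ⊛ y) Rx (trans (eq x) (sym (conjugate-⊛ A x)))

-- Characteristic polynomials and the orbit of the first basis vector.

module MatrixOrbits (F : FiniteField) {d : ℕ} (1≤d : 1 ℕ.≤ d) where
  open LinearAlgebra F
  open Polynomials F
  open Determinants F
  open Orbits F

  module _ (T : Mat (suc d)) where
    private
      ε : Vec Carrier (suc d)
      ε = basis zero

      module P = PrimitiveOrbit {suc d} (⊛-linear T) {ε} (basis-≢𝟎 zero) {charPoly T} (charPoly-monic T) (charPoly-annihilates T)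

    abstract
      primitive⇒orbit : Primitive (suc d) (charPoly T) → Orb (T ⊛_) ε
      primitive⇒orbit = P.primitive⇒orb (s≤s 1≤d)

      orbit⇒primitive : Orb (T ⊛_) ε → Primitive (suc d) (charPoly T)
      orbit⇒primitive orb = P.FromOrb.orb⇒primitive orb (s≤s z≤n)

      -- Under a full orbit the annihilator of ε consists of multiples of χ, and the same χ
      -- annihilates ε under T′.
      kernel-⊆ : Orb (T ⊛_) ε → ∀ T′ → norm (charPoly T) ≡ norm (charPoly T′) → ∀ p → act (T ⊛_) p ε ≡ 𝟎 → act (T′ ⊛_) p ε ≡ 𝟎
      kernel-⊆ orb T′ eq p pε≡𝟎 = act-multiple (⊛-linear T′) (charPoly T′) (charPoly T) p ε (sym eq) (charPoly-annihilates T′) (P.FromOrb.kernel orb p pε≡𝟎)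

      -- The characteristic polynomial of T′ annihilates ε under T as well, and only one monic
      -- polynomial of degree d + 1 does so.
      charPoly-unique : Orb (T ⊛_) ε → ∀ T′ → (∀ p → act (T′ ⊛_) p ε ≡ 𝟎 → act (T ⊛_) p ε ≡ 𝟎) → norm (charPoly T) ≡ norm (charPoly T′)
      charPoly-unique orb T′ kernel-⊇ = sym (~⇒≈ₚ (charPoly T′) (charPoly T)
        (P.FromOrb.annihilator-unique orb (charPoly T′) (charPoly-monic T′) (kernel-⊇ (charPoly T′) (charPoly-annihilates T′))))

-- The fibres of T ↦ χ on primitive TSR matrices and their size.

module TSRCount (F : FiniteField) (n m′ : ℕ) (2≤m : 2 ℕ.≤ suc m′) where
  open LinearAlgebra F
  open Polynomials F
  open Determinants F
  open Orbits F
  open ShiftOperators F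
  open Rigidity F
  open Frames F
  open ListCounting

  m k : ℕ
  m = suc m′
  k = suc n ℕ.* m

  1≤k : 1 ℕ.≤ k
  1≤k = s≤s z≤n

  2≤k : 2 ℕ.≤ k
  2≤k = ℕₚ.≤-trans 2≤m (ℕₚ.m≤m+n m _)

  w : Vec Carrier m
  w = basis zero

  w≢𝟎 : w ≢ 𝟎
  w≢𝟎 = basis-≢𝟎 zero

  ε : Vec Carrier k
  ε = basis zero

  ε≢𝟎 : ε ≢ 𝟎
  ε≢𝟎 = basis-≢𝟎 {k} zero

  open MatrixOrbits F (ℕₚ.≤-pred 2≤k)

  Coefficients : Set
  Coefficients = Vec Carrier (suc n)

  shiftOf : Coefficients → Mat m → Blocks {n} {m} → Blocks
  shiftOf c A = shift c (A ⊛_)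

  tsr : Coefficients → Mat m → Mat k
  tsr = tsrMatrix m (suc n)

  module _ (c : Coefficients) (A : Mat m) where

    act-blocks : ∀ p → toBlocks (act (tsr c A ⊛_) p ε) ≡ act (shiftOf c A) p (at zero w)
    act-blocks p = trans (act-commute (toBlocks-linear {n} {m}) (toBlocks-tsr c A) p ε) (cong (act (shiftOf c A) p) toBlocks-basis)

    act-blocks-𝟎⁺ : ∀ p → act (tsr c A ⊛_) p ε ≡ 𝟎 → act (shiftOf c A) p (at zero w) ≡ 𝟎
    act-blocks-𝟎⁺ p eq = trans (sym (act-blocks p)) (trans (cong toBlocks eq) (𝟎-homo (toBlocks-linear {n} {m})))

    act-blocks-𝟎⁻ : ∀ p → act (shiftOf c A) p (at zero w) ≡ 𝟎 → act (tsr c A ⊛_) p ε ≡ 𝟎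
    act-blocks-𝟎⁻ p eq = toBlocks-injective {n} {m} (trans (act-blocks p) (trans eq (sym (𝟎-homo (toBlocks-linear {n} {m})))))

    orbit-blocks⁺ : Orb (tsr c A ⊛_) ε → Orb (shiftOf c A) (at zero w)
    orbit-blocks⁺ orb = subst (Orb (shiftOf c A)) toBlocks-basis
      (orb-transport {T = tsr c A ⊛_} {T′ = shiftOf c A} {ε = ε} (toBlocks-linear {n} {m}) (toBlocks-tsr c A) (λ v → fromBlocks v , toBlocks-fromBlocks v) orb)

    orbit-blocks⁻ : Orb (shiftOf c A) (at zero w) → Orb (tsr c A ⊛_) ε
    orbit-blocks⁻ orb = orb-transport⁻¹ {T = tsr c A ⊛_} {T′ = shiftOf c A} {ε = ε} (toBlocks-linear {n} {m}) (toBlocks-tsr c A) (toBlocks-injective {n} {m})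
      (subst (Orb (shiftOf c A)) (sym toBlocks-basis) orb)

  tsr≡⇒shift≡ : ∀ c A c′ A′ → tsr c A ≡ tsr c′ A′ → ∀ v → shiftOf c A v ≡ shiftOf c′ A′ v
  tsr≡⇒shift≡ c A c′ A′ eq v = subst (λ v → shiftOf c A v ≡ shiftOf c′ A′ v) (toBlocks-fromBlocks v)
    (trans (sym (toBlocks-tsr c A (fromBlocks v))) (trans (cong (λ T → toBlocks (T ⊛ fromBlocks v)) eq) (toBlocks-tsr c′ A′ (fromBlocks v))))

  shift≡⇒tsr≡ : ∀ c A c′ A′ → (∀ v → shiftOf c A v ≡ shiftOf c′ A′ v) → tsr c A ≡ tsr c′ A′
  shift≡⇒tsr≡ c A c′ A′ eq = matrix-ext (tsr c A) (tsr c′ A′) λ x → toBlocks-injective {n} {m}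
    (trans (toBlocks-tsr c A x) (trans (eq (toBlocks x)) (sym (toBlocks-tsr c′ A′ x))))

  -- The entry c₀ = 1 is left out, which removes the freedom of rescaling c against A.
  Parameters : Set
  Parameters = Vec Carrier n × Mat m

  parameters-finite : Finite Parameters
  parameters-finite = ×-finite (vector-finite n) (Vec-finite (vector-finite m) m)

  coefficients : Parameters → Coefficients
  coefficients (c , _) = 1# ∷ c

  block : Parameters → Mat m
  block = proj₂

  matrix : Parameters → Mat k
  matrix x = tsr (coefficients x) (block x)

  Good : Parameters → Set
  Good x = Orb (shiftOf (coefficients x) (block x)) (at zero w)

  good? : ∀ x → Dec (Good x)
  good? x = Dec.map′ (orbit-blocks⁺ (coefficients x) (block x)) (orbit-blocks⁻ (coefficients x) (block x))
    (orb? (vector-finite k) (⊛-linear (matrix x)) ε≢𝟎)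

  abstract
    χ : Parameters → Poly
    χ x = norm (charPoly (matrix x))

    χ≡ : ∀ x → χ x ≡ norm (charPoly (matrix x))
    χ≡ x = refl

  good⇒TSRP : ∀ x → Good x → TSRP m (suc n) (matrix x)
  good⇒TSRP x good = (coefficients x , block x , refl) , orbit⇒primitive (matrix x) (orbit-blocks⁻ (coefficients x) (block x) good)

  -- The pairs (c , A) and (a⁻¹c , aA) define the same matrix, and c₀ ≠ 0 when the orbit is full.
  normalise : ∀ c A → Orb (shiftOf c A) (at zero w) → ∃ λ x → tsr c A ≡ matrix x × Good x
  normalise (a ∷ c) A orb with a ≟ 0#
  ... | yes refl = ⊥-elim (w≢𝟎 (trans (sym (lookup-at {n} zero w)) (trans (cong (λ v → lookup v zero) (sym (proj₂ return)))
          (trans (lookup-shift (0# ∷ c) (A ⊛_) previousState zero) (trans (⊕-identityˡ (0# · (A ⊛ lookup previousState (fromℕ n)))) (0·v≡𝟎 (A ⊛ lookup previousState (fromℕ n))))))))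
    where
    return : ∃ λ j → iter (shiftOf (0# ∷ c) A) (suc j) (at zero w) ≡ at zero w
    return = orb (at zero w) (at-≢𝟎 {n} zero w≢𝟎)
    previousState : Blocks {n} {m}
    previousState = iter (shiftOf (0# ∷ c) A) (proj₁ return) (at zero w)
  ... | no a≢0 with inverse a a≢0
  ...   | b , ab≡1 = x , shift≡⇒tsr≡ (a ∷ c) A (coefficients x) (block x) same , orb-same
    where
    x : Parameters
    x = b · c , a · A
    scaled-⊛ : ∀ u → (a · A) ⊛ u ≡ a · (A ⊛ u)
    scaled-⊛ u = lookup-ext λ r → trans (lookup-⊛ (a · A) u r) (trans (∑-cong λ s → trans (cong (_* lookup u s) (entry-scaled r s)) (*-assoc a _ _))
      (trans (sym (∑-homo (·-linear a) (λ s → entry A r s * lookup u s))) (sym (trans (Vecₚ.lookup-map r (a *_) (A ⊛ u)) (cong (a *_) (lookup-⊛ A u r))))))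
      where
      entry-scaled : ∀ r s → entry (a · A) r s ≡ a * entry A r s
      entry-scaled r s = trans (cong (λ row → lookup row s) (Vecₚ.lookup-map r (a ·_) A)) (Vecₚ.lookup-map s (a *_) (lookup A r))
    coefficient : ∀ B → lookup (coefficients x) B * a ≡ lookup (a ∷ c) B
    coefficient zero = *-identityˡ a
    coefficient (suc B) = trans (cong (_* a) (Vecₚ.lookup-map B (b *_) c)) (trans (*-comm _ a) (trans (sym (*-assoc a b _)) (trans (cong (_* lookup c B) ab≡1) (*-identityˡ _))))
    same : ∀ v → shiftOf (a ∷ c) A v ≡ shiftOf (coefficients x) (block x) v
    same v = Vecₚ.tabulate-cong λ B → cong (previous v B ⊕_) (sym (trans (cong (lookup (coefficients x) B ·_) (scaled-⊛ (lookup v (fromℕ n))))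
      (trans (sym (·-assoc _ a _)) (cong (_· (A ⊛ lookup v (fromℕ n))) (coefficient B)))))
    orb-same : Good x
    orb-same v v≢𝟎 with orb v v≢𝟎
    ... | j , eq = j , trans (sym (iter-commute {T = shiftOf (a ∷ c) A} {T′ = shiftOf (coefficients x) (block x)} {g = id} same (suc j) (at zero w))) eq

  TSRP⇒good : ∀ T → TSRP m (suc n) T → ∃ λ x → T ≡ matrix x × Good x
  TSRP⇒good T ((c , A , refl) , prim) = normalise c A (orbit-blocks⁺ c A (primitive⇒orbit (tsr c A) prim))

  matrix≡⇒χ≡ : ∀ x y → matrix x ≡ matrix y → χ x ≡ χ y
  matrix≡⇒χ≡ x y eq = trans (χ≡ x) (trans (cong (λ T → norm (charPoly T)) eq) (sym (χ≡ y)))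

  -- A is read off from the top right block, whose coefficient c₀ is one.
  matrix-injective : ∀ c A A′ → matrix (c , A) ≡ matrix (c , A′) → A ≡ A′
  matrix-injective c A A′ eq = matrix-ext A A′ λ u → trans (sym (head A u)) (trans
      (cong (λ v → lookup v zero) (tsr≡⇒shift≡ (1# ∷ c) A (1# ∷ c) A′ eq (at (fromℕ n) u))) (head A′ u))
    where
    head : ∀ A u → lookup (shiftOf (1# ∷ c) A (at (fromℕ n) u)) zero ≡ A ⊛ u
    head A u = trans (cong (λ v → lookup v zero) (shift-at-last (1# ∷ c) (⊛-linear A) u)) (1·v≡v (A ⊛ u))

  Frame : Set
  Frame = Vec (Vec Carrier m) m′

  -- The completions of w to a basis of F^m; beginning with the line of w makes every R built from
  -- them fix w.
  frames : List Frame
  frames = extensions (line w) m′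

  R : Frame → Vec Carrier m → Vec Carrier m
  R bs = combination (w ∷ bs)

  R-linear : ∀ bs → Linear (R bs)
  R-linear bs = combination-linear (w ∷ bs)

  R-fixes : ∀ bs → R bs w ≡ w
  R-fixes bs = combination-basis (w ∷ bs) zero

  R-kernel : ∀ {bs} → bs ∈ frames → ∀ u → R bs u ≡ 𝟎 → u ≡ 𝟎
  R-kernel {bs} bs∈ = independent-over-line⁻ bs w≢𝟎 (extensions-sound m′ (line-subspace w≢𝟎) bs∈)

  kernel-transfer : ∀ x y → Good x → χ x ≡ χ y → ∀ p →
    act (shiftOf (coefficients x) (block x)) p (at zero w) ≡ 𝟎 → act (shiftOf (coefficients y) (block y)) p (at zero w) ≡ 𝟎
  kernel-transfer x y good eq p px = act-blocks-𝟎⁺ (coefficients y) (block y) p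
    (kernel-⊆ (matrix x) (orbit-blocks⁻ (coefficients x) (block x) good) (matrix y) (trans (sym (χ≡ x)) (trans eq (χ≡ y))) p (act-blocks-𝟎⁻ (coefficients x) (block x) p px))

  frame-of : ∀ A A′ {S : Vec Carrier m → Vec Carrier m} → Linear S → S w ≡ w → (∀ u → S u ≡ 𝟎 → u ≡ 𝟎) →
    (∀ u → A′ ⊛ S u ≡ S (A ⊛ u)) → ∃ λ bs → bs ∈ frames × A′ ≡ conjugate (R bs) A
  frame-of A A′ {S} lS Sw≡w ker comm = bs
      , extensions-complete m′ (line-subspace w≢𝟎) bs (independent-over-line⁺ bs ker-R)
      , conjugate-unique (R-linear bs) ker-R A A′ λ u → trans (cong (A′ ⊛_) (R≡S u)) (trans (comm u) (sym (R≡S (A ⊛ u))))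
    where
    bs : Frame
    -- The columns of `S` after the first, which is w because w = e₀ is fixed.
    bs = tabulate λ i → S (basis (suc i))
    R≡S : ∀ u → R bs u ≡ S u
    R≡S = linear-ext (R-linear bs) lS λ i → trans (combination-basis (w ∷ bs) i) (column i)
      where
      column : ∀ i → lookup (w ∷ bs) i ≡ S (basis i)
      column zero = sym Sw≡w
      column (suc i) = Vecₚ.lookup∘tabulate _ i
    ker-R : ∀ u → R bs u ≡ 𝟎 → u ≡ 𝟎
    ker-R u eq = ker u (trans (sym (R≡S u)) eq)

  module _ (c : Vec Carrier n) (A : Mat m) where

    Conjugate : Vec Carrier n → Mat m → Set
    Conjugate c′ A′ = ∃ λ bs → bs ∈ frames × (c′ , A′) ≡ (c , conjugate (R bs) A)

    similar⇒conjugate : ∀ c′ A′ → 1# ∷ c ≡ 1# ∷ c′ × (∃ λ (S : Vec Carrier m → Vec Carrier m) →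
      Linear S × S w ≡ w × (∀ u → S u ≡ 𝟎 → u ≡ 𝟎) × (∀ u → A′ ⊛ S u ≡ S (A ⊛ u))) → Conjugate c′ A′
    similar⇒conjugate c′ A′ (c≡ , S , lS , Sw≡w , ker , comm) =
      let (bs , bs∈ , A′≡) = frame-of A A′ lS Sw≡w ker comm in bs , bs∈ , cong₂ _,_ (sym (Vecₚ.∷-injectiveʳ c≡)) A′≡

    same-χ⇒conjugate : ∀ c′ A′ → Good (c , A) → Good (c′ , A′) → χ (c , A) ≡ χ (c′ , A′) → Conjugate c′ A′
    same-χ⇒conjugate c′ A′ gx gy eq = similar⇒conjugate c′ A′
      (rigidity {c = 1# ∷ c} {1# ∷ c′} {A ⊛_} {A′ ⊛_} (⊛-linear A) (⊛-linear A′) w≢𝟎 gx gy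
        (kernel-transfer (c , A) (c′ , A′) gx eq) (kernel-transfer (c′ , A′) (c , A) gy (sym eq)) refl refl)

  conjugateParameters : Parameters → Frame → Parameters
  conjugateParameters (c , A) bs = c , conjugate (R bs) A

  module _ (x : Parameters) (good : Good x) {bs : Frame} (bs∈ : bs ∈ frames) where
    private
      y : Parameters
      y = conjugateParameters x bs
      c : Coefficients
      c = coefficients x
      lR : Linear (R bs)
      lR = R-linear bs
      comm : ∀ v → Vec.map (R bs) (shiftOf c (block x) v) ≡ shiftOf c (block y) (Vec.map (R bs) v)
      comm = shift-map lR c {block x ⊛_} {block y ⊛_} (λ u → sym (conjugate-⊛ lR (R-kernel bs∈) (block x) u))
      start : Vec.map (R bs) (at {n} zero w) ≡ at zero w
      start = trans (map-at lR zero w) (cong (at zero) (R-fixes bs))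

    -- 1 ⊗ R is onto, fixes ε and intertwines the two shifts, so it carries the full orbit over.
    conjugate-good : Good (conjugateParameters x bs)
    conjugate-good = subst (Orb (shiftOf c (block y))) start (orb-transport {T = shiftOf c (block x)} {T′ = shiftOf c (block y)} {ε = at zero w} (map-linear lR) comm surjective good)
      where
      surjective : ∀ v → ∃ λ u → Vec.map (R bs) u ≡ v
      surjective v = Vec.map (preimage (R bs)) v , trans (sym (Vecₚ.map-∘ (R bs) (preimage (R bs)) v))
        (trans (Vecₚ.map-cong (R-preimage (R bs) (R-surjective lR (R-kernel bs∈))) v) (Vecₚ.map-id v))

    -- Applying 1 ⊗ R to p(T) ε = 0 yields the same relation for the conjugate, and this inclusion
    -- of annihilators determines the characteristic polynomial.
    conjugate-χ : χ (conjugateParameters x bs) ≡ χ x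
    conjugate-χ = trans (χ≡ y) (trans (charPoly-unique (matrix y) (orbit-blocks⁻ c (block y) conjugate-good) (matrix x) kernel-⊇) (sym (χ≡ x)))
      where
      kernel-⊇ : ∀ p → act (matrix x ⊛_) p ε ≡ 𝟎 → act (matrix y ⊛_) p ε ≡ 𝟎
      kernel-⊇ p px = act-blocks-𝟎⁻ c (block y) p (trans (cong (act (shiftOf c (block y)) p) (sym start))
        (trans (sym (act-commute (map-linear lR) comm p (at zero w)))
          (trans (cong (Vec.map (R bs)) (act-blocks-𝟎⁺ c (block x) p px)) (𝟎-homo (map-linear {n} lR)))))

    -- R is determined on A-polynomials applied to w, and these exhaust the space.
    conjugate-injective : ∀ {bs′} → bs′ ∈ frames → conjugate (R bs) (block x) ≡ conjugate (R bs′) (block x) → bs ≡ bs′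
    conjugate-injective {bs′} bs′∈ eq = lookup-ext λ i → trans (sym (combination-basis (w ∷ bs) (suc i)))
        (trans (R≡R′ (basis (suc i))) (combination-basis (w ∷ bs′) (suc i)))
      where
      A : Mat m
      A = block x
      B : Mat m
      B = conjugate (R bs′) A
      image : ∀ {bs} → bs ∈ frames → conjugate (R bs) A ≡ B → ∀ p → R bs (act (A ⊛_) p w) ≡ act (B ⊛_) p w
      image {bs} bs∈ eq p = trans (act-commute (R-linear bs) (λ u → trans (sym (conjugate-⊛ (R-linear bs) (R-kernel bs∈) A u)) (cong (_⊛ R bs u) eq)) p w)
        (cong (act (B ⊛_) p) (R-fixes bs))
      R≡R′ : ∀ u → R bs u ≡ R bs′ u
      R≡R′ u with ShiftOrbit.irreducible c (⊛-linear A) w≢𝟎 good u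
      ... | p , refl = trans (image bs∈ eq p) (sym (image bs′∈ refl p))

  goods : List Parameters
  goods = List.filter good? (Finite.all parameters-finite)

  -- One parameter pair for each characteristic polynomial; the length of this list is the number of
  -- polynomials in the theorem.
  reps : List Parameters
  reps = representatives (Listₚ.≡-dec _≟_) χ goods

  rep-good : ∀ {x} → x ∈ reps → Good x
  rep-good x∈ = proj₂ (∈ₚ.∈-filter⁻ good? {xs = Finite.all parameters-finite} (representatives-⊆ (Listₚ.≡-dec _≟_) χ goods x∈))

  rep-cover : ∀ x → Good x → ∃ λ r → r ∈ reps × χ x ≡ χ r
  rep-cover x good = representatives-cover (Listₚ.≡-dec _≟_) χ goods (∈ₚ.∈-filter⁺ good? (Finite.all-complete parameters-finite x) good)

  conjugates : Parameters → List (Mat k)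
  conjugates x = List.map (λ bs → matrix (conjugateParameters x bs)) frames

  conjugates-unique : ∀ x → Good x → Unique (conjugates x)
  conjugates-unique x good = AllPairsₚ.map⁺ (AllPairs.map distinct (allPairs-with (All.tabulate id) (extensions-unique (line w) m′)))
    where
    distinct : ∀ {bs bs′} → bs ∈ frames × bs′ ∈ frames × bs ≢ bs′ →
      matrix (conjugateParameters x bs) ≢ matrix (conjugateParameters x bs′)
    distinct {bs} {bs′} (bs∈ , bs′∈ , ne) eq = ne (conjugate-injective x good bs∈ bs′∈
      (matrix-injective (proj₁ x) (conjugate (R bs) (block x)) (conjugate (R bs′) (block x)) eq))

  ∈-conjugates⁻ : ∀ {x T} → T ∈ conjugates x → ∃ λ bs → bs ∈ frames × T ≡ matrix (conjugateParameters x bs)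
  ∈-conjugates⁻ {x} T∈ = ∈ₚ.∈-map⁻ (λ bs → matrix (conjugateParameters x bs)) T∈

  conjugates-disjoint : ∀ {x y} → Good x × Good y × χ x ≢ χ y → Disjoint (conjugates x) (conjugates y)
  conjugates-disjoint {x} {y} (gx , gy , ne) (T∈x , T∈y) =
    let (bs , bs∈ , eq) = ∈-conjugates⁻ {x} T∈x
        (bs′ , bs′∈ , eq′) = ∈-conjugates⁻ {y} T∈y
    in ne (trans (sym (conjugate-χ x gx bs∈)) (trans (matrix≡⇒χ≡ (conjugateParameters x bs) (conjugateParameters y bs′) (trans (sym eq) eq′)) (conjugate-χ y gy bs′∈)))

  -- The conjugates of a representative are its whole fibre: rigidity puts every matrix with the
  -- same polynomial among them, and fibres over different polynomials are disjoint.
  TSRP-size : HasSize (TSRP m (suc n)) (length reps ℕ.* length frames)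
  TSRP-size = List.concatMap conjugates reps
      , concatMap-length conjugates (length frames) reps (λ _ → Listₚ.length-map _ frames)
      , concatMap-unique conjugates (λ {x} x∈ → conjugates-unique x (rep-good x∈))
          (AllPairs.map conjugates-disjoint (allPairs-with (All.tabulate rep-good) (representatives-distinct (Listₚ.≡-dec _≟_) χ goods)))
      , λ T → mk⇔ sound (complete′ T)
    where
    sound : ∀ {T} → T ∈ List.concatMap conjugates reps → TSRP m (suc n) T
    sound T∈ =
      let (x , x∈ , T∈x) = ∈-concatMap⁻ conjugates {xs = reps} T∈
          (bs , bs∈ , eq) = ∈-conjugates⁻ {x} T∈x
      in subst (TSRP m (suc n)) (sym eq) (good⇒TSRP (conjugateParameters x bs) (conjugate-good x (rep-good x∈) bs∈))
    complete′ : ∀ T → TSRP m (suc n) T → T ∈ List.concatMap conjugates reps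
    complete′ T tsrp =
      let (y , T≡ , gy) = TSRP⇒good T tsrp
          (r , r∈ , eq) = rep-cover y gy
          (bs , bs∈ , y≡) = same-χ⇒conjugate (proj₁ r) (proj₂ r) (proj₁ y) (proj₂ y) (rep-good r∈) gy (sym eq)
      in subst (_∈ List.concatMap conjugates reps) (sym (trans T≡ (cong matrix y≡)))
           (∈-concatMap⁺ conjugates r∈ (∈ₚ.∈-map⁺ (λ bs → matrix (conjugateParameters r bs)) bs∈))

  PsiP-size : HasSize (PsiP m (suc n)) (length reps)
  PsiP-size = List.map χ reps , Listₚ.length-map χ reps
      , AllPairsₚ.map⁺ (representatives-distinct (Listₚ.≡-dec _≟_) χ goods)
      , λ f → mk⇔ sound complete′
    where
    sound : ∀ {f} → f ∈ List.map χ reps → PsiP m (suc n) f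
    sound f∈ = let (x , x∈ , eq) = ∈ₚ.∈-map⁻ χ f∈ in matrix x , good⇒TSRP x (rep-good x∈) , trans eq (χ≡ x)
    complete′ : ∀ {f} → PsiP m (suc n) f → f ∈ List.map χ reps
    complete′ (T , tsrp , f≡) =
      let (y , T≡ , gy) = TSRP⇒good T tsrp
          (r , r∈ , eq) = rep-cover y gy
      in subst (_∈ List.map χ reps) (trans (sym eq) (trans (χ≡ y) (trans (cong (λ T → norm (charPoly T)) (sym T≡)) (sym f≡)))) (∈ₚ.∈-map⁺ χ r∈)

  -- The line of w has q^1 elements, so the product starts at exponent one, matching
  -- `drop 1 (upTo m)`, which unfolds to `applyUpTo suc m′`.
  frames-length : length frames ≡ glFactor (card F) m
  frames-length = trans (extensions-length 1 m′ (line-subspace w≢𝟎) (trans (Listₚ.length-map _ elements) (sym (ℕₚ.*-identityʳ (card F)))))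
    (sym (fallingProduct-applyUpTo 1 m′ suc λ _ → refl))

open import Data.Nat using (_≤_; _*_)

theorem3p2 : (F : FiniteField) (m n : ℕ) → 3 ≤ card F → 2 ≤ m → Odd n →
    ∃[ N ] ∃[ M ] (HasSize (FieldTheory.TSRP F m n) N
    × HasSize (FieldTheory.PsiP F m n) M
    × N ≡ M * glFactor (card F) m)
theorem3p2 F (suc m′) n _ 2≤m (k , refl) = _ , _ , TSRP-size , PsiP-size , cong (length reps *_) frames-length
  -- `TSRCount` treats the order `suc n`, so 2 k + 1 enters as `2 * k`.
  where open TSRCount F (2 * k) m′ 2≤m
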